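{- Suppose that the following (the nonnegativity conjecture of Fomin and Kirillov) holds: for every $n\ge 2$ and every $w\in S_n$, the element $\mathfrak S_w(\theta)\in FK_n$, obtained from the Schubert polynomial $\mathfrak S_w(x_1,\dots,x_n)$ by substituting $x_i\mapsto\theta_i$, where $\theta_1,\dots,\theta_n$ are the Dunkl elements of the Fomin--Kirillov algebra $FK_n$, can be written as a linear combination with nonnegative coefficients of noncommutative monomials $[i_1j_1][i_2j_2]\cdots[i_mj_m]$ with $i_a<j_a$ for all $a$. Then the Chern--Schwartz--MacPherson classes of Schubert cells in type $A$ flag varieties are nonnegative: for every $n\ge 2$ and all $w,v\in S_n$, the coefficient $c(w;v)$ in the expansion $c_{SM}(X(w)^\circ)=\sum_{v\in S_n}c(w;v)[X(v)]$ satisfies $c(w;v)\ge 0$.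
   Context: Fomin--Kirillov algebra: $FK_n$ is the associative unital algebra generated by $[ij]$, $1\le i<j\le n$, with the convention $[ji]=-[ij]$, subject to: $[ij]^2=0$; $[ij][kl]=[kl][ij]$ for distinct $i,j,k,l$; $[ij][jk]=[jk][ik]+[ik][ij]$ and $[jk][ij]=[ik][jk]+[ij][ik]$ for distinct $i,j,k$. The Dunkl elements are $\theta_i=\sum_{j\ne i}[ij]$, $1\le i\le n$; they commute pairwise, so polynomials can be evaluated at them. Schubert polynomials: $\mathfrak S_{w_0}=x_1^{n-1}x_2^{n-2}\cdots x_{n-1}$ for the longest element $w_0\in S_n$, and $\mathfrak S_{ws_k}=\partial_k\mathfrak S_w$ if $\ell(ws_k)<\ell(w)$, where $\partial_k f=(f-s_kf)/(x_k-x_{k+1})$, $s_k=(k\ k{+}1)$ and $\ell$ is the length function. CSM classes: let $X=SL_n(\mathbb C)/B$, with $B$ the upper triangular matrices, $X(w)^\circ=BwB/B$ (Schubert cell) and $X(w)=\overline{BwB/B}$ (Schubert variety). The classes $[X(w)]$, $w\in S_n$, form a basis of $H_*(X)$. The CSM class is $c_{SM}(X(w)^\circ)=c_*(\mathbb 1_{X(w)^\circ})\in H_*(X)$, where $c_*$ is MacPherson's natural transformation from constructible functions to homology. It is known (Aluffi--Mihalcea) that these classes are determined by $c_{SM}(X(e)^\circ)=[X(e)]$ and $T_k(c_{SM}(X(w)^\circ))=c_{SM}(X(ws_k)^\circ)$ for all $w\in S_n$, $1\le k\le n-1$, where $T_k=\partial_k-s_k$ on $H_*(X)$; here $\partial_k[X(w)]=[X(ws_k)]$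 if $\ell(ws_k)>\ell(w)$ and $0$ otherwise, $s_k=\mathrm{id}-c_1(\mathcal L_{\alpha_k})\partial_k$, and $c_1(\mathcal L_\lambda)\cdot[X(w)]=\sum_\beta\langle\lambda,\beta^\vee\rangle[X(ws_\beta)]$, summed over positive roots $\beta$ with $\ell(ws_\beta)=\ell(w)-1$. The simple roots are $\alpha_k=\varepsilon_k-\varepsilon_{k+1}$, and for $\beta=\varepsilon_a-\varepsilon_b$ with $a<b$, $s_\beta$ is the transposition $(a\ b)$. -}

module Defs where

open import Data.Bool.Base using (if_then_else_)
open import Data.Fin.Base using (Fin; suc; inject₁; toℕ; _<_)
open import Data.Fin.Permutation
  using (Permutation′; _⟨$⟩ʳ_; _∘ₚ_; transpose; reverse)
  renaming (_≈_ to _≈ₚ_; id to idₚ)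
open import Data.Fin.Properties using (_≟_; _<?_; <-cmp; all?)
open import Data.Integer.Base as ℤ using (ℤ; 0ℤ; 1ℤ)
open import Data.List.Base
  using (List; []; _∷_; _++_; map; foldr; filter; length; concatMap; allFin; cartesianProduct)
open import Data.List.Relation.Unary.All using (All)
open import Data.List.Relation.Unary.Unique.Propositional using (Unique)
open import Data.Nat.Base as ℕ using (ℕ; zero; suc; pred; _∸_)
import Data.Nat.Properties as ℕₚ
open import Data.Product.Base using (_×_; _,_; Σ-syntax; ∃-syntax)
open import Data.Rational.Base as ℚ using (ℚ; 0ℚ; 1ℚ)
open import Level using (0ℓ)
open import Relation.Binary.Core using (Rel)
open import Relation.Binary.Definitions using (tri<; tri≈; tri>)
open import Relation.Binary.PropositionalEquality using (_≡_)
open import Relation.Nullary.Decidable using (Dec; does; ¬?)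

private
  variable
    G K : Set
    n : ℕ

------------------------------------------------------------------------
-- Associative unital ℚ-algebras given by generators and relations.
-- Elements are expressions; equality is the congruence generated by the
-- algebra axioms and the relations.
--
-- The base ring is ℚ: an expansion with nonnegative integer coefficients
-- over ℤ yields one over ℚ, so ℚ gives the weaker positivity property.

infix  8 ⊝_
infixl 7 _⊗_
infixl 6 _⊕_ _⊖_

data Expr (G : Set) : Set where
  gen     : G → Expr G
  con     : ℚ → Expr G
  _⊕_ _⊗_ : Expr G → Expr G → Expr G
  ⊝_      : Expr G → Expr G

_⊖_ : Expr G → Expr G → Expr G
a ⊖ b = a ⊕ ⊝ b

data Quotient (_∼_ : Rel (Expr G) 0ℓ) : Rel (Expr G) 0ℓ where
  relation    : ∀ {a b} → a ∼ b → Quotient _∼_ a b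

  refl        : ∀ {a} → Quotient _∼_ a a
  sym         : ∀ {a b} → Quotient _∼_ a b → Quotient _∼_ b a
  trans       : ∀ {a b c} → Quotient _∼_ a b → Quotient _∼_ b c → Quotient _∼_ a c
  ⊕-cong      : ∀ {a a′ b b′} → Quotient _∼_ a a′ → Quotient _∼_ b b′ → Quotient _∼_ (a ⊕ b) (a′ ⊕ b′)
  ⊗-cong      : ∀ {a a′ b b′} → Quotient _∼_ a a′ → Quotient _∼_ b b′ → Quotient _∼_ (a ⊗ b) (a′ ⊗ b′)
  ⊝-cong      : ∀ {a a′} → Quotient _∼_ a a′ → Quotient _∼_ (⊝ a) (⊝ a′)

  ⊕-assoc     : ∀ a b c → Quotient _∼_ ((a ⊕ b) ⊕ c) (a ⊕ (b ⊕ c))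
  ⊕-comm      : ∀ a b → Quotient _∼_ (a ⊕ b) (b ⊕ a)
  ⊕-identityˡ : ∀ a → Quotient _∼_ (con 0ℚ ⊕ a) a
  ⊝-inverseˡ  : ∀ a → Quotient _∼_ (⊝ a ⊕ a) (con 0ℚ)
  ⊗-assoc     : ∀ a b c → Quotient _∼_ ((a ⊗ b) ⊗ c) (a ⊗ (b ⊗ c))
  ⊗-identityˡ : ∀ a → Quotient _∼_ (con 1ℚ ⊗ a) a
  ⊗-identityʳ : ∀ a → Quotient _∼_ (a ⊗ con 1ℚ) a
  distribˡ    : ∀ a b c → Quotient _∼_ (a ⊗ (b ⊕ c)) (a ⊗ b ⊕ a ⊗ c)
  distribʳ    : ∀ a b c → Quotient _∼_ ((b ⊕ c) ⊗ a) (b ⊗ a ⊕ c ⊗ a)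

  con-+       : ∀ p q → Quotient _∼_ (con (p ℚ.+ q)) (con p ⊕ con q)
  con-*       : ∀ p q → Quotient _∼_ (con (p ℚ.* q)) (con p ⊗ con q)
  con-central : ∀ q a → Quotient _∼_ (con q ⊗ a) (a ⊗ con q)

substitute : (G → Expr K) → Expr G → Expr K
substitute σ (gen g) = σ g
substitute σ (con q) = con q
substitute σ (a ⊕ b) = substitute σ a ⊕ substitute σ b
substitute σ (a ⊗ b) = substitute σ a ⊗ substitute σ b
substitute σ (⊝ a)   = ⊝ substitute σ a

sum : List (Expr G) → Expr G
sum = foldr _⊕_ (con 0ℚ)

product : List (Expr G) → Expr G
product = foldr _⊗_ (con 1ℚ)

power : Expr G → ℕ → Expr G
power a zero    = con 1ℚ
power a (suc m) = a ⊗ power a m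

------------------------------------------------------------------------
-- The symmetric group

infixl 9 _·_

-- (u · w)(i) = u (w i), so that w · t permutes positions.
_·_ : Permutation′ n → Permutation′ n → Permutation′ n
u · w = w ∘ₚ u

_≟ₚ_ : (u w : Permutation′ n) → Dec (u ≈ₚ w)
u ≟ₚ w = all? (λ i → (u ⟨$⟩ʳ i) ≟ (w ⟨$⟩ʳ i))

-- The pair (a , b), a < b, stands for the positive root ε_a − ε_b.
positiveRoots : ∀ n → List (Fin n × Fin n)
positiveRoots n =
  filter (λ (a , b) → a <? b) (cartesianProduct (allFin n) (allFin n))

ℓ : Permutation′ n → ℕ
ℓ {n} w =
  length (filter (λ (a , b) → (w ⟨$⟩ʳ b) <? (w ⟨$⟩ʳ a)) (positiveRoots n))

-- The index k : Fin (pred n) of a simple reflection exchanges the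
-- positions k ⁻ and k ⁺, which are k and k + 1.
infix 10 _⁻ _⁺

_⁻ _⁺ : Fin (pred n) → Fin n
_⁻ {suc _} k = inject₁ k
_⁺ {suc _} k = suc k

s : Fin (pred n) → Permutation′ n
s k = transpose (k ⁻) (k ⁺)

------------------------------------------------------------------------
-- Schubert polynomials

Poly : ℕ → Set
Poly n = Expr (Fin n)

data Commute {n} : Rel (Poly n) 0ℓ where
  commute : ∀ i j → Commute (gen i ⊗ gen j) (gen j ⊗ gen i)

infix 4 _≈[x]_

_≈[x]_ : Rel (Poly n) 0ℓ
_≈[x]_ = Quotient Commute

act : Permutation′ n → Poly n → Poly n
act w = substitute (λ i → gen (w ⟨$⟩ʳ i))

-- x₁ⁿ⁻¹ x₂ⁿ⁻² ⋯ xₙ₋₁, with Fin n counting from 0.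
staircase : ∀ n → Poly n
staircase n = product (map (λ i → power (gen i) (n ∸ suc (toℕ i))) (allFin n))

-- g = ∂ₖ f.  As the polynomial ring is a domain, this determines g.
DividedDifference : Fin (pred n) → Poly n → Poly n → Set
DividedDifference k f g =
  (gen (k ⁻) ⊖ gen (k ⁺)) ⊗ g ≈[x] f ⊖ act (s k) f

-- f represents the Schubert polynomial of w.
data IsSchubert {n} : Permutation′ n → Poly n → Set where
  longest : ∀ {w f} → w ≈ₚ reverse → f ≈[x] staircase n → IsSchubert w f
  descent : ∀ {w f u g} (k : Fin (pred n)) →
            IsSchubert w f → ℓ (w · s k) ℕ.< ℓ w →
            u ≈ₚ w · s k → DividedDifference k f g →
            IsSchubert u g

------------------------------------------------------------------------
-- The Fomin–Kirillov algebra

FKGenerator : ℕ → Set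
FKGenerator n = Σ[ i ∈ Fin n ] Σ[ j ∈ Fin n ] i < j

FK : ℕ → Set
FK n = Expr (FKGenerator n)

-- [ij] for arbitrary i ≠ j; the value at i = j is never used.
[_,_] : Fin n → Fin n → FK n
[ i , j ] with <-cmp i j
... | tri< i<j _ _ = gen (i , j , i<j)
... | tri≈ _ _ _   = con 0ℚ
... | tri> _ _ j<i = ⊝ gen (j , i , j<i)

data FKRelation {n} : Rel (FK n) 0ℓ where
  square   : ∀ i j → Unique (i ∷ j ∷ []) →
             FKRelation ([ i , j ] ⊗ [ i , j ]) (con 0ℚ)
  disjoint : ∀ i j k l → Unique (i ∷ j ∷ k ∷ l ∷ []) →
             FKRelation ([ i , j ] ⊗ [ k , l ]) ([ k , l ] ⊗ [ i , j ])
  triple₁  : ∀ i j k → Unique (i ∷ j ∷ k ∷ []) →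
             FKRelation ([ i , j ] ⊗ [ j , k ])
                        ([ j , k ] ⊗ [ i , k ] ⊕ [ i , k ] ⊗ [ i , j ])
  triple₂  : ∀ i j k → Unique (i ∷ j ∷ k ∷ []) →
             FKRelation ([ j , k ] ⊗ [ i , j ])
                        ([ i , k ] ⊗ [ j , k ] ⊕ [ i , j ] ⊗ [ i , k ])

infix 4 _≈FK_

_≈FK_ : Rel (FK n) 0ℓ
_≈FK_ = Quotient FKRelation

θ : Fin n → FK n
θ {n} i = sum (map (λ j → [ i , j ]) (filter (λ j → ¬? (j ≟ i)) (allFin n)))

-- f(θ).  Since the θ i commute, this respects _≈[x]_ and _≈FK_.
atDunkl : Poly n → FK n
atDunkl = substitute θ

Monomial : ℕ → Set
Monomial n = List (FKGenerator n)

combination : List (ℚ × Monomial n) → FK n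
combination ts = sum (map (λ (q , m) → con q ⊗ product (map gen m)) ts)

FKNonnegative : FK n → Set
FKNonnegative {n} a =
  ∃[ ts ] All (λ ((q , _) : ℚ × Monomial n) → 0ℚ ℚ.≤ q) ts × a ≈FK combination ts

------------------------------------------------------------------------
-- Homology of the flag variety, in the basis of Schubert classes

-- A list of pairs (c , w) stands for the sum of the c [X(w)].
H : ℕ → Set
H n = List (ℤ × Permutation′ n)

coefficient : H n → Permutation′ n → ℤ
coefficient []            v = 0ℤ
coefficient ((c , w) ∷ h) v =
  (if does (w ≟ₚ v) then c else 0ℤ) ℤ.+ coefficient h v

infix 4 _≈H_

_≈H_ : Rel (H n) 0ℓ
h ≈H h′ = ∀ v → coefficient h v ≡ coefficient h′ v

[X_] : Permutation′ n → H n
[X w ] = (1ℤ , w) ∷ []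

scale : ℤ → H n → H n
scale c = map (λ (d , w) → c ℤ.* d , w)

infixl 6 _-H_

_-H_ : H n → H n → H n
h -H h′ = h ++ scale (ℤ.- 1ℤ) h′

extendLinearly : (Permutation′ n → H n) → H n → H n
extendLinearly φ = concatMap (λ (c , w) → scale c (φ w))

∂ : Fin (pred n) → H n → H n
∂ k = extendLinearly λ w →
  if does (ℓ w ℕₚ.<? ℓ (w · s k)) then [X w · s k ] else []

-- Weights, in the coordinates ε₁, …, εₙ.
Weight : ℕ → Set
Weight n = Fin n → ℤ

α : Fin (pred n) → Weight n
α k i = (if does (i ≟ k ⁻) then 1ℤ else 0ℤ) ℤ.- (if does (i ≟ k ⁺) then 1ℤ else 0ℤ)

⟨_,_⟩ : Weight n → Fin n × Fin n → ℤ
⟨ μ , (a , b) ⟩ = μ a ℤ.- μ b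

c₁ : Weight n → H n → H n
c₁ {n} μ = extendLinearly λ w →
  map (λ (a , b) → ⟨ μ , (a , b) ⟩ , w · transpose a b)
    (filter (λ (a , b) → suc (ℓ (w · transpose a b)) ℕₚ.≟ ℓ w) (positiveRoots n))

s* : Fin (pred n) → H n → H n
s* k h = h -H c₁ (α k) (∂ k h)

T : Fin (pred n) → H n → H n
T k h = ∂ k h -H s* k h

-- MacPherson's transformation is not available here: the CSM classes of
-- the Schubert cells enter through the equations of Aluffi and Mihalcea,
-- which have exactly one solution up to _≈H_.
record IsCSM {n} (c_SM : Permutation′ n → H n) : Set where
  field
    cong     : ∀ {w w′} → w ≈ₚ w′ → c_SM w ≈H c_SM w′
    identity : c_SM idₚ ≈H [X idₚ ]
    step     : ∀ w k → T k (c_SM w) ≈H c_SM (w · s k)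

{-# OPTIONS --safe #-}

-- The classes c_SM(X(w)°) are permuted by the operators T_k, which together
-- with the multiplications by x_i generate a degenerate affine Hecke algebra:
-- x_i T_k = T_k x_{s_k(i)} + ⟨ε_i, α_k⟩.  By induction on w,
--
--   x_i · c_SM(X(w)°) = Σ_{j ≠ i} ± c_SM(X(w t_ij)°),
--
-- summed over the inversions (i , j) of w, with sign + for i < j and − for
-- j < i.  The operators [ij], w ↦ w t_ij if (i , j) is an inversion and
-- w ↦ 0 otherwise, satisfy the relations of FK_n, so that θ_i acts on the
-- CSM classes as x_i does, and monomials in the [ij] with i < j take CSM
-- classes to CSM classes or 0.
--
-- The Schubert polynomial of v is dual to [X(v)]: up to a nonnegative factor,
-- the coefficient of [X(v)] in a class h is that of [X(e)] in 𝔖_v · h,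
-- because the divided difference ∂_k is adjoint to ∂_k on homology.  For
-- h = c_SM(X(w)°) it is nonnegative by the assumption on 𝔖_v(θ), since the
-- coefficient of [X(e)] in every CSM class is 1.
--
-- Homology classes are represented by the function v ↦ coefficient of [X(v)].

module Submission where

open import Defs
open import Data.Nat.Base using (ℕ; _≤_)
open import Data.Fin.Permutation using (Permutation′)
open import Data.Integer.Base using (ℤ; 0ℤ) renaming (_≤_ to _≤ℤ_)

open import Algebra.Bundles using (CommutativeMonoid; CommutativeRing; Ring)
import Algebra.Construct.Flip.Op as Flip
import Algebra.Solver.Ring as RingSolver
import Algebra.Solver.Ring.AlmostCommutativeRing as ACR
open import Data.Bool.Base using (true; false; if_then_else_)
open import Data.Fin.Base as Fin using (Fin; zero; suc; inject₁; toℕ; opposite; _<_)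
open import Data.Fin.Induction using (<-weakInduction; >-weakInduction)
open import Data.Fin.Permutation using (_⟨$⟩ʳ_; transpose; reverse) renaming (_≈_ to _≈ₚ_; id to idₚ)
import Data.Fin.Permutation.Components as PC
import Data.Fin.Properties as Finₚ
open import Data.Fin.Properties using (_≟_; _<?_; <-cmp)
open import Data.Integer.Base as ℤ using (1ℤ)
import Data.Integer.Properties as ℤₚ
open import Data.List.Base as List using (List; []; _∷_; _++_; filter; length; cartesianProduct; allFin)
import Data.List.Properties as Listₚ
open import Data.List.Relation.Unary.All using (All; []; _∷_)
open import Data.List.Relation.Unary.AllPairs using ([]; _∷_)
open import Data.Maybe.Base as Maybe using (Maybe)
open import Data.Nat.Base as ℕ using (zero; suc; _∸_)
import Data.Nat.Properties as ℕₚ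
open import Data.Product.Base using (_×_; _,_; proj₁; proj₂; ∃-syntax; Σ-syntax)
open import Data.Rational.Base as ℚ using (ℚ; 0ℚ; 1ℚ; ½; _+_; _*_; -_; _-_)
import Data.Rational.Properties as ℚₚ
open import Data.Rational.Solver using (module +-*-Solver)
open import Data.Rational.Unnormalised.Base as ℚᵘ using (mkℚᵘ; _≃_; *≤*)
import Data.Rational.Unnormalised.Properties as ℚᵘₚ
open import Data.Sum.Base as Sum using (_⊎_; inj₁; inj₂)
open import Data.Vec.Functional using (updateAt)
open import Data.Vec.Functional.Properties using (updateAt-updates; updateAt-minimal)
open import Function.Base using (_∘_; _∋_)
open import Function.Bundles using (Injection)
open import Function.Properties.Inverse using (↔⇒↣)
open import Level using (0ℓ)
open import Relation.Binary.Definitions using (tri<; tri≈; tri>)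
open import Relation.Binary.PropositionalEquality as ≡ using (_≡_; _≢_; refl; cong; cong₂; subst; module ≡-Reasoning)
open import Relation.Nullary using (¬_; Dec; yes; no; does; contradiction)
open import Relation.Nullary.Decidable using (dec-true; dec-false; _×-dec_; dec⇒maybe; ¬?)
open import Relation.Unary using (Decidable)
open +-*-Solver using (solve; _:+_; _:*_; _:-_; :-_; _:=_) renaming (con to const)

private
  variable
    n m : ℕ

-- Finite sums

if-yes : ∀ {A P : Set} (P? : Dec P) {x y : A} → P → (if does P? then x else y) ≡ x
if-yes P? p = cong (if_then _ else _) (dec-true P? p)

if-no : ∀ {A P : Set} (P? : Dec P) {x y : A} → ¬ P → (if does P? then x else y) ≡ y
if-no P? ¬p = cong (if_then _ else _) (dec-false P? ¬p)

if-cong : ∀ {A P Q : Set} (P? : Dec P) (Q? : Dec Q) {x x′ y : A} →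
          (P → Q) → (Q → P) → (P → x ≡ x′) →
          (if does P? then x else y) ≡ (if does Q? then x′ else y)
if-cong (yes p) Q? f g h = ≡.trans (h p) (≡.sym (if-yes Q? (f p)))
if-cong (no ¬p) Q? f g h = ≡.sym (if-no Q? (¬p ∘ g))

module FiniteSums (M : CommutativeMonoid 0ℓ 0ℓ) where
  open CommutativeMonoid M renaming (refl to ≈-refl; sym to ≈-sym; trans to ≈-trans)
  open import Algebra.Properties.CommutativeMonoid.Sum M public
    using (∑-distrib-+; ∑-comm; sum-permute; sum-cong-≋; sum-cong-≗; sum-replicate-zero)
    renaming (sum to ∑)

  private
    variable
      A B : Set

  ⨁ : List A → (A → Carrier) → Carrier
  ⨁ []       f = ε
  ⨁ (x ∷ xs) f = f x ∙ ⨁ xs f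

  ⨁-++ : ∀ (xs ys : List A) f → ⨁ (xs ++ ys) f ≈ ⨁ xs f ∙ ⨁ ys f
  ⨁-++ []       ys f = ≈-sym (identityˡ _)
  ⨁-++ (x ∷ xs) ys f = ≈-trans (∙-congˡ (⨁-++ xs ys f)) (≈-sym (assoc _ _ _))

  ⨁-map : ∀ (g : A → B) xs f → ⨁ (List.map g xs) f ≡ ⨁ xs (f ∘ g)
  ⨁-map g []       f = refl
  ⨁-map g (x ∷ xs) f = cong (f (g x) ∙_) (⨁-map g xs f)

  ⨁-filter : ∀ {P : A → Set} (P? : Decidable P) xs f →
             ⨁ (filter P? xs) f ≈ ⨁ xs (λ x → if does (P? x) then f x else ε)
  ⨁-filter P? []       f = ≈-refl
  ⨁-filter P? (x ∷ xs) f with does (P? x)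
  ... | true  = ∙-congˡ (⨁-filter P? xs f)
  ... | false = ≈-trans (⨁-filter P? xs f) (≈-sym (identityˡ _))

  ⨁-cartesianProduct : ∀ (xs : List A) (ys : List B) f →
                       ⨁ (cartesianProduct xs ys) f ≈ ⨁ xs (λ x → ⨁ ys (λ y → f (x , y)))
  ⨁-cartesianProduct []       ys f = ≈-refl
  ⨁-cartesianProduct (x ∷ xs) ys f =
    ≈-trans (⨁-++ (List.map (x ,_) ys) _ f)
            (∙-cong (reflexive (⨁-map (x ,_) ys f)) (⨁-cartesianProduct xs ys f))

  ⨁-tabulate : ∀ (g : Fin n → A) f → ⨁ (List.tabulate g) f ≡ ∑ (f ∘ g)
  ⨁-tabulate {zero}  g f = refl
  ⨁-tabulate {suc n} g f = cong (f (g zero) ∙_) (⨁-tabulate (g ∘ suc) f)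

  ⨁-positiveRoots : ∀ (f : Fin n × Fin n → Carrier) →
    ⨁ (positiveRoots n) f ≈ ∑ λ a → ∑ λ b → if does (a <? b) then f (a , b) else ε
  ⨁-positiveRoots f =
    ≈-trans (⨁-filter (λ (a , b) → a <? b) (cartesianProduct (allFin _) (allFin _)) f)
    (≈-trans (⨁-cartesianProduct (allFin _) (allFin _) g)
    (≈-trans (reflexive (⨁-tabulate (λ i → i) λ a → ⨁ (allFin _) λ b → g (a , b)))
             (sum-cong-≋ λ a → reflexive (⨁-tabulate (λ i → i) λ b → g (a , b)))))
    where
    g : Fin _ × Fin _ → Carrier
    g (a , b) = if does (a <? b) then f (a , b) else ε

  ∑-zero : ∀ {f : Fin n → Carrier} → (∀ i → f i ≈ ε) → ∑ f ≈ ε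
  ∑-zero {n} eq = ≈-trans (sum-cong-≋ eq) (sum-replicate-zero n)

  ∑-single : ∀ (k : Fin n) (f : Fin n → Carrier) → (∀ i → i ≢ k → f i ≈ ε) → ∑ f ≈ f k
  ∑-single zero    f z = ≈-trans (∙-congˡ (∑-zero λ i → z (suc i) λ ())) (identityʳ _)
  ∑-single (suc k) f z =
    ≈-trans (∙-cong (z zero λ ()) (∑-single k (f ∘ suc) λ i i≢k → z (suc i) (i≢k ∘ Finₚ.suc-injective)))
            (identityˡ _)

-- Permutations and their lengths

transpose-fst : ∀ (i j : Fin n) → PC.transpose i j i ≡ j
transpose-fst i j rewrite dec-true (i ≟ i) refl = refl

transpose-snd : ∀ (i j : Fin n) → PC.transpose i j j ≡ i
transpose-snd i j with j ≟ i
... | yes j≡i = j≡i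
... | no  _   rewrite dec-true (j ≟ j) refl = refl

transpose-other : ∀ {i j x : Fin n} → x ≢ i → x ≢ j → PC.transpose i j x ≡ x
transpose-other {i = i} {j} {x} x≢i x≢j
  rewrite dec-false (x ≟ i) x≢i | dec-false (x ≟ j) x≢j = refl

transpose-natural : ∀ (f : Fin n → Fin n) → (∀ {x y} → f x ≡ f y → x ≡ y) → ∀ i j x →
                    f (PC.transpose i j x) ≡ PC.transpose (f i) (f j) (f x)
transpose-natural f inj i j x with x ≟ i
... | yes refl = ≡.sym (transpose-fst (f x) (f j))
... | no  x≢i  with x ≟ j
...   | yes refl = ≡.sym (transpose-snd (f i) (f x))
...   | no  x≢j  = ≡.sym (transpose-other (x≢i ∘ inj) (x≢j ∘ inj))

transpose-comm : ∀ (i j x : Fin n) → PC.transpose i j x ≡ PC.transpose j i x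
transpose-comm i j x with x ≟ i
... | yes refl = ≡.sym (transpose-snd j x)
... | no  x≢i  with x ≟ j
...   | yes refl = refl
...   | no  x≢j  rewrite dec-false (x ≟ i) x≢i = refl

transpose-involutive : ∀ (i j x : Fin n) → PC.transpose i j (PC.transpose i j x) ≡ x
transpose-involutive i j x = ≡.trans (transpose-comm i j (PC.transpose i j x)) (PC.transpose-inverse j i {x})

perm-injective : ∀ (w : Permutation′ n) {x y} → w ⟨$⟩ʳ x ≡ w ⟨$⟩ʳ y → x ≡ y
perm-injective w = Injection.injective (↔⇒↣ w)

≈ₚ-sym : ∀ {u w : Permutation′ n} → u ≈ₚ w → w ≈ₚ u
≈ₚ-sym eq i = ≡.sym (eq i)

≈ₚ-trans : ∀ {u w x : Permutation′ n} → u ≈ₚ w → w ≈ₚ x → u ≈ₚ x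
≈ₚ-trans p q i = ≡.trans (p i) (q i)

·-congˡ : ∀ {u w : Permutation′ n} (t : Permutation′ n) → u ≈ₚ w → u · t ≈ₚ w · t
·-congˡ t eq i = eq (t ⟨$⟩ʳ i)

·-transpose-involutive : ∀ (w : Permutation′ n) i j → w · transpose i j · transpose i j ≈ₚ w
·-transpose-involutive w i j x = cong (w ⟨$⟩ʳ_) (transpose-involutive i j x)

·-transpose-comm : ∀ (w : Permutation′ n) i j → w · transpose i j ≈ₚ w · transpose j i
·-transpose-comm w i j x = cong (w ⟨$⟩ʳ_) (transpose-comm i j x)

·-conjugate : ∀ (w t : Permutation′ n) i j →
              w · t · transpose i j ≈ₚ w · transpose (t ⟨$⟩ʳ i) (t ⟨$⟩ʳ j) · t
·-conjugate w t i j x = cong (w ⟨$⟩ʳ_) (transpose-natural (t ⟨$⟩ʳ_) (perm-injective t) i j x)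

·-transpose-swap : ∀ {u w : Permutation′ n} i j → u ≈ₚ w · transpose i j → w ≈ₚ u · transpose i j
·-transpose-swap {u = u} {w} i j eq x =
  ≡.trans (≡.sym (·-transpose-involutive w i j x)) (≡.sym (eq (transpose i j ⟨$⟩ʳ x)))

s-involutive : ∀ (k : Fin m) x → s {suc m} k ⟨$⟩ʳ (s {suc m} k ⟨$⟩ʳ x) ≡ x
s-involutive k = transpose-involutive (inject₁ k) (suc k)

s-involutiveʳ : ∀ (w : Permutation′ (suc m)) k → w · s k · s k ≈ₚ w
s-involutiveʳ w k = ·-transpose-involutive w (inject₁ k) (suc k)

inject₁<suc : ∀ (k : Fin m) → inject₁ k < suc k
inject₁<suc k = ℕ.s≤s (ℕₚ.≤-reflexive (Finₚ.toℕ-inject₁ k))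

inject₁≢suc : ∀ (k : Fin m) → inject₁ k ≢ suc k
inject₁≢suc k = Finₚ.<⇒≢ (inject₁<suc k)

above-inject₁ : ∀ {k : Fin m} {x} → inject₁ k < x → x ≢ suc k → suc k < x
above-inject₁ {k = k} lt x≢ =
  ℕₚ.≤∧≢⇒< (subst (ℕ._< _) (Finₚ.toℕ-inject₁ k) lt) (x≢ ∘ ≡.sym ∘ Finₚ.toℕ-injective)

below-suc : ∀ {k : Fin m} {x} → x < suc k → x ≢ inject₁ k → x < inject₁ k
below-suc {k = k} (ℕ.s≤s le) x≢ =
  ℕₚ.≤∧≢⇒< (subst (_ ℕ.≤_) (≡.sym (Finₚ.toℕ-inject₁ k)) le) (x≢ ∘ Finₚ.toℕ-injective)

s-preserves-< : ∀ (k : Fin m) {a b} → a < b → ¬ (a ≡ inject₁ k × b ≡ suc k) →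
                s {suc m} k ⟨$⟩ʳ a < s {suc m} k ⟨$⟩ʳ b
s-preserves-< k {a} {b} a<b ¬up = go (a ≟ inject₁ k) (a ≟ suc k) (b ≟ inject₁ k) (b ≟ suc k)
  where
  t = PC.transpose (inject₁ k) (suc k)
  fst = transpose-fst (inject₁ k) (suc k)
  snd = transpose-snd (inject₁ k) (suc k)
  _≪_ : ∀ {x y x′ y′ : Fin (suc _)} → x ≡ x′ → y ≡ y′ → x′ < y′ → x < y
  _≪_ refl refl lt = lt
  go : Dec (a ≡ inject₁ k) → Dec (a ≡ suc k) → Dec (b ≡ inject₁ k) → Dec (b ≡ suc k) → t a < t b
  go (yes refl) _ (yes b≡) _ = contradiction b≡ (Finₚ.<⇒≢ a<b ∘ ≡.sym)
  go (yes refl) _ _ (yes b≡) = contradiction (refl , b≡) ¬up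
  go (yes refl) _ (no b≢⁻) (no b≢⁺) = (fst ≪ transpose-other b≢⁻ b≢⁺) (above-inject₁ a<b b≢⁺)
  go (no a≢⁻) (yes refl) (yes refl) _ = contradiction a<b (Finₚ.<-asym (inject₁<suc k))
  go (no a≢⁻) (yes refl) (no b≢⁻) (yes b≡) = contradiction b≡ (Finₚ.<⇒≢ a<b ∘ ≡.sym)
  go (no a≢⁻) (yes refl) (no b≢⁻) (no b≢⁺) = (snd ≪ transpose-other b≢⁻ b≢⁺) (Finₚ.<-trans (inject₁<suc k) a<b)
  go (no a≢⁻) (no a≢⁺) (yes refl) _ = (transpose-other a≢⁻ a≢⁺ ≪ fst) (Finₚ.<-trans a<b (inject₁<suc k))
  go (no a≢⁻) (no a≢⁺) (no b≢⁻) (yes refl) = (transpose-other a≢⁻ a≢⁺ ≪ snd) (below-suc a<b a≢⁻)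
  go (no a≢⁻) (no a≢⁺) (no b≢⁻) (no b≢⁺) = (transpose-other a≢⁻ a≢⁺ ≪ transpose-other b≢⁻ b≢⁺) a<b

data Position {m} (k : Fin m) : Fin (suc m) → Fin (suc m) → Set where
  ascending  : Position k (inject₁ k) (suc k)
  descending : Position k (suc k) (inject₁ k)
  unrelated  : ∀ {a b} →
               ¬ (a ≡ inject₁ k × b ≡ suc k) → ¬ (a ≡ suc k × b ≡ inject₁ k) →
               Position k a b

position : ∀ (k : Fin m) a b → Position k a b
position k a b with (a ≟ inject₁ k) ×-dec (b ≟ suc k)
... | yes (refl , refl) = ascending
... | no ¬up with (a ≟ suc k) ×-dec (b ≟ inject₁ k)
...   | yes (refl , refl) = descending
...   | no ¬down          = unrelated ¬up ¬down

s-reflects-< : ∀ (k : Fin m) {a b} → s {suc m} k ⟨$⟩ʳ a < s {suc m} k ⟨$⟩ʳ b →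
               ¬ (a ≡ suc k × b ≡ inject₁ k) → a < b
s-reflects-< k {a} {b} lt ¬down =
  ≡.subst₂ _<_ (s-involutive k a) (s-involutive k b) (s-preserves-< k lt λ
    { (p , q) → ¬down ( ≡.trans (≡.sym (s-involutive k a)) (≡.trans (cong (s k ⟨$⟩ʳ_) p) (transpose-fst (inject₁ k) (suc k)))
                      , ≡.trans (≡.sym (s-involutive k b)) (≡.trans (cong (s k ⟨$⟩ʳ_) q) (transpose-snd (inject₁ k) (suc k)))) })

module ℕ-Sum = FiniteSums ℕₚ.+-0-commutativeMonoid

inversion : Permutation′ n → Fin n → Fin n → ℕ
inversion w a b = if does ((w ⟨$⟩ʳ b) <? (w ⟨$⟩ʳ a)) then 1 else 0

length-⨁ : ∀ {A : Set} (xs : List A) → length xs ≡ ℕ-Sum.⨁ xs (λ _ → 1)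
length-⨁ []       = refl
length-⨁ (x ∷ xs) = cong suc (length-⨁ xs)

ℓ-∑ : ∀ (w : Permutation′ n) →
      ℓ w ≡ ℕ-Sum.∑ λ a → ℕ-Sum.∑ λ b → if does (a <? b) then inversion w a b else 0
ℓ-∑ {n} w = ≡.trans (length-⨁ (filter _ (positiveRoots n)))
  (≡.trans (ℕ-Sum.⨁-filter (λ (a , b) → (w ⟨$⟩ʳ b) <? (w ⟨$⟩ʳ a)) (positiveRoots n) (λ _ → 1))
           (ℕ-Sum.⨁-positiveRoots λ (a , b) → inversion w a b))

ℓ-cong : ∀ (u w : Permutation′ n) → u ≈ₚ w → ℓ u ≡ ℓ w
ℓ-cong u w eq = ≡.trans (ℓ-∑ u) (≡.trans
  (ℕ-Sum.sum-cong-≗ λ a → ℕ-Sum.sum-cong-≗ λ b → cong (if does (a <? b) then_else 0)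
     (≡.cong₂ (λ x y → if does (x <? y) then 1 else 0) (eq b) (eq a)))
  (≡.sym (ℓ-∑ w)))

-- Reindexing the sum for ℓ (w · s k) by s k changes only the terms at
-- the positions (k , k + 1) and (k + 1 , k).
ℓ-·-s : ∀ (w : Permutation′ (suc m)) (k : Fin m) →
        ℓ (w · s k) ℕ.+ inversion w (inject₁ k) (suc k) ≡ ℓ w ℕ.+ inversion w (suc k) (inject₁ k)
ℓ-·-s {m} w k = begin
  ℓ (w · s k) ℕ.+ inversion w (inject₁ k) (suc k)
    ≡⟨ ≡.cong₂ ℕ._+_ reindexed (≡.sym (double (inject₁ k) (suc k))) ⟩
  ∑ (λ a → ∑ (F′ a)) ℕ.+ ∑ (λ a → ∑ (δ (inject₁ k) (suc k) a))
    ≡⟨ distrib F′ (δ (inject₁ k) (suc k)) ⟨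
  ∑ (λ a → ∑ λ b → F′ a b ℕ.+ δ (inject₁ k) (suc k) a b)
    ≡⟨ (sum-cong-≗ λ a → sum-cong-≗ λ b → pointwise (position k a b)) ⟩
  ∑ (λ a → ∑ λ b → F a b ℕ.+ δ (suc k) (inject₁ k) a b)
    ≡⟨ distrib F (δ (suc k) (inject₁ k)) ⟩
  ∑ (λ a → ∑ (F a)) ℕ.+ ∑ (λ a → ∑ (δ (suc k) (inject₁ k) a))
    ≡⟨ ≡.cong₂ ℕ._+_ (≡.sym (ℓ-∑ w)) (double (suc k) (inject₁ k)) ⟩
  ℓ w ℕ.+ inversion w (suc k) (inject₁ k) ∎
  where
  open ≡-Reasoning
  open ℕ-Sum
  t = s {suc m} k ⟨$⟩ʳ_

  F F′ : Fin (suc m) → Fin (suc m) → ℕ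
  F a b = if does (a <? b) then inversion w a b else 0
  F′ a b = if does (t a <? t b) then inversion w a b else 0

  δ : Fin (suc m) → Fin (suc m) → Fin (suc m) → Fin (suc m) → ℕ
  δ c d a b = if does (a ≟ c) then (if does (b ≟ d) then inversion w a b else 0) else 0

  δ-one : ∀ c d → δ c d c d ≡ inversion w c d
  δ-one c d = ≡.trans (if-yes (c ≟ c) refl) (if-yes (d ≟ d) refl)

  double : ∀ c d → ∑ (λ a → ∑ (δ c d a)) ≡ inversion w c d
  double c d = ≡.trans
    (∑-single c (λ a → ∑ (δ c d a)) λ a a≢ → ∑-zero {f = δ c d a} λ b → if-no (a ≟ c) a≢)
    (≡.trans (∑-single d (δ c d c) λ b b≢ → ≡.trans (if-yes (c ≟ c) refl) (if-no (b ≟ d) b≢))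
             (δ-one c d))

  distrib : ∀ (f g : Fin (suc m) → Fin (suc m) → ℕ) →
            ∑ (λ a → ∑ λ b → f a b ℕ.+ g a b) ≡ ∑ (λ a → ∑ (f a)) ℕ.+ ∑ (λ a → ∑ (g a))
  distrib f g = ≡.trans (sum-cong-≗ λ a → ∑-distrib-+ (f a) (g a)) (∑-distrib-+ (∑ ∘ f) (∑ ∘ g))

  G : Fin (suc m) → Fin (suc m) → ℕ
  G a b = if does (a <? b) then inversion (w · s k) a b else 0

  reindexed : ℓ (w · s k) ≡ ∑ (λ a → ∑ (F′ a))
  reindexed = ≡.trans (ℓ-∑ (w · s k)) (≡.trans (sum-permute (λ a → ∑ (G a)) (s {suc m} k))
    (sum-cong-≗ λ a → ≡.trans (sum-permute (G (t a)) (s {suc m} k))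
      (sum-cong-≗ λ b → cong (if does (t a <? t b) then_else 0)
        (≡.cong₂ (λ x y → if does ((w ⟨$⟩ʳ x) <? (w ⟨$⟩ʳ y)) then 1 else 0) (s-involutive k b) (s-involutive k a)))))

  δ-zero : ∀ {c d a b} → ¬ (a ≡ c × b ≡ d) → δ c d a b ≡ 0
  δ-zero {c} {d} {a} {b} ¬p with a ≟ c | b ≟ d
  ... | no _     | _       = refl
  ... | yes _    | no _    = refl
  ... | yes refl | yes refl = contradiction (refl , refl) ¬p

  pointwise : ∀ {a b} → Position k a b →
              F′ a b ℕ.+ δ (inject₁ k) (suc k) a b ≡ F a b ℕ.+ δ (suc k) (inject₁ k) a b
  pointwise ascending = ≡.trans
    (≡.cong₂ ℕ._+_
      (if-no (t (inject₁ k) <? t (suc k)) λ lt → Finₚ.<-asym (inject₁<suc k)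
         (≡.subst₂ _<_ (transpose-fst (inject₁ k) (suc k)) (transpose-snd (inject₁ k) (suc k)) lt))
      (δ-one (inject₁ k) (suc k)))
    (≡.trans (≡.sym (ℕₚ.+-identityʳ _))
      (≡.cong₂ ℕ._+_ (≡.sym (if-yes (inject₁ k <? suc k) (inject₁<suc k)))
        (≡.sym (δ-zero {suc k} {inject₁ k} {inject₁ k} {suc k} λ p → inject₁≢suc k (proj₁ p)))))
  pointwise descending = ≡.trans
    (≡.cong₂ ℕ._+_
      (if-yes (t (suc k) <? t (inject₁ k))
         (≡.subst₂ _<_ (≡.sym (transpose-snd (inject₁ k) (suc k))) (≡.sym (transpose-fst (inject₁ k) (suc k)))
           (inject₁<suc k)))
      (δ-zero {inject₁ k} {suc k} {suc k} {inject₁ k} λ p → inject₁≢suc k (≡.sym (proj₁ p))))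
    (≡.trans (ℕₚ.+-identityʳ _)
      (≡.cong₂ ℕ._+_ (≡.sym (if-no (suc k <? inject₁ k) (Finₚ.<-asym (inject₁<suc k))))
        (≡.sym (δ-one (suc k) (inject₁ k)))))
  pointwise {a} {b} (unrelated ¬up ¬down) = ≡.cong₂ ℕ._+_
    (if-cong (t a <? t b) (a <? b) (λ lt → s-reflects-< k lt ¬down) (λ lt → s-preserves-< k lt ¬up) λ _ → refl)
    (≡.trans (δ-zero ¬up) (≡.sym (δ-zero ¬down)))

ℓ-ascent : ∀ (w : Permutation′ (suc m)) (k : Fin m) →
           w ⟨$⟩ʳ inject₁ k < w ⟨$⟩ʳ suc k → ℓ (w · s k) ≡ suc (ℓ w)
ℓ-ascent w k lt = begin
  ℓ (w · s k)                                       ≡⟨ ℕₚ.+-identityʳ (ℓ (w · s k)) ⟨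
  ℓ (w · s k) ℕ.+ 0                                 ≡⟨ cong (ℓ (w · s k) ℕ.+_) (if-no ((w ⟨$⟩ʳ suc k) <? (w ⟨$⟩ʳ inject₁ k)) (Finₚ.<-asym lt)) ⟨
  ℓ (w · s k) ℕ.+ inversion w (inject₁ k) (suc k)   ≡⟨ ℓ-·-s w k ⟩
  ℓ w ℕ.+ inversion w (suc k) (inject₁ k)           ≡⟨ cong (ℓ w ℕ.+_) (if-yes ((w ⟨$⟩ʳ inject₁ k) <? (w ⟨$⟩ʳ suc k)) lt) ⟩
  ℓ w ℕ.+ 1                                         ≡⟨ ℕₚ.+-comm (ℓ w) 1 ⟩
  suc (ℓ w)                                         ∎
  where open ≡-Reasoning

ℓ-descent : ∀ (w : Permutation′ (suc m)) (k : Fin m) →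
            w ⟨$⟩ʳ suc k < w ⟨$⟩ʳ inject₁ k → ℓ w ≡ suc (ℓ (w · s k))
ℓ-descent w k lt = ≡.trans (≡.sym (ℓ-cong (w · s k · s k) w (s-involutiveʳ w k)))
  (ℓ-ascent (w · s k) k (≡.subst₂ _<_ (cong (w ⟨$⟩ʳ_) (≡.sym (transpose-fst (inject₁ k) (suc k))))
                                      (cong (w ⟨$⟩ʳ_) (≡.sym (transpose-snd (inject₁ k) (suc k)))) lt))

ℓ-transpose-ascent : ∀ (w : Permutation′ (suc m)) {a b} → a < b → w ⟨$⟩ʳ a < w ⟨$⟩ʳ b →
                     ℓ w ℕ.< ℓ (w · transpose a b)
ℓ-transpose-ascent {m} w {a} {b} a<b = go (toℕ b) w b ℕₚ.≤-refl a<b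
  where
  -- t_ab = s_k t_a,b−1 s_k with k = b − 1.
  go : ∀ d (w : Permutation′ (suc m)) b → toℕ b ℕ.≤ d → a < b → w ⟨$⟩ʳ a < w ⟨$⟩ʳ b →
       ℓ w ℕ.< ℓ (w · transpose a b)
  go (suc d) w (suc k) (ℕ.s≤s k≤d) a<b wa<wb with a ≟ inject₁ k
  ... | yes refl = ℕₚ.≤-reflexive (≡.sym (ℓ-ascent w k wa<wb))
  ... | no  a≢k  = by-cases (<-cmp (w ⟨$⟩ʳ suc k) (w ⟨$⟩ʳ inject₁ k))
    where
    x = w · transpose a (suc k)
    a≢k⁺ = Finₚ.<⇒≢ a<b
    sa≡a = transpose-other a≢k a≢k⁺
    sk⁻≡k⁺ = transpose-fst (inject₁ k) (suc k)

    x-k⁻ : x ⟨$⟩ʳ inject₁ k ≡ w ⟨$⟩ʳ inject₁ k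
    x-k⁻ = cong (w ⟨$⟩ʳ_) (transpose-other (a≢k ∘ ≡.sym) (inject₁≢suc k))

    x-k⁺ : x ⟨$⟩ʳ suc k ≡ w ⟨$⟩ʳ a
    x-k⁺ = cong (w ⟨$⟩ʳ_) (transpose-snd a (suc k))

    conjugate : w · s k · transpose a (inject₁ k) ≈ₚ x · s k
    conjugate i = ≡.trans (·-conjugate w (s {suc m} k) a (inject₁ k) i)
      (≡.cong₂ (λ p q → w · transpose p q · s k ⟨$⟩ʳ i) sa≡a sk⁻≡k⁺)

    smaller : ℓ (w · s k) ℕ.< ℓ (x · s k)
    smaller = subst (ℓ (w · s k) ℕ.<_) (ℓ-cong (w · s k · transpose a (inject₁ k)) (x · s k) conjugate)
      (go d (w · s k) (inject₁ k) (subst (ℕ._≤ d) (≡.sym (Finₚ.toℕ-inject₁ k)) k≤d) (below-suc a<b a≢k)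
          (≡.subst₂ _<_ (≡.sym (cong (w ⟨$⟩ʳ_) sa≡a)) (≡.sym (cong (w ⟨$⟩ʳ_) sk⁻≡k⁺)) wa<wb))

    by-cases : _ → ℓ w ℕ.< ℓ x
    by-cases (tri< lt _ _) = ≡.subst₂ ℕ._<_ (≡.sym (ℓ-descent w k lt))
      (≡.sym (ℓ-descent x k (≡.subst₂ _<_ (≡.sym x-k⁺) (≡.sym x-k⁻) (Finₚ.<-trans wa<wb lt))))
      (ℕ.s≤s smaller)
    by-cases (tri≈ _ eq _) = contradiction (≡.sym (perm-injective w eq)) (inject₁≢suc k)
    by-cases (tri> _ _ gt) with <-cmp (x ⟨$⟩ʳ inject₁ k) (x ⟨$⟩ʳ suc k)
    ... | tri< lt _ _ = ℕ.s≤s⁻¹ (≡.subst₂ ℕ._<_ (ℓ-ascent w k gt) (ℓ-ascent x k lt) smaller)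
    ... | tri≈ _ eq _ = contradiction (perm-injective x eq) (inject₁≢suc k)
    ... | tri> _ _ lt = ℕₚ.<-trans (ℕₚ.<-trans (ℕₚ.≤-reflexive (≡.sym (ℓ-ascent w k gt))) smaller)
                                  (ℕₚ.≤-reflexive (≡.sym (ℓ-descent x k lt)))

ℓ-transpose-descent : ∀ (w : Permutation′ (suc m)) {a b} → a < b → w ⟨$⟩ʳ b < w ⟨$⟩ʳ a →
                      ℓ (w · transpose a b) ℕ.< ℓ w
ℓ-transpose-descent w {a} {b} a<b lt =
  subst (ℓ (w · transpose a b) ℕ.<_) (ℓ-cong (w · transpose a b · transpose a b) w (·-transpose-involutive w a b))
    (ℓ-transpose-ascent (w · transpose a b) a<b
      (≡.subst₂ _<_ (≡.sym (cong (w ⟨$⟩ʳ_) (transpose-fst a b))) (≡.sym (cong (w ⟨$⟩ʳ_) (transpose-snd a b))) lt))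

∑-greater : ∀ (a : Fin n) → ℕ-Sum.∑ {n} (λ b → if does (a <? b) then 1 else 0) ≡ n ∸ suc (toℕ a)
∑-greater {suc n} zero = ones n
  where
  ones : ∀ n → ℕ-Sum.∑ {n} (λ _ → 1) ≡ n
  ones zero    = refl
  ones (suc n) = cong suc (ones n)
∑-greater {suc n} (suc a) = ∑-greater a

maxLength : ℕ → ℕ
maxLength n = ℕ-Sum.∑ {n} λ a → n ∸ suc (toℕ a)

ℓ≤maxLength : ∀ (w : Permutation′ n) → ℓ w ℕ.≤ maxLength n
ℓ≤maxLength {n} w = ℕₚ.≤-trans (Listₚ.length-filter (λ (a , b) → (w ⟨$⟩ʳ b) <? (w ⟨$⟩ʳ a)) (positiveRoots n))
  (ℕₚ.≤-reflexive (≡.trans (length-⨁ (positiveRoots n))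
    (≡.trans (ℕ-Sum.⨁-positiveRoots {n} λ _ → 1) (ℕ-Sum.sum-cong-≗ {n} ∑-greater))))

increasing⇒identity : ∀ (f : Fin (suc m) → Fin (suc m)) → (∀ k → f (inject₁ k) < f (suc k)) → ∀ i → f i ≡ i
increasing⇒identity {m} f inc i = Finₚ.≤-antisym (upper i) (lower i)
  where
  lower : ∀ i → i Fin.≤ f i
  lower = <-weakInduction (λ i → i Fin.≤ f i) ℕ.z≤n
    λ k le → ℕₚ.≤-<-trans (subst (ℕ._≤ toℕ (f (inject₁ k))) (Finₚ.toℕ-inject₁ k) le) (inc k)

  upper : ∀ i → f i Fin.≤ i
  upper = >-weakInduction (λ i → f i Fin.≤ i)
    (subst (toℕ (f (Fin.fromℕ m)) ℕ.≤_) (≡.sym (Finₚ.toℕ-fromℕ m)) (Finₚ.toℕ≤pred[n] (f (Fin.fromℕ m))))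
    λ k le → subst (toℕ (f (inject₁ k)) ℕ.≤_) (≡.sym (Finₚ.toℕ-inject₁ k)) (ℕ.s≤s⁻¹ (ℕₚ.<-≤-trans (inc k) le))

opposite-< : ∀ {i j : Fin n} → i < j → opposite j < opposite i
opposite-< {n} {i} {j} lt =
  ≡.subst₂ ℕ._<_ (≡.sym (Finₚ.opposite-prop j)) (≡.sym (Finₚ.opposite-prop i))
    (ℕₚ.∸-monoʳ-< (ℕ.s≤s lt) (Finₚ.toℕ<n j))

decreasing⇒reverse : ∀ (w : Permutation′ (suc m)) → (∀ k → w ⟨$⟩ʳ suc k < w ⟨$⟩ʳ inject₁ k) → w ≈ₚ reverse
decreasing⇒reverse w dec i = ≡.trans (≡.sym (Finₚ.opposite-involutive (w ⟨$⟩ʳ i)))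
  (cong opposite (increasing⇒identity (λ i → opposite (w ⟨$⟩ʳ i)) (λ k → opposite-< (dec k)) i))

descent⊎identity : ∀ (w : Permutation′ (suc m)) →
                   (∃[ k ] w ⟨$⟩ʳ suc k < w ⟨$⟩ʳ inject₁ k) ⊎ w ≈ₚ idₚ
descent⊎identity w with Finₚ.any? (λ k → (w ⟨$⟩ʳ suc k) <? (w ⟨$⟩ʳ inject₁ k))
... | yes (k , lt) = inj₁ (k , lt)
... | no  ¬desc    = inj₂ (increasing⇒identity (w ⟨$⟩ʳ_) λ k →
  ℕₚ.≤∧≢⇒< (ℕₚ.≮⇒≥ λ lt → ¬desc (k , lt)) (inject₁≢suc k ∘ perm-injective w ∘ Finₚ.toℕ-injective))

ascent⊎reverse : ∀ (w : Permutation′ (suc m)) →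
                 (∃[ k ] w ⟨$⟩ʳ inject₁ k < w ⟨$⟩ʳ suc k) ⊎ w ≈ₚ reverse
ascent⊎reverse w with Finₚ.any? (λ k → (w ⟨$⟩ʳ inject₁ k) <? (w ⟨$⟩ʳ suc k))
... | yes (k , lt) = inj₁ (k , lt)
... | no  ¬asc     = inj₂ (decreasing⇒reverse w λ k →
  ℕₚ.≤∧≢⇒< (ℕₚ.≮⇒≥ λ lt → ¬asc (k , lt)) (inject₁≢suc k ∘ ≡.sym ∘ perm-injective w ∘ Finₚ.toℕ-injective))

maxLength⇒reverse : ∀ (w : Permutation′ (suc m)) → ℓ w ≡ maxLength (suc m) → w ≈ₚ reverse
maxLength⇒reverse {m} w eq with ascent⊎reverse w
... | inj₂ w≈        = w≈
... | inj₁ (k , lt) = contradiction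
  (≡.subst₂ ℕ._≤_ (≡.trans (ℓ-ascent w k lt) (cong suc eq)) refl (ℓ≤maxLength (w · s k))) ℕₚ.1+n≰n

generated-by-s : ∀ (Q : Permutation′ (suc m) → Set) → (∀ w → w ≈ₚ idₚ → Q w) →
                 (∀ w u k → Q w → u ≈ₚ w · s k → Q u) → ∀ w → Q w
generated-by-s {m} Q base step w = go (ℓ w) w ℕₚ.≤-refl
  where
  go : ∀ d w → ℓ w ℕ.≤ d → Q w
  go d w le with descent⊎identity w
  ... | inj₂ w≈id = base w w≈id
  ... | inj₁ (k , lt) with d | subst (ℕ._≤ d) (ℓ-descent w k lt) le
  ...   | suc d | ℕ.s≤s le′ = step (w · s k) w k (go d (w · s k) le′) (≈ₚ-sym {u = w · s k · s k} {w} (s-involutiveʳ w k))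

descending-from-reverse : ∀ (Q : Permutation′ (suc m) → Set) → (∀ w → w ≈ₚ reverse → Q w) →
                          (∀ w u k → Q w → ℓ (w · s k) ℕ.< ℓ w → u ≈ₚ w · s k → Q u) → ∀ w → Q w
descending-from-reverse {m} Q base step w = go (maxLength (suc m)) w (ℕₚ.m≤m+n (maxLength (suc m)) (ℓ w))
  where
  go : ∀ d w → maxLength (suc m) ℕ.≤ d ℕ.+ ℓ w → Q w
  go d w le with ascent⊎reverse w
  ... | inj₂ w≈ = base w w≈
  go zero w le | inj₁ (k , lt) = contradiction
    (ℕₚ.≤-trans (subst (ℕ._≤ maxLength (suc m)) (ℓ-ascent w k lt) (ℓ≤maxLength (w · s k))) le) ℕₚ.1+n≰n
  go (suc d) w le | inj₁ (k , lt) =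
    step (w · s k) w k
      (go d (w · s k) (subst (maxLength (suc m) ℕ.≤_)
        (≡.trans (≡.sym (ℕₚ.+-suc d (ℓ w))) (cong (d ℕ.+_) (≡.sym (ℓ-ascent w k lt)))) le))
      (subst (ℕ._< ℓ (w · s k)) (≡.sym (ℓ-cong (w · s k · s k) w (s-involutiveʳ w k))) (ℕₚ.≤-reflexive (≡.sym (ℓ-ascent w k lt))))
      (≈ₚ-sym {u = w · s k · s k} {w} (s-involutiveʳ w k))

ℓ-identity : ∀ (w : Permutation′ (suc m)) → w ≈ₚ idₚ → ℓ w ≡ 0
ℓ-identity {m} w w≈id = ≡.trans (ℓ-∑ w) (ℕ-Sum.∑-zero {f = λ a → ℕ-Sum.∑ (F a)} λ a →
  ℕ-Sum.∑-zero {f = F a} λ b → zero-term a b (a <? b))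
  where
  F : Fin (suc m) → Fin (suc m) → ℕ
  F a b = if does (a <? b) then inversion w a b else 0
  zero-term : ∀ a b (d : Dec (a < b)) → (if does d then inversion w a b else 0) ≡ 0
  zero-term a b (no _) = refl
  zero-term a b (yes lt) = if-no ((w ⟨$⟩ʳ b) <? (w ⟨$⟩ʳ a))
    λ gt → Finₚ.<-asym lt (≡.subst₂ _<_ (w≈id b) (w≈id a) gt)

-- Linear operators on functions on the symmetric group

module ℚ-Sum where
  open FiniteSums (CommutativeRing.+-commutativeMonoid ℚₚ.+-*-commutativeRing) public
  open import Algebra.Properties.Semiring.Sum (CommutativeRing.semiring ℚₚ.+-*-commutativeRing) public
    using (*-distribˡ-sum; *-distribʳ-sum)

open ℚ-Sum using (∑)

∑-cong : ∀ {f g : Fin n → ℚ} → (∀ i → f i ≡ g i) → ∑ f ≡ ∑ g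
∑-cong = ℚ-Sum.sum-cong-≗

𝟙 : ∀ {P : Set} → Dec P → ℚ
𝟙 P? = if does P? then 1ℚ else 0ℚ

𝟙-yes : ∀ {P : Set} (P? : Dec P) → P → 𝟙 P? ≡ 1ℚ
𝟙-yes P? = if-yes P?

𝟙-no : ∀ {P : Set} (P? : Dec P) → ¬ P → 𝟙 P? ≡ 0ℚ
𝟙-no P? = if-no P?

𝟙-cong : ∀ {P Q : Set} (P? : Dec P) (Q? : Dec Q) → (P → Q) → (Q → P) → 𝟙 P? ≡ 𝟙 Q?
𝟙-cong P? Q? f g = if-cong P? Q? f g λ _ → refl

𝟙-*-cong : ∀ {P Q R S : Set} (P? : Dec P) (Q? : Dec Q) (R? : Dec R) (S? : Dec S) →
           (P → Q → R × S) → (R → S → P × Q) → 𝟙 P? * 𝟙 Q? ≡ 𝟙 R? * 𝟙 S?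
𝟙-*-cong P? Q? R? S? f g = ≡.trans (product-𝟙 P? Q?)
  (≡.trans (𝟙-cong (P? ×-dec Q?) (R? ×-dec S?) (λ (p , q) → f p q) (λ (r , t) → g r t))
           (≡.sym (product-𝟙 R? S?)))
  where
  product-𝟙 : ∀ {P Q : Set} (P? : Dec P) (Q? : Dec Q) → 𝟙 P? * 𝟙 Q? ≡ 𝟙 (P? ×-dec Q?)
  product-𝟙 (yes _) Q? = ℚₚ.*-identityˡ (𝟙 Q?)
  product-𝟙 (no _)  Q? = ℚₚ.*-zeroˡ (𝟙 Q?)

𝟙-nonneg : ∀ {P : Set} (P? : Dec P) → 0ℚ ℚ.≤ 𝟙 P?
𝟙-nonneg (yes _) = ℚₚ.nonNegative⁻¹ 1ℚ
𝟙-nonneg (no _)  = ℚₚ.≤-refl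

*-nonneg : ∀ {p q} → 0ℚ ℚ.≤ p → 0ℚ ℚ.≤ q → 0ℚ ℚ.≤ p * q
*-nonneg {p} {q} p≥0 q≥0 =
  ℚₚ.nonNegative⁻¹ (p * q) {{ℚₚ.nonNeg*nonNeg⇒nonNeg p {{ℚ.nonNegative p≥0}} q {{ℚ.nonNegative q≥0}}}}

+-nonneg : ∀ {p q} → 0ℚ ℚ.≤ p → 0ℚ ℚ.≤ q → 0ℚ ℚ.≤ p + q
+-nonneg = ℚₚ.+-mono-≤

record Fun (n : ℕ) : Set where
  no-eta-equality
  field
    at   : Permutation′ n → ℚ
    resp : ∀ u w → u ≈ₚ w → at u ≡ at w

open Fun

infixl 6 _+ᶠ_
infixr 7 _*ᶠ_

_+ᶠ_ : Fun n → Fun n → Fun n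
(ξ +ᶠ η) .at v          = at ξ v + at η v
(ξ +ᶠ η) .resp u w u≈w = cong₂ _+_ (resp ξ u w u≈w) (resp η u w u≈w)

_*ᶠ_ : ℚ → Fun n → Fun n
(q *ᶠ ξ) .at v          = q * at ξ v
(q *ᶠ ξ) .resp u w u≈w = cong (q *_) (resp ξ u w u≈w)

infix 4 _≐_

_≐_ : Fun n → Fun n → Set
ξ ≐ η = ∀ v → at ξ v ≡ at η v

record Op (n : ℕ) : Set where
  no-eta-equality
  infixr 8 _$ᵒ_
  field
    _$ᵒ_    : Fun n → Fun n
    $-cong  : ∀ ξ η → ξ ≐ η → _$ᵒ_ ξ ≐ _$ᵒ_ η
    $-+     : ∀ ξ η → _$ᵒ_ (ξ +ᶠ η) ≐ _$ᵒ_ ξ +ᶠ _$ᵒ_ η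
    $-*     : ∀ q ξ → _$ᵒ_ (q *ᶠ ξ) ≐ q *ᶠ _$ᵒ_ ξ

open Op

infixl 6 _+ᵒ_
infixl 7 _*ᵒ_
infix  8 -ᵒ_

_+ᵒ_ _*ᵒ_ : Op n → Op n → Op n

(A +ᵒ B) ._$ᵒ_ ξ           = A $ᵒ ξ +ᶠ B $ᵒ ξ
(A +ᵒ B) .$-cong ξ η eq v = cong₂ _+_ ($-cong A ξ η eq v) ($-cong B ξ η eq v)
(A +ᵒ B) .$-+ ξ η v       = ≡.trans (cong₂ _+_ ($-+ A ξ η v) ($-+ B ξ η v))
  (solve 4 (λ a b c d → (a :+ b) :+ (c :+ d) := (a :+ c) :+ (b :+ d)) refl
     (at (A $ᵒ ξ) v) (at (A $ᵒ η) v) (at (B $ᵒ ξ) v) (at (B $ᵒ η) v))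
(A +ᵒ B) .$-* q ξ v       = ≡.trans (cong₂ _+_ ($-* A q ξ v) ($-* B q ξ v))
  (≡.sym (ℚₚ.*-distribˡ-+ q (at (A $ᵒ ξ) v) (at (B $ᵒ ξ) v)))

(A *ᵒ B) ._$ᵒ_ ξ         = A $ᵒ B $ᵒ ξ
(A *ᵒ B) .$-cong ξ η eq = $-cong A (B $ᵒ ξ) (B $ᵒ η) ($-cong B ξ η eq)
(A *ᵒ B) .$-+ ξ η v     = ≡.trans ($-cong A (B $ᵒ (ξ +ᶠ η)) (B $ᵒ ξ +ᶠ B $ᵒ η) ($-+ B ξ η) v)
                                  ($-+ A (B $ᵒ ξ) (B $ᵒ η) v)
(A *ᵒ B) .$-* q ξ v     = ≡.trans ($-cong A (B $ᵒ (q *ᶠ ξ)) (q *ᶠ B $ᵒ ξ) ($-* B q ξ) v)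
                                  ($-* A q (B $ᵒ ξ) v)

scalar : ℚ → Op n
scalar p ._$ᵒ_           = p *ᶠ_
scalar p .$-cong ξ η eq v = cong (p *_) (eq v)
scalar p .$-+ ξ η v       = ℚₚ.*-distribˡ-+ p (at ξ v) (at η v)
scalar p .$-* q ξ v       = solve 3 (λ p q a → p :* (q :* a) := q :* (p :* a)) refl p q (at ξ v)

-ᵒ_ : Op n → Op n
-ᵒ A = scalar (- 1ℚ) *ᵒ A

translate : Fun n → Permutation′ n → Fun n → Fun n
translate c t ξ .at v          = at c v * at ξ (v · t)
translate c t ξ .resp u w u≈w = cong₂ _*_ (resp c u w u≈w) (resp ξ (u · t) (w · t) (·-congˡ {u = u} {w} t u≈w))

shift : Fun n → Permutation′ n → Op n
shift c t ._$ᵒ_           = translate c t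
shift c t .$-cong ξ η eq v = cong (at c v *_) (eq (v · t))
shift c t .$-+ ξ η v       = ℚₚ.*-distribˡ-+ (at c v) (at ξ (v · t)) (at η (v · t))
shift c t .$-* q ξ v       = solve 3 (λ p q a → p :* (q :* a) := q :* (p :* a)) refl (at c v) q (at ξ (v · t))

infix 4 _≈ᵒ_

record _≈ᵒ_ (A B : Op n) : Set where
  constructor pointwise
  field
    point : ∀ ξ v → at (A $ᵒ ξ) v ≡ at (B $ᵒ ξ) v

open _≈ᵒ_

Op-ring : ℕ → Ring 0ℓ 0ℓ
Op-ring n = record
  { Carrier = Op n
  ; _≈_ = _≈ᵒ_
  ; _+_ = _+ᵒ_
  ; _*_ = _*ᵒ_
  ; -_ = -ᵒ_
  ; 0# = scalar 0ℚ
  ; 1# = scalar 1ℚ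
  ; isRing = record
    { +-isAbelianGroup = record
      { isGroup = record
        { isMonoid = record
          { isSemigroup = record
            { isMagma = record
              { isEquivalence = record
                { refl  = pointwise λ ξ v → refl
                ; sym   = λ p → pointwise λ ξ v → ≡.sym (point p ξ v)
                ; trans = λ p q → pointwise λ ξ v → ≡.trans (point p ξ v) (point q ξ v)
                }
              ; ∙-cong = λ p q → pointwise λ ξ v → cong₂ _+_ (point p ξ v) (point q ξ v)
              }
            ; assoc = λ A B C → pointwise λ ξ v → ℚₚ.+-assoc (at (A $ᵒ ξ) v) (at (B $ᵒ ξ) v) (at (C $ᵒ ξ) v)
            }
          ; identity =
              (λ A → pointwise λ ξ v → ≡.trans (cong (_+ at (A $ᵒ ξ) v) (ℚₚ.*-zeroˡ (at ξ v))) (ℚₚ.+-identityˡ (at (A $ᵒ ξ) v))) ,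
              (λ A → pointwise λ ξ v → ≡.trans (cong (at (A $ᵒ ξ) v +_) (ℚₚ.*-zeroˡ (at ξ v))) (ℚₚ.+-identityʳ (at (A $ᵒ ξ) v)))
          }
        ; inverse =
            (λ A → pointwise λ ξ v → solve 2 (λ a x → const (- 1ℚ) :* a :+ a := const 0ℚ :* x) refl (at (A $ᵒ ξ) v) (at ξ v)) ,
            (λ A → pointwise λ ξ v → solve 2 (λ a x → a :+ const (- 1ℚ) :* a := const 0ℚ :* x) refl (at (A $ᵒ ξ) v) (at ξ v))
        ; ⁻¹-cong = λ p → pointwise λ ξ v → cong (- 1ℚ *_) (point p ξ v)
        }
      ; comm = λ A B → pointwise λ ξ v → ℚₚ.+-comm (at (A $ᵒ ξ) v) (at (B $ᵒ ξ) v)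
      }
    ; *-cong = λ {A} {A′} {B} {B′} p q → pointwise λ ξ v →
        ≡.trans ($-cong A (B $ᵒ ξ) (B′ $ᵒ ξ) (point q ξ) v) (point p (B′ $ᵒ ξ) v)
    ; *-assoc = λ A B C → pointwise λ ξ v → refl
    ; *-identity =
        (λ A → pointwise λ ξ v → ℚₚ.*-identityˡ (at (A $ᵒ ξ) v)) ,
        (λ A → pointwise λ ξ v → ≡.trans ($-* A 1ℚ ξ v) (ℚₚ.*-identityˡ (at (A $ᵒ ξ) v)))
    ; distrib =
        (λ A B C → pointwise λ ξ v → $-+ A (B $ᵒ ξ) (C $ᵒ ξ) v) ,
        (λ A B C → pointwise λ ξ v → refl)
    }
  }

scalar-+ : ∀ p q → scalar {n} (p + q) ≈ᵒ scalar p +ᵒ scalar q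
scalar-+ p q = pointwise λ ξ v → ℚₚ.*-distribʳ-+ (at ξ v) p q

scalar-* : ∀ p q → scalar {n} (p * q) ≈ᵒ scalar p *ᵒ scalar q
scalar-* p q = pointwise λ ξ v → ℚₚ.*-assoc p q (at ξ v)

scalar-central : ∀ q (A : Op n) → scalar q *ᵒ A ≈ᵒ A *ᵒ scalar q
scalar-central q A = pointwise λ ξ v → ≡.sym ($-* A q ξ v)

∑ᵒ : ∀ {k} → (Fin k → Op n) → Op n
∑ᵒ {n} = FiniteSums.∑ (Ring.+-commutativeMonoid (Op-ring n))

∑ᵒ-at : ∀ {k} (A : Fin k → Op n) ξ v → at (∑ᵒ A $ᵒ ξ) v ≡ ∑ λ j → at (A j $ᵒ ξ) v
∑ᵒ-at {k = zero}  A ξ v = ℚₚ.*-zeroˡ (at ξ v)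
∑ᵒ-at {k = suc k} A ξ v = cong (at (A zero $ᵒ ξ) v +_) (∑ᵒ-at (A ∘ suc) ξ v)

-- Signs and simple reflections

sign : Fin n → Fin n → ℚ
sign a b with <-cmp a b
... | tri< _ _ _ = 1ℚ
... | tri≈ _ _ _ = 0ℚ
... | tri> _ _ _ = - 1ℚ

sign-< : ∀ {a b : Fin n} → a < b → sign a b ≡ 1ℚ
sign-< {a = a} {b} a<b with <-cmp a b
... | tri< _ _ _   = refl
... | tri≈ a≮b _ _ = contradiction a<b a≮b
... | tri> a≮b _ _ = contradiction a<b a≮b

sign-> : ∀ {a b : Fin n} → b < a → sign a b ≡ - 1ℚ
sign-> {a = a} {b} b<a with <-cmp a b
... | tri< _ _ b≮a = contradiction b<a b≮a
... | tri≈ _ _ b≮a = contradiction b<a b≮a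
... | tri> _ _ _   = refl

sign-diagonal : ∀ (a : Fin n) → sign a a ≡ 0ℚ
sign-diagonal a with <-cmp a a
... | tri< _ a≢a _ = contradiction refl a≢a
... | tri≈ _ _ _   = refl
... | tri> _ a≢a _ = contradiction refl a≢a

sign-cong : ∀ {a b c d : Fin n} → (a < b → c < d) → (b < a → d < c) → (a ≡ b → c ≡ d) →
            sign c d ≡ sign a b
sign-cong {a = a} {b} {c} {d} f g h with <-cmp a b
... | tri< a<b _ _ = sign-< (f a<b)
... | tri≈ _ a≡b _ = ≡.trans (cong (sign c) (≡.sym (h a≡b))) (sign-diagonal c)
... | tri> _ _ b<a = sign-> (g b<a)

sign-anti : ∀ (a b : Fin n) → sign b a ≡ - sign a b
sign-anti a b with <-cmp a b
... | tri< a<b _ _ = sign-> a<b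
... | tri≈ _ refl _ = sign-diagonal a
... | tri> _ _ b<a = sign-< b<a

τ : Fin m → Fin (suc m) → Fin (suc m) → ℚ
τ k i j = 𝟙 (i ≟ inject₁ k) * 𝟙 (j ≟ suc k) - 𝟙 (i ≟ suc k) * 𝟙 (j ≟ inject₁ k)

ε : Fin m → Fin (suc m) → ℚ
ε k i = 𝟙 (i ≟ inject₁ k) - 𝟙 (i ≟ suc k)

τ-ascending : ∀ (k : Fin m) → τ k (inject₁ k) (suc k) ≡ 1ℚ
τ-ascending k
  rewrite dec-true (inject₁ k ≟ inject₁ k) refl | dec-true (suc k ≟ suc k) refl
        | dec-false (inject₁ k ≟ suc k) (inject₁≢suc k) | dec-false (suc k ≟ inject₁ k) (inject₁≢suc k ∘ ≡.sym) = refl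

τ-descending : ∀ (k : Fin m) → τ k (suc k) (inject₁ k) ≡ - 1ℚ
τ-descending k
  rewrite dec-true (inject₁ k ≟ inject₁ k) refl | dec-true (suc k ≟ suc k) refl
        | dec-false (inject₁ k ≟ suc k) (inject₁≢suc k) | dec-false (suc k ≟ inject₁ k) (inject₁≢suc k ∘ ≡.sym) = refl

τ-unrelated : ∀ (k : Fin m) {a b} → ¬ (a ≡ inject₁ k × b ≡ suc k) → ¬ (a ≡ suc k × b ≡ inject₁ k) →
              τ k a b ≡ 0ℚ
τ-unrelated k {a} {b} ¬up ¬down = cong₂ _-_ (go (a ≟ inject₁ k) (b ≟ suc k) ¬up) (go (a ≟ suc k) (b ≟ inject₁ k) ¬down)
  where
  go : ∀ {P Q : Set} (P? : Dec P) (Q? : Dec Q) → ¬ (P × Q) → 𝟙 P? * 𝟙 Q? ≡ 0ℚ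
  go (yes p) (yes q) ¬pq = contradiction (p , q) ¬pq
  go (yes p) (no _)  ¬pq = refl
  go (no _)  Q?      ¬pq = ℚₚ.*-zeroˡ (𝟙 Q?)

s-fst : ∀ (k : Fin m) → s {suc m} k ⟨$⟩ʳ inject₁ k ≡ suc k
s-fst k = transpose-fst (inject₁ k) (suc k)

s-snd : ∀ (k : Fin m) → s {suc m} k ⟨$⟩ʳ suc k ≡ inject₁ k
s-snd k = transpose-snd (inject₁ k) (suc k)

s-other : ∀ (k : Fin m) {i} → i ≢ inject₁ k → i ≢ suc k → s {suc m} k ⟨$⟩ʳ i ≡ i
s-other k = transpose-other

ε-fst : ∀ (k : Fin m) → ε k (inject₁ k) ≡ 1ℚ
ε-fst k = cong₂ _-_ (𝟙-yes (inject₁ k ≟ inject₁ k) refl) (𝟙-no (inject₁ k ≟ suc k) (inject₁≢suc k))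

ε-snd : ∀ (k : Fin m) → ε k (suc k) ≡ - 1ℚ
ε-snd k = cong₂ _-_ (𝟙-no (suc k ≟ inject₁ k) (inject₁≢suc k ∘ ≡.sym)) (𝟙-yes (suc k ≟ suc k) refl)

ε-other : ∀ (k : Fin m) {i} → i ≢ inject₁ k → i ≢ suc k → ε k i ≡ 0ℚ
ε-other k {i} i≢k⁻ i≢k⁺ = cong₂ _-_ (𝟙-no (i ≟ inject₁ k) i≢k⁻) (𝟙-no (i ≟ suc k) i≢k⁺)

data Index {m} (k : Fin m) : Fin (suc m) → Set where
  fst   : Index k (inject₁ k)
  snd   : Index k (suc k)
  other : ∀ {i} → i ≢ inject₁ k → i ≢ suc k → Index k i

index : ∀ (k : Fin m) i → Index k i
index k i with i ≟ inject₁ k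
... | yes refl = fst
... | no i≢k⁻ with i ≟ suc k
...   | yes refl = snd
...   | no i≢k⁺  = other i≢k⁻ i≢k⁺

ε-s : ∀ (k : Fin m) i → ε k (s {suc m} k ⟨$⟩ʳ i) ≡ - ε k i
ε-s k i with index k i
... | fst         = ≡.trans (cong (ε k) (s-fst k)) (≡.trans (ε-snd k) (cong -_ (≡.sym (ε-fst k))))
... | snd         = ≡.trans (cong (ε k) (s-snd k)) (≡.trans (ε-fst k) (cong -_ (≡.sym (ε-snd k))))
... | other p q = ≡.trans (cong (ε k) (s-other k p q)) (≡.trans (ε-other k p q) (cong -_ (≡.sym (ε-other k p q))))

ε-difference : ∀ (k : Fin m) (f : Fin (suc m) → ℚ) i →
               f i - f (s {suc m} k ⟨$⟩ʳ i) ≡ ε k i * (f (inject₁ k) - f (suc k))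
ε-difference k f i with index k i
... | fst = ≡.trans (cong (λ x → f (inject₁ k) - f x) (s-fst k))
  (≡.trans (≡.sym (ℚₚ.*-identityˡ _)) (cong (_* (f (inject₁ k) - f (suc k))) (≡.sym (ε-fst k))))
... | snd = ≡.trans (cong (λ x → f (suc k) - f x) (s-snd k))
  (≡.trans (solve 2 (λ a b → b :- a := const (- 1ℚ) :* (a :- b)) refl (f (inject₁ k)) (f (suc k)))
           (cong (_* (f (inject₁ k) - f (suc k))) (≡.sym (ε-snd k))))
... | other p q = ≡.trans (cong (λ x → f i - f x) (s-other k p q))
  (≡.trans (solve 3 (λ a b c → a :- a := const 0ℚ :* (b :- c)) refl (f i) (f (inject₁ k)) (f (suc k)))
           (cong (_* (f (inject₁ k) - f (suc k))) (≡.sym (ε-other k p q))))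

∑-τ : ∀ (k : Fin m) i (f : Fin (suc m) → Fin (suc m) → ℚ) y →
      f (inject₁ k) (suc k) ≡ y → f (suc k) (inject₁ k) ≡ y → ∑ (λ j → τ k i j * f i j) ≡ ε k i * y
∑-τ {m} k i f y up down with index k i
... | fst = ≡.trans
  (ℚ-Sum.∑-single (suc k) (λ j → τ k (inject₁ k) j * f (inject₁ k) j) λ j j≢ → ≡.trans
    (cong (_* f (inject₁ k) j) (τ-unrelated k (j≢ ∘ proj₂) (inject₁≢suc k ∘ proj₁)))
    (ℚₚ.*-zeroˡ (f (inject₁ k) j)))
  (cong₂ _*_ (≡.trans (τ-ascending k) (≡.sym (ε-fst k))) up)
... | snd = ≡.trans
  (ℚ-Sum.∑-single (inject₁ k) (λ j → τ k (suc k) j * f (suc k) j) λ j j≢ → ≡.trans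
    (cong (_* f (suc k) j) (τ-unrelated k (inject₁≢suc k ∘ ≡.sym ∘ proj₁) (j≢ ∘ proj₂)))
    (ℚₚ.*-zeroˡ (f (suc k) j)))
  (cong₂ _*_ (≡.trans (τ-descending k) (≡.sym (ε-snd k))) down)
... | other p q = ≡.trans
  (ℚ-Sum.∑-zero {f = λ j → τ k i j * f i j} λ j → ≡.trans
    (cong (_* f i j) (τ-unrelated k {i} {j} (p ∘ proj₁) (q ∘ proj₁))) (ℚₚ.*-zeroˡ (f i j)))
  (≡.sym (≡.trans (cong (_* y) (ε-other k p q)) (ℚₚ.*-zeroˡ y)))

sign-s-unrelated : ∀ (k : Fin m) {a b} → ¬ (a ≡ inject₁ k × b ≡ suc k) → ¬ (a ≡ suc k × b ≡ inject₁ k) →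
                   sign (s {suc m} k ⟨$⟩ʳ a) (s {suc m} k ⟨$⟩ʳ b) ≡ sign a b
sign-s-unrelated k ¬up ¬down = sign-cong
  (λ lt → s-preserves-< k lt ¬up) (λ gt → s-preserves-< k gt λ (p , q) → ¬down (q , p)) (cong (s k ⟨$⟩ʳ_))

-- The Chevalley operators

cover? : ∀ (v : Permutation′ n) i j → Dec (ℓ (v · transpose i j) ≡ suc (ℓ v))
cover? v i j = ℓ (v · transpose i j) ℕₚ.≟ suc (ℓ v)

chevalleyCoefficient : Fin n → Fin n → Fun n
chevalleyCoefficient i j .at v = sign i j * 𝟙 (cover? v i j)
chevalleyCoefficient i j .resp u w u≈w = cong (sign i j *_) (cong₂ (λ p q → 𝟙 (p ℕₚ.≟ suc q))
  (ℓ-cong (u · transpose i j) (w · transpose i j) (·-congˡ {u = u} {w} (transpose i j) u≈w)) (ℓ-cong u w u≈w))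

-- Multiplication by x_i and ∂_k, on the coefficients of a homology class.
abstract
  X : Fin n → Op n
  X i = ∑ᵒ λ j → shift (chevalleyCoefficient i j) (transpose i j)

  X-at : ∀ (i : Fin n) ξ v →
         at (X i $ᵒ ξ) v ≡ ∑ λ j → sign i j * 𝟙 (cover? v i j) * at ξ (v · transpose i j)
  X-at i = ∑ᵒ-at λ j → shift (chevalleyCoefficient i j) (transpose i j)

descends : Fin m → Fun (suc m)
descends k .at v = 𝟙 (ℓ (v · s k) ℕₚ.<? ℓ v)
descends k .resp u w u≈w = cong₂ (λ p q → 𝟙 (p ℕₚ.<? q))
  (ℓ-cong (u · s k) (w · s k) (·-congˡ {u = u} {w} (s k) u≈w)) (ℓ-cong u w u≈w)

D : Fin m → Op (suc m)
D k = shift (descends k) (s k)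

D-descent : ∀ (k : Fin m) ξ v → ℓ (v · s k) ℕ.< ℓ v → at (D k $ᵒ ξ) v ≡ at ξ (v · s k)
D-descent k ξ v lt = ≡.trans (cong (_* at ξ (v · s k)) (𝟙-yes (ℓ (v · s k) ℕₚ.<? ℓ v) lt)) (ℚₚ.*-identityˡ _)

D-identity : ∀ (k : Fin m) ξ → at (D k $ᵒ ξ) idₚ ≡ 0ℚ
D-identity {m} k ξ = ≡.trans (cong (_* at ξ (e · s k)) (𝟙-no (ℓ (e · s k) ℕₚ.<? ℓ e)
    λ lt → ℕₚ.n≮0 (subst (ℓ (e · s k) ℕ.<_) (ℓ-identity e λ _ → refl) lt)))
  (ℚₚ.*-zeroˡ (at ξ (e · s k)))
  where
  e = idₚ {suc m}

ℓ-adjacent : ∀ (w : Permutation′ (suc m)) k → ℓ (w · s k) ≡ suc (ℓ w) ⊎ ℓ w ≡ suc (ℓ (w · s k))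
ℓ-adjacent w k with <-cmp (w ⟨$⟩ʳ inject₁ k) (w ⟨$⟩ʳ suc k)
... | tri< lt _ _ = inj₁ (ℓ-ascent w k lt)
... | tri≈ _ eq _ = contradiction (perm-injective w eq) (inject₁≢suc k)
... | tri> _ _ gt = inj₂ (ℓ-descent w k gt)

-- For a positive root β ≠ α_k, the sign of v on β is the sign of v s_k
-- on s_k β.
Parallel : Permutation′ (suc m) → Fin m → Fin (suc m) → Fin (suc m) → Set
Parallel {m} v k i j =
  (ℓ v ℕ.< ℓ (v · transpose i j) × ℓ (v · s k) ℕ.< ℓ (v · s k · transpose si sj)) ⊎
  (ℓ (v · transpose i j) ℕ.< ℓ v × ℓ (v · s k · transpose si sj) ℕ.< ℓ (v · s k))
  where
  si = s {suc m} k ⟨$⟩ʳ i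
  sj = s {suc m} k ⟨$⟩ʳ j

parallel-< : ∀ (v : Permutation′ (suc m)) k {i j} → i < j → ¬ (i ≡ inject₁ k × j ≡ suc k) → Parallel v k i j
parallel-< {m} v k {i} {j} i<j ¬up with <-cmp (v ⟨$⟩ʳ i) (v ⟨$⟩ʳ j)
... | tri< lt _ _ = inj₁
  ( ℓ-transpose-ascent v i<j lt
  , ℓ-transpose-ascent (v · s k) (s-preserves-< k i<j ¬up)
      (≡.subst₂ _<_ (cong (v ⟨$⟩ʳ_) (≡.sym (s-involutive k i))) (cong (v ⟨$⟩ʳ_) (≡.sym (s-involutive k j))) lt))
... | tri≈ _ eq _ = contradiction (perm-injective v eq) (Finₚ.<⇒≢ i<j)
... | tri> _ _ gt = inj₂
  ( ℓ-transpose-descent v i<j gt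
  , ℓ-transpose-descent (v · s k) (s-preserves-< k i<j ¬up)
      (≡.subst₂ _<_ (cong (v ⟨$⟩ʳ_) (≡.sym (s-involutive k j))) (cong (v ⟨$⟩ʳ_) (≡.sym (s-involutive k i))) gt))

ℓ-transpose-comm : ∀ (v : Permutation′ n) i j → ℓ (v · transpose i j) ≡ ℓ (v · transpose j i)
ℓ-transpose-comm v i j = ℓ-cong (v · transpose i j) (v · transpose j i) (·-transpose-comm v i j)

parallel-sym : ∀ (v : Permutation′ (suc m)) k {i j} → Parallel v k i j → Parallel v k j i
parallel-sym {m} v k {i} {j}
  rewrite ℓ-transpose-comm v i j
        | ℓ-transpose-comm (v · s k) (s {suc m} k ⟨$⟩ʳ i) (s {suc m} k ⟨$⟩ʳ j) = λ p → p

parallel : ∀ (v : Permutation′ (suc m)) k {i j} → i ≢ j →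
           ¬ (i ≡ inject₁ k × j ≡ suc k) → ¬ (i ≡ suc k × j ≡ inject₁ k) → Parallel v k i j
parallel v k {i} {j} i≢j ¬up ¬down with <-cmp i j
... | tri< i<j _ _ = parallel-< v k i<j ¬up
... | tri≈ _ i≡j _ = contradiction i≡j i≢j
... | tri> _ _ j<i = parallel-sym v k (parallel-< v k j<i λ (p , q) → ¬down (q , p))

-- p, q, r, t are the lengths of v, v t_β, v s_k and v t_β s_k.
cover-exchange : ∀ {p q r t : ℕ} → q ≡ suc t ⊎ t ≡ suc q → p ≡ suc r ⊎ r ≡ suc p →
                 (p ℕ.< q × r ℕ.< t) ⊎ (q ℕ.< p × t ℕ.< r) →
                 𝟙 (q ℕₚ.≟ suc p) * 𝟙 (t ℕₚ.<? q) ≡ 𝟙 (r ℕₚ.<? p) * 𝟙 (t ℕₚ.≟ suc r)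
cover-exchange {p} {q} {r} {t} qt pr par = 𝟙-*-cong (q ℕₚ.≟ suc p) (t ℕₚ.<? q) (r ℕₚ.<? p) (t ℕₚ.≟ suc r)
  (forward qt pr par) (backward qt pr par)
  where
  forward : q ≡ suc t ⊎ t ≡ suc q → p ≡ suc r ⊎ r ≡ suc p → (p ℕ.< q × r ℕ.< t) ⊎ (q ℕ.< p × t ℕ.< r) →
            q ≡ suc p → t ℕ.< q → r ℕ.< p × t ≡ suc r
  forward (inj₁ refl) (inj₁ refl) _ refl _ = ℕₚ.≤-refl , refl
  forward (inj₁ refl) (inj₂ refl) (inj₁ (_ , lt)) refl _ = contradiction lt (ℕₚ.<-asym ℕₚ.≤-refl)
  forward (inj₁ refl) (inj₂ refl) (inj₂ (lt , _)) refl _ = contradiction lt (ℕₚ.<-asym ℕₚ.≤-refl)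
  forward (inj₂ refl) _ _ _ lt = contradiction lt (ℕₚ.<-asym ℕₚ.≤-refl)

  backward : q ≡ suc t ⊎ t ≡ suc q → p ≡ suc r ⊎ r ≡ suc p → (p ℕ.< q × r ℕ.< t) ⊎ (q ℕ.< p × t ℕ.< r) →
             r ℕ.< p → t ≡ suc r → q ≡ suc p × t ℕ.< q
  backward (inj₁ refl) (inj₁ refl) _ _ refl = refl , ℕₚ.≤-refl
  backward (inj₂ refl) (inj₁ refl) (inj₁ (lt , _)) _ refl = contradiction lt (ℕₚ.<-asym ℕₚ.≤-refl)
  backward (inj₂ refl) (inj₁ refl) (inj₂ (_ , lt)) _ refl = contradiction lt (ℕₚ.<-asym ℕₚ.≤-refl)
  backward _ (inj₂ refl) _ lt _ = contradiction lt (ℕₚ.<-asym ℕₚ.≤-refl)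

ℓ-exchange : ∀ (v : Permutation′ (suc m)) k i j →
             ℓ (v · s k · transpose (s {suc m} k ⟨$⟩ʳ i) (s {suc m} k ⟨$⟩ʳ j)) ≡ ℓ (v · transpose i j · s k)
ℓ-exchange v k i j = ℓ-cong (v · s k · transpose (t i) (t j)) (v · transpose i j · s k) λ x →
  ≡.trans (·-conjugate v (s k) (t i) (t j) x)
    (cong₂ (λ p q → v · transpose p q · s k ⟨$⟩ʳ x) (s-involutive k i) (s-involutive k j))
  where
  t = s k ⟨$⟩ʳ_

module _ {m : ℕ} (k : Fin m) where
  private
    t : Fin (suc m) → Fin (suc m)
    t = s {suc m} k ⟨$⟩ʳ_

    e : Fin (suc m) → Fin (suc m) → Permutation′ (suc m) → ℚ
    e i j v = at (descends k) v * (sign (t i) (t j) * 𝟙 (cover? (v · s k) (t i) (t j)))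

  chevalley-unrelated : ∀ (v : Permutation′ (suc m)) {i j} →
    ¬ (i ≡ inject₁ k × j ≡ suc k) → ¬ (i ≡ suc k × j ≡ inject₁ k) →
    sign i j * 𝟙 (cover? v i j) * at (descends k) (v · transpose i j) ≡ e i j v
  chevalley-unrelated v {i} {j} ¬up ¬down with i ≟ j
  ... | yes refl = ≡.trans
    (zero₁ (sign i i) (𝟙 (cover? v i i)) (at (descends k) (v · transpose i i)) (sign-diagonal i))
    (≡.sym (zero₂ (sign (t i) (t i)) (at (descends k) v) (𝟙 (cover? (v · s k) (t i) (t i))) (sign-diagonal (t i))))
    where
    zero₁ : ∀ a b c → a ≡ 0ℚ → a * b * c ≡ 0ℚ
    zero₁ _ b c refl = ≡.trans (cong (_* c) (ℚₚ.*-zeroˡ b)) (ℚₚ.*-zeroˡ c)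
    zero₂ : ∀ a b c → a ≡ 0ℚ → b * (a * c) ≡ 0ℚ
    zero₂ _ b c refl = ≡.trans (cong (b *_) (ℚₚ.*-zeroˡ c)) (ℚₚ.*-zeroʳ b)
  ... | no i≢j = begin
    sign i j * κ * δ′  ≡⟨ ℚₚ.*-assoc (sign i j) κ δ′ ⟩
    sign i j * (κ * δ′)  ≡⟨ cong (sign i j *_) exchange ⟩
    sign i j * (δ * κ′)  ≡⟨ solve 3 (λ a b c → a :* (b :* c) := b :* (a :* c)) refl (sign i j) δ κ′ ⟩
    δ * (sign i j * κ′)  ≡⟨ cong (λ x → δ * (x * κ′)) (sign-s-unrelated k ¬up ¬down) ⟨
    e i j v  ∎
    where
    open ≡-Reasoning
    κ = 𝟙 (cover? v i j)
    κ′ = 𝟙 (cover? (v · s k) (t i) (t j))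
    δ = at (descends k) v
    δ′ = at (descends k) (v · transpose i j)
    eq = ℓ-exchange v k i j

    exchange : κ * δ′ ≡ δ * κ′
    exchange = ≡.trans
      (cover-exchange (Sum.swap (ℓ-adjacent (v · transpose i j) k)) (Sum.swap (ℓ-adjacent v k))
        (subst (λ x → (ℓ v ℕ.< ℓ (v · transpose i j) × ℓ (v · s k) ℕ.< x) ⊎
                      (ℓ (v · transpose i j) ℕ.< ℓ v × x ℕ.< ℓ (v · s k))) eq (parallel v k i≢j ¬up ¬down)))
      (cong (λ x → δ * 𝟙 (x ℕₚ.≟ suc (ℓ (v · s k)))) (≡.sym eq))

  private
    simple : ∀ (v : Permutation′ (suc m)) →
      𝟙 (ℓ (v · s k) ℕₚ.≟ suc (ℓ v)) * 𝟙 (ℓ (v · s k · s k) ℕₚ.<? ℓ (v · s k)) ≡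
      1ℚ - 𝟙 (ℓ (v · s k) ℕₚ.<? ℓ v) * 𝟙 (ℓ (v · s k · s k) ℕₚ.≟ suc (ℓ (v · s k)))
    simple v rewrite ℓ-cong (v · s k · s k) v (s-involutiveʳ v k) = go (ℓ-adjacent v k)
      where
      go : ∀ {p r} → r ≡ suc p ⊎ p ≡ suc r →
           𝟙 (r ℕₚ.≟ suc p) * 𝟙 (p ℕₚ.<? r) ≡ 1ℚ - 𝟙 (r ℕₚ.<? p) * 𝟙 (p ℕₚ.≟ suc r)
      go {p} (inj₁ refl) = ≡.trans (cong₂ _*_ (𝟙-yes (suc p ℕₚ.≟ suc p) refl) (𝟙-yes (p ℕₚ.<? suc p) ℕₚ.≤-refl))
        (≡.sym (≡.trans (cong (λ x → 1ℚ - x * 𝟙 (p ℕₚ.≟ suc (suc p)))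
                              (𝟙-no (suc p ℕₚ.<? p) (ℕₚ.<-asym ℕₚ.≤-refl)))
                        (cong (λ x → 1ℚ - x) (ℚₚ.*-zeroˡ (𝟙 (p ℕₚ.≟ suc (suc p)))))))
      go {r = r} (inj₂ refl) = ≡.trans
        (≡.trans (cong (𝟙 (r ℕₚ.≟ suc (suc r)) *_) (𝟙-no (suc r ℕₚ.<? r) (ℕₚ.<-asym ℕₚ.≤-refl)))
                 (ℚₚ.*-zeroʳ (𝟙 (r ℕₚ.≟ suc (suc r)))))
        (≡.sym (cong₂ (λ x y → 1ℚ - x * y) (𝟙-yes (r ℕₚ.<? suc r) ℕₚ.≤-refl) (𝟙-yes (suc r ℕₚ.≟ suc r) refl)))

  chevalley-term : ∀ (v : Permutation′ (suc m)) i j →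
    sign i j * 𝟙 (cover? v i j) * at (descends k) (v · transpose i j) ≡ e i j v + τ k i j
  chevalley-term v i j with position k i j
  ... | unrelated {a} {b} ¬up ¬down = ≡.trans (chevalley-unrelated v ¬up ¬down)
    (≡.trans (≡.sym (ℚₚ.+-identityʳ (e a b v))) (cong (e a b v +_) (≡.sym (τ-unrelated k ¬up ¬down))))
  ... | ascending
    rewrite τ-ascending k | s-fst k | s-snd k
          | sign-< (inject₁<suc k) | sign-> (inject₁<suc k)
          | ℓ-transpose-comm (v · s k) (suc k) (inject₁ k) = ≡.trans
      (cong (_* at (descends k) (v · s k)) (ℚₚ.*-identityˡ (𝟙 (ℓ (v · s k) ℕₚ.≟ suc (ℓ v)))))
      (≡.trans (simple v)
        (solve 2 (λ a b → const 1ℚ :- a :* b := a :* (const (- 1ℚ) :* b) :+ const 1ℚ) refl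
          (at (descends k) v) (𝟙 (ℓ (v · s k · s k) ℕₚ.≟ suc (ℓ (v · s k))))))
  ... | descending
    rewrite τ-descending k | s-fst k | s-snd k
          | sign-< (inject₁<suc k) | sign-> (inject₁<suc k)
          | ℓ-transpose-comm v (suc k) (inject₁ k)
          | ℓ-cong (v · transpose (suc k) (inject₁ k) · s k) (v · s k · s k)
              (·-congˡ {u = v · transpose (suc k) (inject₁ k)} {v · s k} (s k) (·-transpose-comm v (suc k) (inject₁ k))) = ≡.trans
      (solve 2 (λ a b → const (- 1ℚ) :* a :* b := :- (a :* b)) refl
        (𝟙 (ℓ (v · s k) ℕₚ.≟ suc (ℓ v))) (𝟙 (ℓ (v · s k · s k) ℕₚ.<? ℓ (v · s k))))
      (≡.trans (cong -_ (simple v))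
        (solve 2 (λ a b → :- (const 1ℚ :- a :* b) := a :* (const 1ℚ :* b) :+ const (- 1ℚ)) refl
          (at (descends k) v) (𝟙 (ℓ (v · s k · s k) ℕₚ.≟ suc (ℓ (v · s k))))))

  X-D : ∀ i ξ v → at (X i $ᵒ D k $ᵒ ξ) v ≡ at (D k $ᵒ X (t i) $ᵒ ξ) v + ε k i * at ξ v
  X-D i ξ v = begin
    at (X i $ᵒ D k $ᵒ ξ) v
      ≡⟨ X-at i (D k $ᵒ ξ) v ⟩
    ∑ (λ j → c j * (at (descends k) (v · transpose i j) * f i j))
      ≡⟨ (∑-cong λ j → ≡.trans (≡.sym (ℚₚ.*-assoc (c j) (at (descends k) (v · transpose i j)) (f i j)))
            (≡.trans (cong (_* f i j) (chevalley-term v i j)) (ℚₚ.*-distribʳ-+ (f i j) (e i j v) (τ k i j)))) ⟩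
    ∑ (λ j → e i j v * f i j + τ k i j * f i j)
      ≡⟨ ℚ-Sum.∑-distrib-+ (λ j → e i j v * f i j) (λ j → τ k i j * f i j) ⟩
    ∑ (λ j → e i j v * f i j) + ∑ (λ j → τ k i j * f i j)
      ≡⟨ cong₂ _+_ reindexed (∑-τ k i f (at ξ v) (resp ξ _ v (s-involutiveʳ v k)) (resp ξ _ v down)) ⟩
    at (D k $ᵒ X (t i) $ᵒ ξ) v + ε k i * at ξ v ∎
    where
    open ≡-Reasoning
    c : Fin (suc m) → ℚ
    c j = sign i j * 𝟙 (cover? v i j)

    f : Fin (suc m) → Fin (suc m) → ℚ
    f i j = at ξ (v · transpose i j · s k)

    down : v · transpose (suc k) (inject₁ k) · s k ≈ₚ v
    down x = ≡.trans (·-transpose-comm v (suc k) (inject₁ k) (s k ⟨$⟩ʳ x)) (s-involutiveʳ v k x)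

    d : Fin (suc m) → ℚ
    d j = sign (t i) j * 𝟙 (cover? (v · s k) (t i) j) * at ξ (v · s k · transpose (t i) j)

    term : ∀ j → e i j v * f i j ≡ at (descends k) v * d (t j)
    term j = ≡.trans (ℚₚ.*-assoc (at (descends k) v) (sign (t i) (t j) * 𝟙 (cover? (v · s k) (t i) (t j))) (f i j))
      (cong (λ x → at (descends k) v * (sign (t i) (t j) * 𝟙 (cover? (v · s k) (t i) (t j)) * x))
        (resp ξ (v · transpose i j · s k) (v · s k · transpose (t i) (t j)) λ x → ≡.sym
          (≡.trans (·-conjugate v (s k) (t i) (t j) x)
            (cong₂ (λ p q → v · transpose p q · s k ⟨$⟩ʳ x) (s-involutive k i) (s-involutive k j)))))

    reindexed : ∑ (λ j → e i j v * f i j) ≡ at (D k $ᵒ X (t i) $ᵒ ξ) v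
    reindexed = begin
      ∑ (λ j → e i j v * f i j)             ≡⟨ ∑-cong term ⟩
      ∑ (λ j → at (descends k) v * d (t j)) ≡⟨ ℚ-Sum.*-distribˡ-sum (at (descends k) v) (d ∘ t) ⟨
      at (descends k) v * ∑ (d ∘ t)         ≡⟨ cong (at (descends k) v *_) (ℚ-Sum.sum-permute d (s k)) ⟨
      at (descends k) v * ∑ d               ≡⟨ cong (at (descends k) v *_) (X-at (t i) ξ (v · s k)) ⟨
      at (D k $ᵒ X (t i) $ᵒ ξ) v            ∎

D-X : ∀ (k : Fin m) i ξ v →
      at (D k $ᵒ X i $ᵒ ξ) v ≡ at (X (s {suc m} k ⟨$⟩ʳ i) $ᵒ D k $ᵒ ξ) v + ε k i * at ξ v
D-X {m} k i ξ v = begin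
  at (D k $ᵒ X i $ᵒ ξ) v
    ≡⟨ cong (λ j → at (D k $ᵒ X j $ᵒ ξ) v) (s-involutive k i) ⟨
  at (D k $ᵒ X (t (t i)) $ᵒ ξ) v
    ≡⟨ solve 3 (λ a e x → a := (a :+ (:- e) :* x) :+ e :* x) refl
         (at (D k $ᵒ X (t (t i)) $ᵒ ξ) v) (ε k i) (at ξ v) ⟩
  at (D k $ᵒ X (t (t i)) $ᵒ ξ) v + (- ε k i) * at ξ v + ε k i * at ξ v
    ≡⟨ cong (λ e → at (D k $ᵒ X (t (t i)) $ᵒ ξ) v + e * at ξ v + ε k i * at ξ v) (ε-s k i) ⟨
  at (D k $ᵒ X (t (t i)) $ᵒ ξ) v + ε k (t i) * at ξ v + ε k i * at ξ v
    ≡⟨ cong (_+ ε k i * at ξ v) (X-D k (t i) ξ v) ⟨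
  at (X (t i) $ᵒ D k $ᵒ ξ) v + ε k i * at ξ v ∎
  where
  open ≡-Reasoning
  t = s {suc m} k ⟨$⟩ʳ_

X-reverse : ∀ (i : Fin (suc m)) ξ v → v ≈ₚ reverse → at (X i $ᵒ ξ) v ≡ 0ℚ
X-reverse {m} i ξ v v≈ = ≡.trans (X-at i ξ v)
  (ℚ-Sum.∑-zero {f = λ j → sign i j * 𝟙 (cover? v i j) * at ξ (v · transpose i j)} λ j →
    ≡.trans (cong (_* at ξ (v · transpose i j)) (vanish i j)) (ℚₚ.*-zeroˡ (at ξ (v · transpose i j))))
  where
  shorter : ∀ {i j} → i < j → ℓ (v · transpose i j) ≢ suc (ℓ v)
  shorter {i} {j} i<j eq = ℕₚ.<-asym (ℓ-transpose-descent v i<j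
    (≡.subst₂ _<_ (≡.sym (v≈ j)) (≡.sym (v≈ i)) (opposite-< i<j))) (ℕₚ.≤-reflexive (≡.sym eq))

  vanish : ∀ i j → sign i j * 𝟙 (cover? v i j) ≡ 0ℚ
  vanish i j with <-cmp i j
  ... | tri< i<j _ _ = cong (1ℚ *_) (𝟙-no (cover? v i j) (shorter i<j))
  ... | tri≈ _ _ _   = ℚₚ.*-zeroˡ (𝟙 (cover? v i j))
  ... | tri> _ _ j<i = cong (- 1ℚ *_) (𝟙-no (cover? v i j) (shorter j<i ∘ ≡.trans (ℓ-transpose-comm v j i)))

-- Descending induction: ∂_k [X_i , X_j] = [X_s(i) , X_s(j)] ∂_k.
X-comm-at : ∀ (v : Permutation′ (suc m)) ξ i j → at (X i $ᵒ X j $ᵒ ξ) v ≡ at (X j $ᵒ X i $ᵒ ξ) v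
X-comm-at {m} = descending-from-reverse
  (λ v → ∀ ξ i j → at (X i $ᵒ X j $ᵒ ξ) v ≡ at (X j $ᵒ X i $ᵒ ξ) v)
  (λ v v≈ ξ i j → ≡.trans (X-reverse i (X j $ᵒ ξ) v v≈) (≡.sym (X-reverse j (X i $ᵒ ξ) v v≈)))
  step
  where
  step : ∀ w u k → (∀ ξ i j → at (X i $ᵒ X j $ᵒ ξ) w ≡ at (X j $ᵒ X i $ᵒ ξ) w) →
         ℓ (w · s k) ℕ.< ℓ w → u ≈ₚ w · s k →
         ∀ ξ i j → at (X i $ᵒ X j $ᵒ ξ) u ≡ at (X j $ᵒ X i $ᵒ ξ) u
  step w u k ih lt u≈ ξ i j = begin
    at (X i $ᵒ X j $ᵒ ξ) u                                      ≡⟨ expand i j ⟩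
    a + ε k j * f (t i) + ε k i * f j                           ≡⟨ cong (λ x → a + ε k j * x + ε k i * f j) (f-t i) ⟩
    a + ε k j * (f i - ε k i * Δ) + ε k i * f j
      ≡⟨ rearrange a (ε k j) (ε k i) (f i) (f j) Δ ⟩
    a + ε k i * (f j - ε k j * Δ) + ε k j * f i                 ≡⟨ cong₂ (λ a x → a + ε k i * x + ε k j * f i) (ih (D k $ᵒ ξ) (t i) (t j)) (≡.sym (f-t j)) ⟩
    at (X (t j) $ᵒ X (t i) $ᵒ D k $ᵒ ξ) w + ε k i * f (t j) + ε k j * f i ≡⟨ expand j i ⟨
    at (X j $ᵒ X i $ᵒ ξ) u                                      ∎
    where
    open ≡-Reasoning
    t = s {suc m} k ⟨$⟩ʳ_
    a = at (X (t i) $ᵒ X (t j) $ᵒ D k $ᵒ ξ) w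

    f : Fin (suc m) → ℚ
    f l = at (X l $ᵒ ξ) w

    Δ = f (inject₁ k) - f (suc k)

    f-t : ∀ l → f (t l) ≡ f l - ε k l * Δ
    f-t l = ≡.trans (solve 2 (λ x y → y := x :- (x :- y)) refl (f l) (f (t l)))
                    (cong (λ x → f l - x) (ε-difference k f l))

    rearrange : ∀ a p q x y d → a + p * (x - q * d) + q * y ≡ a + q * (y - p * d) + p * x
    rearrange = solve 6 (λ a p q x y d → a :+ p :* (x :- q :* d) :+ q :* y := a :+ q :* (y :- p :* d) :+ p :* x) refl

    expand : ∀ i j → at (X i $ᵒ X j $ᵒ ξ) u ≡
                     at (X (t i) $ᵒ X (t j) $ᵒ D k $ᵒ ξ) w + ε k j * f (t i) + ε k i * f j
    expand i j = begin
      at (X i $ᵒ X j $ᵒ ξ) u          ≡⟨ resp (X i $ᵒ X j $ᵒ ξ) u (w · s k) u≈ ⟩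
      at (X i $ᵒ X j $ᵒ ξ) (w · s k)  ≡⟨ D-descent k (X i $ᵒ X j $ᵒ ξ) w lt ⟨
      at (D k $ᵒ X i $ᵒ X j $ᵒ ξ) w   ≡⟨ D-X k i (X j $ᵒ ξ) w ⟩
      at (X (t i) $ᵒ D k $ᵒ X j $ᵒ ξ) w + ε k i * f j
        ≡⟨ cong (_+ ε k i * f j) (≡.trans
             ($-cong (X (t i)) (D k $ᵒ X j $ᵒ ξ) (X (t j) $ᵒ D k $ᵒ ξ +ᶠ ε k j *ᶠ ξ) (D-X k j ξ) w)
             (≡.trans ($-+ (X (t i)) (X (t j) $ᵒ D k $ᵒ ξ) (ε k j *ᶠ ξ) w)
               (cong (a′ +_) ($-* (X (t i)) (ε k j) ξ w)))) ⟩
      a′ + ε k j * f (t i) + ε k i * f j ∎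
      where
      a′ = at (X (t i) $ᵒ X (t j) $ᵒ D k $ᵒ ξ) w

X-comm : ∀ (i j : Fin (suc m)) → X i *ᵒ X j ≈ᵒ X j *ᵒ X i
X-comm i j = pointwise λ ξ v → X-comm-at v ξ i j

-- Evaluation of expressions

module Evaluation
  {G : Set} (R : Ring 0ℓ 0ℓ)
  (c : ℚ → Ring.Carrier R)
  (c-0 : Ring._≈_ R (c 0ℚ) (Ring.0# R))
  (c-1 : Ring._≈_ R (c 1ℚ) (Ring.1# R))
  (c-+ : ∀ p q → Ring._≈_ R (c (p + q)) (Ring._+_ R (c p) (c q)))
  (c-* : ∀ p q → Ring._≈_ R (c (p * q)) (Ring._*_ R (c p) (c q)))
  (c-central : ∀ q a → Ring._≈_ R (Ring._*_ R (c q) a) (Ring._*_ R a (c q)))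
  (γ : G → Ring.Carrier R)
  where
  private
    module R = Ring R

  ⟦_⟧ : Expr G → R.Carrier
  ⟦ gen g ⟧ = γ g
  ⟦ con q ⟧ = c q
  ⟦ a ⊕ b ⟧ = ⟦ a ⟧ R.+ ⟦ b ⟧
  ⟦ a ⊗ b ⟧ = ⟦ a ⟧ R.* ⟦ b ⟧
  ⟦ ⊝ a ⟧   = R.- ⟦ a ⟧

  sound : ∀ {_∼_ : Expr G → Expr G → Set} → (∀ {a b} → a ∼ b → ⟦ a ⟧ R.≈ ⟦ b ⟧) →
          ∀ {a b} → Quotient _∼_ a b → ⟦ a ⟧ R.≈ ⟦ b ⟧
  sound rel (relation r)      = rel r
  sound rel refl              = R.refl
  sound rel (sym p)           = R.sym (sound rel p)
  sound rel (trans p q)       = R.trans (sound rel p) (sound rel q)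
  sound rel (⊕-cong p q)      = R.+-cong (sound rel p) (sound rel q)
  sound rel (⊗-cong p q)      = R.*-cong (sound rel p) (sound rel q)
  sound rel (⊝-cong p)        = R.-‿cong (sound rel p)
  sound rel (⊕-assoc a b d)   = R.+-assoc ⟦ a ⟧ ⟦ b ⟧ ⟦ d ⟧
  sound rel (⊕-comm a b)      = R.+-comm ⟦ a ⟧ ⟦ b ⟧
  sound rel (⊕-identityˡ a)   = R.trans (R.+-congʳ c-0) (R.+-identityˡ ⟦ a ⟧)
  sound rel (⊝-inverseˡ a)    = R.trans (R.-‿inverseˡ ⟦ a ⟧) (R.sym c-0)
  sound rel (⊗-assoc a b d)   = R.*-assoc ⟦ a ⟧ ⟦ b ⟧ ⟦ d ⟧
  sound rel (⊗-identityˡ a)   = R.trans (R.*-congʳ c-1) (R.*-identityˡ ⟦ a ⟧)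
  sound rel (⊗-identityʳ a)   = R.trans (R.*-congˡ c-1) (R.*-identityʳ ⟦ a ⟧)
  sound rel (distribˡ a b d)  = R.distribˡ ⟦ a ⟧ ⟦ b ⟧ ⟦ d ⟧
  sound rel (distribʳ a b d)  = R.distribʳ ⟦ a ⟧ ⟦ b ⟧ ⟦ d ⟧
  sound rel (con-+ p q)       = c-+ p q
  sound rel (con-* p q)       = c-* p q
  sound rel (con-central q a) = c-central q ⟦ a ⟧

module Polynomial {n : ℕ} =
  Evaluation {Fin n} (Op-ring n) scalar (Ring.refl (Op-ring n)) (Ring.refl (Op-ring n)) scalar-+ scalar-* scalar-central X

open Polynomial using () renaming (⟦_⟧ to op)

op-cong : ∀ {f g : Poly (suc m)} → f ≈[x] g → op f ≈ᵒ op g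
op-cong = Polynomial.sound λ { (commute i j) → X-comm i j }

module _ {G : Set} (_∼_ : Expr G → Expr G → Set) where
  private
    Q = Quotient _∼_

    ⊕-identityʳ : ∀ a → Q (a ⊕ con 0ℚ) a
    ⊕-identityʳ a = trans (⊕-comm a (con 0ℚ)) (⊕-identityˡ a)

    ⊝-inverseʳ : ∀ a → Q (a ⊕ ⊝ a) (con 0ℚ)
    ⊝-inverseʳ a = trans (⊕-comm a (⊝ a)) (⊝-inverseˡ a)

  Quotient-ring : Ring 0ℓ 0ℓ
  Quotient-ring = record
    { Carrier = Expr G
    ; _≈_ = Q
    ; _+_ = _⊕_
    ; _*_ = _⊗_
    ; -_ = ⊝_
    ; 0# = con 0ℚ
    ; 1# = con 1ℚ
    ; isRing = record
      { +-isAbelianGroup = record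
        { isGroup = record
          { isMonoid = record
            { isSemigroup = record
              { isMagma = record { isEquivalence = record { refl = refl ; sym = sym ; trans = trans } ; ∙-cong = ⊕-cong }
              ; assoc = ⊕-assoc
              }
            ; identity = ⊕-identityˡ , ⊕-identityʳ
            }
          ; inverse = ⊝-inverseˡ , ⊝-inverseʳ
          ; ⁻¹-cong = ⊝-cong
          }
        ; comm = ⊕-comm
        }
      ; *-cong = ⊗-cong
      ; *-assoc = ⊗-assoc
      ; *-identity = ⊗-identityˡ , ⊗-identityʳ
      ; distrib = distribˡ , distribʳ
      }
    }

module _ {n : ℕ} where
  private
    module R = Ring (Quotient-ring (Commute {n}))
    open import Algebra.Properties.Ring (Quotient-ring (Commute {n})) using (-‿distribˡ-*; -‿distribʳ-*)

    commutes : ∀ x → (∀ i → x ⊗ gen i ≈[x] gen i ⊗ x) → ∀ b → x ⊗ b ≈[x] b ⊗ x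
    commutes x h (gen i) = h i
    commutes x h (con q) = sym (con-central q x)
    commutes x h (a ⊕ b) = trans (distribˡ x a b) (trans (⊕-cong (commutes x h a) (commutes x h b)) (sym (distribʳ x a b)))
    commutes x h (a ⊗ b) = trans (sym (⊗-assoc x a b)) (trans (⊗-cong (commutes x h a) refl)
      (trans (⊗-assoc a x b) (trans (⊗-cong refl (commutes x h b)) (sym (⊗-assoc a b x)))))
    commutes x h (⊝ a)   = trans (sym (-‿distribʳ-* x a)) (trans (⊝-cong (commutes x h a)) (-‿distribˡ-* a x))

  ⊗-comm : ∀ (a b : Poly n) → a ⊗ b ≈[x] b ⊗ a
  ⊗-comm a = commutes a λ i → sym (commutes (gen i) (λ j → relation (commute i j)) a)

  Poly-ring : CommutativeRing 0ℓ 0ℓ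
  Poly-ring = record { isCommutativeRing = record { isRing = R.isRing ; *-comm = ⊗-comm } }

-- Divided differences

dividedDifference : Fin m → Poly (suc m) → Poly (suc m)
dividedDifference k (gen i) = con (ε k i)
dividedDifference k (con q) = con 0ℚ
dividedDifference k (a ⊕ b) = dividedDifference k a ⊕ dividedDifference k b
dividedDifference k (a ⊗ b) = dividedDifference k a ⊗ act (s k) b ⊕ a ⊗ dividedDifference k b
dividedDifference k (⊝ a)   = ⊝ dividedDifference k a
module _ {m : ℕ} where
  private
    R = Poly-ring {suc m}
    module R = CommutativeRing R
    open import Relation.Binary.Reasoning.Setoid R.setoid

    con-neg : ∀ q → con (- q) ≈[x] (Poly (suc m) ∋ ⊝ con q)
    con-neg q = R.trans (R.sym (R.+-identityʳ (con (- q))))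
      (R.trans (R.+-congˡ (R.sym (R.-‿inverseʳ (con q))))
      (R.trans (R.sym (R.+-assoc (con (- q)) (con q) (⊝ con q)))
      (R.trans (R.+-congʳ (R.trans (R.sym (con-+ (- q) q)) (R.reflexive (cong con (ℚₚ.+-inverseˡ q)))))
               (R.+-identityˡ (⊝ con q)))))

    coefficients : ACR._-Raw-AlmostCommutative⟶_ (CommutativeRing.rawRing ℚₚ.+-*-commutativeRing) (ACR.fromCommutativeRing R)
    coefficients = record
      { ⟦_⟧ = con ; +-homo = con-+ ; *-homo = con-* ; -‿homo = con-neg ; 0-homo = R.refl ; 1-homo = R.refl }

    coefficient≟ : ∀ p q → Maybe (con p ≈[x] (Poly (suc m) ∋ con q))
    coefficient≟ p q = Maybe.map (λ p≡q → R.reflexive (cong con p≡q)) (dec⇒maybe (p ℚₚ.≟ q))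

    module RS = RingSolver (CommutativeRing.rawRing ℚₚ.+-*-commutativeRing) (ACR.fromCommutativeRing R) coefficients coefficient≟

    leibniz : ∀ p a b sa sb da db → p ⊗ da ≈[x] a ⊖ sa → p ⊗ db ≈[x] b ⊖ sb →
              p ⊗ (da ⊗ sb ⊕ a ⊗ db) ≈[x] a ⊗ b ⊖ sa ⊗ sb
    leibniz p a b sa sb da db ea eb = begin
      p ⊗ (da ⊗ sb ⊕ a ⊗ db)        ≈⟨ RS.solve 5 (λ p da sb a db → p RS.:* (da RS.:* sb RS.:+ a RS.:* db) RS.:= ((p RS.:* da) RS.:* sb RS.:+ a RS.:* (p RS.:* db))) R.refl p da sb a db ⟩
      (p ⊗ da) ⊗ sb ⊕ a ⊗ (p ⊗ db)  ≈⟨ R.+-cong (R.*-congʳ ea) (R.*-congˡ eb) ⟩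
      (a ⊖ sa) ⊗ sb ⊕ a ⊗ (b ⊖ sb)  ≈⟨ RS.solve 4 (λ a b sa sb → (a RS.:- sa) RS.:* sb RS.:+ a RS.:* (b RS.:- sb) RS.:= (a RS.:* b RS.:- (sa RS.:* sb))) R.refl a b sa sb ⟩
      a ⊗ b ⊖ sa ⊗ sb               ∎

  dividedDifference-correct : ∀ (k : Fin m) f → DividedDifference k f (dividedDifference k f)
  dividedDifference-correct k (gen i) with index k i
  ... | fst rewrite s-fst k | ε-fst k = R.*-identityʳ (gen (inject₁ k) ⊖ gen (suc k))
  ... | snd rewrite s-snd k | ε-snd k = R.trans (R.*-congˡ (con-neg 1ℚ)) (R.trans
    (RS.solve 3 (λ x y e → (x RS.:- y) RS.:* (RS.:-_ e) RS.:= (y RS.:* e RS.:- (x RS.:* e))) R.refl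
      (gen (inject₁ k)) (gen (suc k)) (con 1ℚ))
    (R.+-cong (R.*-identityʳ (gen (suc k))) (R.-‿cong (R.*-identityʳ (gen (inject₁ k))))))
  ... | other p q rewrite s-other k p q | ε-other k p q = R.trans (R.zeroʳ (gen (inject₁ k) ⊖ gen (suc k))) (R.sym (R.-‿inverseʳ (gen i)))
  dividedDifference-correct k (con q) = R.trans (R.zeroʳ (gen (inject₁ k) ⊖ gen (suc k))) (R.sym (R.-‿inverseʳ (con q)))
  dividedDifference-correct k (a ⊕ b) = R.trans
    (R.distribˡ (gen (inject₁ k) ⊖ gen (suc k)) (dividedDifference k a) (dividedDifference k b))
    (R.trans (R.+-cong (dividedDifference-correct k a) (dividedDifference-correct k b))
      (RS.solve 4 (λ a b c d → (a RS.:- b) RS.:+ (c RS.:- d) RS.:= ((a RS.:+ c) RS.:- (b RS.:+ d))) R.refl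
        a (act (s k) a) b (act (s k) b)))
  dividedDifference-correct k (a ⊗ b) = leibniz (gen (inject₁ k) ⊖ gen (suc k)) a b (act (s k) a) (act (s k) b)
    (dividedDifference k a) (dividedDifference k b) (dividedDifference-correct k a) (dividedDifference-correct k b)
  dividedDifference-correct k (⊝ a) = R.trans
    (R.sym (-‿distribʳ-* (gen (inject₁ k) ⊖ gen (suc k)) (dividedDifference k a)))
    (R.trans (R.-‿cong (dividedDifference-correct k a))
      (RS.solve 2 (λ a b → RS.:-_ (a RS.:- b) RS.:= ((RS.:-_ a) RS.:- (RS.:-_ b))) R.refl a (act (s k) a)))
    where open import Algebra.Properties.Ring R.ring using (-‿distribʳ-*)

op-D : ∀ (k : Fin m) f → op f *ᵒ D k ≈ᵒ D k *ᵒ op (act (s k) f) +ᵒ op (dividedDifference k f)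
op-D k (gen i) = pointwise (X-D k i)
op-D k (con q) = pointwise λ ξ v → ≡.trans (≡.sym ($-* (D k) q ξ v))
  (solve 2 (λ a x → a := a :+ const 0ℚ :* x) refl (at (D k $ᵒ (q *ᶠ ξ)) v) (at ξ v))
op-D k (a ⊕ b) = pointwise λ ξ v → ≡.trans
  (cong₂ _+_ (point (op-D k a) ξ v) (point (op-D k b) ξ v))
  (≡.trans (solve 4 (λ x y z w → (x :+ y) :+ (z :+ w) := (x :+ z) :+ (y :+ w)) refl
     (at (D k $ᵒ op (act (s k) a) $ᵒ ξ) v) (at (op (dividedDifference k a) $ᵒ ξ) v)
     (at (D k $ᵒ op (act (s k) b) $ᵒ ξ) v) (at (op (dividedDifference k b) $ᵒ ξ) v))
   (cong (_+ (at (op (dividedDifference k a) $ᵒ ξ) v + at (op (dividedDifference k b) $ᵒ ξ) v))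
     (≡.sym ($-+ (D k) (op (act (s k) a) $ᵒ ξ) (op (act (s k) b) $ᵒ ξ) v))))
op-D k (a ⊗ b) = pointwise λ ξ v → let sa = op (act (s k) a); sb = op (act (s k) b); db = op (dividedDifference k b) in
  ≡.trans ($-cong (op a) (op b $ᵒ D k $ᵒ ξ) (D k $ᵒ sb $ᵒ ξ +ᶠ db $ᵒ ξ) (point (op-D k b) ξ) v)
  (≡.trans ($-+ (op a) (D k $ᵒ sb $ᵒ ξ) (db $ᵒ ξ) v)
  (≡.trans (cong (_+ at (op a $ᵒ db $ᵒ ξ) v) (point (op-D k a) (sb $ᵒ ξ) v))
           (ℚₚ.+-assoc (at (D k $ᵒ sa $ᵒ sb $ᵒ ξ) v) (at (op (dividedDifference k a) $ᵒ sb $ᵒ ξ) v) (at (op a $ᵒ db $ᵒ ξ) v))))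
op-D k (⊝ a) = pointwise λ ξ v → ≡.trans (cong (- 1ℚ *_) (point (op-D k a) ξ v))
  (≡.trans (ℚₚ.*-distribˡ-+ (- 1ℚ) (at (D k $ᵒ op (act (s k) a) $ᵒ ξ) v) (at (op (dividedDifference k a) $ᵒ ξ) v))
    (cong (_+ - 1ℚ * at (op (dividedDifference k a) $ᵒ ξ) v) (≡.sym ($-* (D k) (- 1ℚ) (op (act (s k) a) $ᵒ ξ) v))))

-- The pairing of a polynomial with a homology class: the coefficient of
-- [X(e)] in f · ξ.
⟨_∣_⟩ : Poly (suc m) → Fun (suc m) → ℚ
⟨ f ∣ ξ ⟩ = at (op f $ᵒ ξ) idₚ

∂-adjoint : ∀ (k : Fin m) f ξ → ⟨ f ∣ D k $ᵒ ξ ⟩ ≡ ⟨ dividedDifference k f ∣ ξ ⟩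
∂-adjoint k f ξ = ≡.trans (point (op-D k f) ξ idₚ)
  (≡.trans (cong (_+ ⟨ dividedDifference k f ∣ ξ ⟩) (D-identity k (op (act (s k) f) $ᵒ ξ)))
           (ℚₚ.+-identityˡ ⟨ dividedDifference k f ∣ ξ ⟩))

-- The staircase monomial

monomial : (Fin n → ℕ) → Poly n
monomial e = product (List.map (λ i → power (gen i) (e i)) (allFin _))

monomial-cong : ∀ {e e′ : Fin n → ℕ} → (∀ i → e i ≡ e′ i) → monomial e ≡ monomial e′
monomial-cong eq = cong product (Listₚ.map-cong (λ i → cong (power (gen i)) (eq i)) (allFin _))

module _ {n : ℕ} where
  private
    module R = CommutativeRing (Poly-ring {n})
    module Π = FiniteSums R.*-commutativeMonoid

    product-⨁ : ∀ {A : Set} (F : A → Poly n) xs → product (List.map F xs) ≡ Π.⨁ xs F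
    product-⨁ F []       = refl
    product-⨁ F (x ∷ xs) = cong (F x ⊗_) (product-⨁ F xs)

    product-∑ : ∀ (F : Fin n → Poly n) → product (List.map F (allFin n)) ≡ Π.∑ F
    product-∑ F = ≡.trans (product-⨁ F (allFin n)) (Π.⨁-tabulate (λ i → i) F)

  monomial-suc : ∀ k {e e′ : Fin n → ℕ} → e′ k ≡ suc (e k) → (∀ i → i ≢ k → e′ i ≡ e i) →
                 monomial e′ ≈[x] gen k ⊗ monomial e
  monomial-suc k {e} {e′} eq-k eq = begin
    monomial e′                       ≡⟨ product-∑ F′ ⟩
    Π.∑ F′                              ≈⟨ Π.sum-cong-≋ (λ i → factor i (i ≟ k)) ⟩
    Π.∑ (λ i → indicator i ⊗ F i)       ≈⟨ Π.∑-distrib-+ indicator F ⟩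
    Π.∑ indicator ⊗ Π.∑ F                 ≈⟨ R.*-cong (Π.∑-single k indicator λ i i≢k → R.reflexive (if-no (i ≟ k) i≢k))
                                                  (R.reflexive (≡.sym (product-∑ F))) ⟩
    indicator k ⊗ monomial e          ≡⟨ cong (_⊗ monomial e) (if-yes (k ≟ k) refl) ⟩
    gen k ⊗ monomial e                ∎
    where
    open import Relation.Binary.Reasoning.Setoid R.setoid
    F F′ indicator : Fin n → Poly n
    F i = power (gen i) (e i)
    F′ i = power (gen i) (e′ i)
    indicator i = if does (i ≟ k) then gen i else con 1ℚ

    factor : ∀ i (d : Dec (i ≡ k)) → F′ i ≈[x] (if does d then gen i else con 1ℚ) ⊗ F i
    factor i (yes refl) = R.reflexive (cong (power (gen i)) eq-k)
    factor i (no i≢k)   = R.trans (R.reflexive (cong (power (gen i)) (eq i i≢k))) (R.sym (R.*-identityˡ (F i)))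

VanishesAt : ℕ → Fun n → Set
VanishesAt L ξ = ∀ v → ℓ v ≡ L → at ξ v ≡ 0ℚ

X-vanishes : ∀ L (i : Fin n) ξ → VanishesAt (suc L) ξ → VanishesAt L (X i $ᵒ ξ)
X-vanishes L i ξ van v ℓv≡L = ≡.trans (X-at i ξ v) (ℚ-Sum.∑-zero {f = f} λ j → term j (cover? v i j))
  where
  f : Fin _ → ℚ
  f j = sign i j * 𝟙 (cover? v i j) * at ξ (v · transpose i j)
  term : ∀ j (d : Dec (ℓ (v · transpose i j) ≡ suc (ℓ v))) → sign i j * 𝟙 d * at ξ (v · transpose i j) ≡ 0ℚ
  term j (yes cov) = ≡.trans (cong (sign i j * 1ℚ *_) (van (v · transpose i j) (≡.trans cov (cong suc ℓv≡L))))
                             (ℚₚ.*-zeroʳ (sign i j * 1ℚ))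
  term j (no _)    = ≡.trans (cong (_* at ξ (v · transpose i j)) (ℚₚ.*-zeroʳ (sign i j)))
                             (ℚₚ.*-zeroˡ (at ξ (v · transpose i j)))

power-vanishes : ∀ p L (i : Fin n) ξ → VanishesAt (p ℕ.+ L) ξ → VanishesAt L (op (power (gen i) p) $ᵒ ξ)
power-vanishes zero    L i ξ van v eq = ≡.trans (ℚₚ.*-identityˡ (at ξ v)) (van v eq)
power-vanishes (suc p) L i ξ van = X-vanishes L i (op (power (gen i) p) $ᵒ ξ)
  (power-vanishes p (suc L) i ξ (subst (λ L → VanishesAt L ξ) (≡.sym (ℕₚ.+-suc p L)) van))

product-vanishes : ∀ (e : Fin n → ℕ) xs L ξ → VanishesAt (ℕ-Sum.⨁ xs e ℕ.+ L) ξ →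
                   VanishesAt L (op (product (List.map (λ i → power (gen i) (e i)) xs)) $ᵒ ξ)
product-vanishes e []       L ξ van v eq = ≡.trans (ℚₚ.*-identityˡ (at ξ v)) (van v eq)
product-vanishes e (x ∷ xs) L ξ van = power-vanishes (e x) L x (op (product (List.map (λ i → power (gen i) (e i)) xs)) $ᵒ ξ)
  (product-vanishes e xs (e x ℕ.+ L) ξ (subst (λ L → VanishesAt L ξ)
    (≡.trans (cong (ℕ._+ L) (ℕₚ.+-comm (e x) (ℕ-Sum.⨁ xs e))) (ℕₚ.+-assoc (ℕ-Sum.⨁ xs e) (e x) L)) van))

module _ {m : ℕ} (k : Fin m) where
  private
    Commutes : Poly (suc m) → Set
    Commutes f = ∀ ξ → op f $ᵒ D k $ᵒ ξ ≐ D k $ᵒ op f $ᵒ ξ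

    commutes-⊗ : ∀ {f g} → Commutes f → Commutes g → Commutes (f ⊗ g)
    commutes-⊗ {f} {g} cf cg ξ v = ≡.trans ($-cong (op f) (op g $ᵒ D k $ᵒ ξ) (D k $ᵒ op g $ᵒ ξ) (cg ξ) v) (cf (op g $ᵒ ξ) v)

    commutes-con : ∀ q → Commutes (con q)
    commutes-con q ξ v = ≡.sym ($-* (D k) q ξ v)

    commutes-power : ∀ {f} → Commutes f → ∀ p → Commutes (power f p)
    commutes-power     cf zero    = commutes-con 1ℚ
    commutes-power {f} cf (suc p) = commutes-⊗ {f} {power f p} cf (commutes-power {f} cf p)

    commutes-other : ∀ {i} → i ≢ inject₁ k → i ≢ suc k → Commutes (gen i)
    commutes-other {i} p q ξ v = ≡.trans (X-D k i ξ v) (≡.trans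
      (cong₂ (λ j e → at (D k $ᵒ X j $ᵒ ξ) v + e * at ξ v) (s-other k p q) (ε-other k p q))
      (solve 2 (λ a x → a :+ const 0ℚ :* x := a) refl (at (D k $ᵒ X i $ᵒ ξ) v) (at ξ v)))

    X⁻-D : ∀ ξ v → at (X (inject₁ k) $ᵒ D k $ᵒ ξ) v ≡ at (D k $ᵒ X (suc k) $ᵒ ξ) v + at ξ v
    X⁻-D ξ v = ≡.trans (X-D k (inject₁ k) ξ v)
      (cong₂ (λ j x → at (D k $ᵒ X j $ᵒ ξ) v + x) (s-fst k)
        (≡.trans (cong (_* at ξ v) (ε-fst k)) (ℚₚ.*-identityˡ (at ξ v))))

    X⁺-D : ∀ ξ v → at (X (suc k) $ᵒ D k $ᵒ ξ) v ≡ at (D k $ᵒ X (inject₁ k) $ᵒ ξ) v + - 1ℚ * at ξ v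
    X⁺-D ξ v = ≡.trans (X-D k (suc k) ξ v)
      (cong₂ (λ j x → at (D k $ᵒ X j $ᵒ ξ) v + x * at ξ v) (s-snd k) (ε-snd k))

    commutes-pair : Commutes (gen (suc k) ⊗ gen (inject₁ k))
    commutes-pair ξ v = ≡.trans
      ($-cong (X (suc k)) (X (inject₁ k) $ᵒ D k $ᵒ ξ) (D k $ᵒ X (suc k) $ᵒ ξ +ᶠ ξ) (X⁻-D ξ) v)
      (≡.trans ($-+ (X (suc k)) (D k $ᵒ X (suc k) $ᵒ ξ) ξ v)
      (≡.trans (cong (_+ at (X (suc k) $ᵒ ξ) v) (X⁺-D (X (suc k) $ᵒ ξ) v))
      (≡.trans (solve 2 (λ a x → a :+ const (- 1ℚ) :* x :+ x := a) refl
                  (at (D k $ᵒ X (inject₁ k) $ᵒ X (suc k) $ᵒ ξ) v) (at (X (suc k) $ᵒ ξ) v))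
        ($-cong (D k) (X (inject₁ k) $ᵒ X (suc k) $ᵒ ξ) (X (suc k) $ᵒ X (inject₁ k) $ᵒ ξ)
          (point (X-comm (inject₁ k) (suc k)) ξ) v))))

    commutes-≈ : ∀ {f g} → f ≈[x] g → Commutes g → Commutes f
    commutes-≈ {f} {g} eq cg ξ v = ≡.trans (point (op-cong eq) (D k $ᵒ ξ) v)
      (≡.trans (cg ξ v) ($-cong (D k) (op g $ᵒ ξ) (op f $ᵒ ξ) (λ w → ≡.sym (point (op-cong eq) ξ w)) v))

    commutes-product : ∀ {e : Fin (suc m) → ℕ} → e (inject₁ k) ≡ 0 → e (suc k) ≡ 0 → ∀ xs →
                       Commutes (product (List.map (λ i → power (gen i) (e i)) xs))
    commutes-product e⁻ e⁺ []       = commutes-con 1ℚ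
    commutes-product {e} e⁻ e⁺ (x ∷ xs) =
      commutes-⊗ {power (gen x) (e x)} {product (List.map (λ i → power (gen i) (e i)) xs)} factor (commutes-product {e} e⁻ e⁺ xs)
      where
      factor : Commutes (power (gen x) (e x))
      factor with index k x
      ... | fst       = subst (λ p → Commutes (power (gen (inject₁ k)) p)) (≡.sym e⁻) (commutes-con 1ℚ)
      ... | snd       = subst (λ p → Commutes (power (gen (suc k)) p)) (≡.sym e⁺) (commutes-con 1ℚ)
      ... | other p q = commutes-power {gen x} (commutes-other p q) (e x)

    -- x_k x_k+1 commutes with ∂_k, and so does x_i for the other i.
    commutes-monomial : ∀ a (e : Fin (suc m) → ℕ) → e (inject₁ k) ≡ a → e (suc k) ≡ a → Commutes (monomial e)
    commutes-monomial zero    e e⁻ e⁺ = commutes-product {e} e⁻ e⁺ (allFin (suc m))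
    commutes-monomial (suc a) e e⁻ e⁺ = commutes-≈ {monomial e} {gen (suc k) ⊗ gen (inject₁ k) ⊗ monomial e₂}
      (trans (monomial-suc (suc k) {e₁} {e} (≡.trans e⁺ (cong suc (≡.sym e₁⁺)))
               λ i i≢ → ≡.sym (updateAt-minimal i (suc k) e i≢))
        (trans (⊗-cong refl (monomial-suc (inject₁ k) {e₂} {e₁} (≡.trans e₁⁻ (cong suc (≡.sym e₂⁻)))
                 λ i i≢ → ≡.sym (updateAt-minimal i (inject₁ k) e₁ i≢)))
          (sym (⊗-assoc (gen (suc k)) (gen (inject₁ k)) (monomial e₂)))))
      (commutes-⊗ {gen (suc k) ⊗ gen (inject₁ k)} {monomial e₂} commutes-pair
        (commutes-monomial a e₂ e₂⁻ (≡.trans (updateAt-minimal (suc k) (inject₁ k) e₁ (inject₁≢suc k ∘ ≡.sym)) e₁⁺)))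
      where
      e₁ e₂ : Fin (suc m) → ℕ
      e₁ = updateAt e (suc k) λ _ → a
      e₂ = updateAt e₁ (inject₁ k) λ _ → a
      e₁⁺ : e₁ (suc k) ≡ a
      e₁⁺ = updateAt-updates (suc k) e
      e₁⁻ : e₁ (inject₁ k) ≡ suc a
      e₁⁻ = ≡.trans (updateAt-minimal (inject₁ k) (suc k) e (inject₁≢suc k)) e⁻
      e₂⁻ : e₂ (inject₁ k) ≡ a
      e₂⁻ = updateAt-updates (inject₁ k) e₁

  ⟨monomial∣D⟩ : ∀ (e e′ : Fin (suc m) → ℕ) → e (inject₁ k) ≡ e (suc k) →
                 e′ (inject₁ k) ≡ suc (e (inject₁ k)) → (∀ i → i ≢ inject₁ k → e′ i ≡ e i) →
                 ∀ ζ → ⟨ monomial e′ ∣ D k $ᵒ ζ ⟩ ≡ ⟨ monomial e ∣ ζ ⟩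
  ⟨monomial∣D⟩ e e′ e⁻≡e⁺ eq-k eq ζ = begin
    ⟨ monomial e′ ∣ D k $ᵒ ζ ⟩
      ≡⟨ point (op-cong (monomial-suc (inject₁ k) {e} {e′} eq-k eq)) (D k $ᵒ ζ) idₚ ⟩
    at (X (inject₁ k) $ᵒ op (monomial e) $ᵒ D k $ᵒ ζ) idₚ
      ≡⟨ $-cong (X (inject₁ k)) (op (monomial e) $ᵒ D k $ᵒ ζ) (D k $ᵒ op (monomial e) $ᵒ ζ)
           (commutes-monomial (e (suc k)) e e⁻≡e⁺ refl ζ) idₚ ⟩
    at (X (inject₁ k) $ᵒ D k $ᵒ op (monomial e) $ᵒ ζ) idₚ
      ≡⟨ X⁻-D (op (monomial e) $ᵒ ζ) idₚ ⟩
    at (D k $ᵒ X (suc k) $ᵒ op (monomial e) $ᵒ ζ) idₚ + ⟨ monomial e ∣ ζ ⟩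
      ≡⟨ cong (_+ ⟨ monomial e ∣ ζ ⟩) (D-identity k (X (suc k) $ᵒ op (monomial e) $ᵒ ζ)) ⟩
    0ℚ + ⟨ monomial e ∣ ζ ⟩
      ≡⟨ ℚₚ.+-identityˡ ⟨ monomial e ∣ ζ ⟩ ⟩
    ⟨ monomial e ∣ ζ ⟩ ∎
    where open ≡-Reasoning

Detected : (Fin (suc m) → ℕ) → Set
Detected {m} e = Σ[ ζ ∈ Fun (suc m) ] (∀ v → 0ℚ ℚ.≤ at ζ v) × ⟨ monomial e ∣ ζ ⟩ ≡ 1ℚ

detected-cong : ∀ {e e′ : Fin (suc m) → ℕ} → (∀ i → e i ≡ e′ i) → Detected e → Detected e′
detected-cong eq (ζ , ζ≥0 , one) = ζ , ζ≥0 , ≡.trans (cong (λ f → ⟨ f ∣ ζ ⟩) (≡.sym (monomial-cong eq))) one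

detected-zero : ∀ {e : Fin (suc m) → ℕ} → (∀ i → e i ≡ 0) → Detected e
detected-zero {m} {e} e≡0 = δ , (λ v → 𝟙-nonneg (idₚ ≟ₚ v)) ,
  ≡.trans (trivial (allFin (suc m)) δ idₚ) (𝟙-yes (idₚ {suc m} ≟ₚ idₚ) λ _ → refl)
  where
  δ : Fun (suc m)
  δ .at v = 𝟙 (idₚ ≟ₚ v)
  δ .resp u w u≈w = 𝟙-cong (idₚ ≟ₚ u) (idₚ ≟ₚ w)
    (λ p → ≈ₚ-trans {u = idₚ} {u} {w} p u≈w) (λ p → ≈ₚ-trans {u = idₚ} {w} {u} p (≈ₚ-sym {u = u} {w} u≈w))

  trivial : ∀ xs ξ v → at (op (product (List.map (λ i → power (gen i) (e i)) xs)) $ᵒ ξ) v ≡ at ξ v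
  trivial []       ξ v = ℚₚ.*-identityˡ (at ξ v)
  trivial (x ∷ xs) ξ v rewrite e≡0 x = ≡.trans
    (ℚₚ.*-identityˡ (at (op (product (List.map (λ i → power (gen i) (e i)) xs)) $ᵒ ξ) v)) (trivial xs ξ v)

detected-suc : ∀ (k : Fin m) {e e′} → e (inject₁ k) ≡ e (suc k) →
               e′ (inject₁ k) ≡ suc (e (inject₁ k)) → (∀ i → i ≢ inject₁ k → e′ i ≡ e i) →
               Detected e → Detected e′
detected-suc k {e} {e′} e⁻≡e⁺ eq-k eq (ζ , ζ≥0 , one) = D k $ᵒ ζ ,
  (λ v → *-nonneg (𝟙-nonneg (ℓ (v · s k) ℕₚ.<? ℓ v)) (ζ≥0 (v · s k))) ,
  ≡.trans (⟨monomial∣D⟩ k e e′ e⁻≡e⁺ eq-k eq ζ) one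

-- The exponents between the staircases of sizes p and p + 1.
row : ℕ → ℕ → Fin n → ℕ
row p q i = if does (q ℕₚ.≤? toℕ i) then p ∸ toℕ i else p ∸ suc (toℕ i)

row-≤ : ∀ p {q} {i : Fin n} → q ℕ.≤ toℕ i → row p q i ≡ p ∸ toℕ i
row-≤ p {q} {i} = if-yes (q ℕₚ.≤? toℕ i)

row-> : ∀ p {q} {i : Fin n} → toℕ i ℕ.< q → row p q i ≡ p ∸ suc (toℕ i)
row-> p {q} {i} i<q = if-no (q ℕₚ.≤? toℕ i) (ℕₚ.<⇒≱ i<q)

detected-row-step : ∀ p (k : Fin m) → toℕ k ℕ.< p → Detected {m} (row p (suc (toℕ k))) → Detected {m} (row p (toℕ k))
detected-row-step {m} p k k<p = detected-suc k
  (≡.trans row-k (≡.sym (row-≤ p {suc (toℕ k)} {suc k} ℕₚ.≤-refl)))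
  (≡.trans (≡.trans (row-≤ p (ℕₚ.≤-reflexive (≡.sym k⁻))) (cong (p ∸_) k⁻))
           (≡.trans (ℕₚ.+-∸-assoc 1 k<p) (cong suc (≡.sym row-k))))
  λ i i≢k → others i (λ eq → i≢k (Finₚ.toℕ-injective (≡.trans (≡.sym eq) (≡.sym k⁻))))
  where
  k⁻ = Finₚ.toℕ-inject₁ k

  row-k : row p (suc (toℕ k)) (inject₁ k) ≡ p ∸ suc (toℕ k)
  row-k = ≡.trans (row-> p (ℕ.s≤s (ℕₚ.≤-reflexive k⁻))) (cong (λ x → p ∸ suc x) k⁻)

  others : ∀ (i : Fin (suc m)) → toℕ k ≢ toℕ i → row p (toℕ k) i ≡ row p (suc (toℕ k)) i
  others i k≢i with ℕₚ.<-cmp (toℕ k) (toℕ i)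
  ... | tri< k<i _ _ = ≡.trans (row-≤ p (ℕₚ.<⇒≤ k<i)) (≡.sym (row-≤ p k<i))
  ... | tri≈ _ k≡i _ = contradiction k≡i k≢i
  ... | tri> _ _ i<k = ≡.trans (row-> p i<k) (≡.sym (row-> p (ℕₚ.m<n⇒m<1+n i<k)))

detected-rows : ∀ p → p ℕ.≤ m → ∀ q → q ℕ.≤ p → Detected {m} (row p q) → Detected {m} (row p 0)
detected-rows p p≤m zero    q≤p det = det
detected-rows {m} p p≤m (suc q) q<p det = detected-rows p p≤m q (ℕₚ.<⇒≤ q<p)
  (subst (λ q → Detected {m} (row p q)) eq
    (detected-row-step p k (subst (ℕ._< p) (≡.sym eq) q<p) (subst (λ q → Detected {m} (row p (suc q))) (≡.sym eq) det)))
  where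
  k : Fin m
  k = Fin.fromℕ< (ℕₚ.≤-trans q<p p≤m)
  eq : toℕ k ≡ q
  eq = Finₚ.toℕ-fromℕ< (ℕₚ.≤-trans q<p p≤m)

detected-staircase : ∀ p → p ℕ.≤ m → Detected {m} (row p 0)
detected-staircase zero    _ = detected-zero λ i → ℕₚ.0∸n≡0 (toℕ i)
detected-staircase {m} (suc p) p<m = detected-rows (suc p) p<m (suc p) ℕₚ.≤-refl
  (detected-cong start (detected-staircase p (ℕₚ.<⇒≤ p<m)))
  where
  start : ∀ i → row p 0 i ≡ row (suc p) (suc p) i
  start i with ℕₚ.≤-<-connex (suc p) (toℕ i)
  ... | inj₁ p<i = ≡.trans (ℕₚ.m≤n⇒m∸n≡0 (ℕₚ.<⇒≤ p<i))
                           (≡.sym (≡.trans (row-≤ (suc p) {suc p} {i} p<i) (ℕₚ.m≤n⇒m∸n≡0 p<i)))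
  ... | inj₂ i≤p = ≡.sym (row-> (suc p) {suc p} {i} i≤p)

staircase-detects : ∃[ z ] 0ℚ ℚ.≤ z × (∀ (w : Permutation′ (suc m)) → w ≈ₚ reverse → ∀ ξ → at ξ w ≡ z * ⟨ staircase (suc m) ∣ ξ ⟩)
staircase-detects {m} with detected-staircase {m} m ℕₚ.≤-refl
... | ζ , ζ≥0 , one = at ζ reverse , ζ≥0 reverse , λ w w≈ ξ → begin
  at ξ w                ≡⟨ resp ξ w reverse w≈ ⟩
  at ξ reverse          ≡⟨ solve 3 (λ x z f → x := (:- (z :* f :+ (:- x) :* const 1ℚ)) :+ z :* f) refl
                             (at ξ reverse) (at ζ reverse) ⟨ f ∣ ξ ⟩ ⟩
  - (at ζ reverse * ⟨ f ∣ ξ ⟩ + (- at ξ reverse) * 1ℚ) + at ζ reverse * ⟨ f ∣ ξ ⟩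
                        ≡⟨ cong (λ x → - x + at ζ reverse * ⟨ f ∣ ξ ⟩) (zero-pairing ξ) ⟩
  - 0ℚ + at ζ reverse * ⟨ f ∣ ξ ⟩ ≡⟨ ℚₚ.+-identityˡ (at ζ reverse * ⟨ f ∣ ξ ⟩) ⟩
  at ζ reverse * ⟨ f ∣ ξ ⟩ ∎
  where
  open ≡-Reasoning
  f = staircase (suc m)

  zero-pairing : ∀ ξ → at ζ reverse * ⟨ f ∣ ξ ⟩ + (- at ξ reverse) * 1ℚ ≡ 0ℚ
  zero-pairing ξ = begin
    at ζ reverse * ⟨ f ∣ ξ ⟩ + (- at ξ reverse) * 1ℚ
      ≡⟨ cong (λ x → at ζ reverse * ⟨ f ∣ ξ ⟩ + (- at ξ reverse) * x) one ⟨
    at ζ reverse * ⟨ f ∣ ξ ⟩ + (- at ξ reverse) * ⟨ f ∣ ζ ⟩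
      ≡⟨ cong₂ _+_ ($-* (op f) (at ζ reverse) ξ idₚ) ($-* (op f) (- at ξ reverse) ζ idₚ) ⟨
    ⟨ f ∣ at ζ reverse *ᶠ ξ ⟩ + ⟨ f ∣ (- at ξ reverse) *ᶠ ζ ⟩
      ≡⟨ $-+ (op f) (at ζ reverse *ᶠ ξ) ((- at ξ reverse) *ᶠ ζ) idₚ ⟨
    ⟨ f ∣ η ⟩
      ≡⟨ product-vanishes (λ i → suc m ∸ suc (toℕ i)) (allFin (suc m)) 0 η vanishes idₚ (ℓ-identity {m} idₚ λ _ → refl) ⟩
    0ℚ ∎
    where
    η = at ζ reverse *ᶠ ξ +ᶠ (- at ξ reverse) *ᶠ ζ

    vanishes : VanishesAt (ℕ-Sum.⨁ (allFin (suc m)) (λ i → suc m ∸ suc (toℕ i)) ℕ.+ 0) η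
    vanishes v ℓv = ≡.trans (resp η v reverse (maxLength⇒reverse v (≡.trans ℓv
        (≡.trans (ℕₚ.+-identityʳ _) (ℕ-Sum.⨁-tabulate {suc m} (λ i → i) λ i → suc m ∸ suc (toℕ i))))))
      (solve 2 (λ z x → z :* x :+ (:- x) :* z := const 0ℚ) refl (at ζ reverse) (at ξ reverse))

-- Duality with Schubert polynomials

Detects : ℚ → Permutation′ (suc m) → Poly (suc m) → Set
Detects z v f = ∀ ξ → at ξ v ≡ z * ⟨ f ∣ ξ ⟩

∂-detects : ∀ z (w u : Permutation′ (suc m)) k f → Detects z w f → ℓ (w · s k) ℕ.< ℓ w → u ≈ₚ w · s k →
            Detects z u (dividedDifference k f)
∂-detects z w u k f det lt u≈ ξ = begin
  at ξ u                              ≡⟨ resp ξ u (w · s k) u≈ ⟩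
  at ξ (w · s k)                      ≡⟨ D-descent k ξ w lt ⟨
  at (D k $ᵒ ξ) w                     ≡⟨ det (D k $ᵒ ξ) ⟩
  z * ⟨ f ∣ D k $ᵒ ξ ⟩                ≡⟨ cong (z *_) (∂-adjoint k f ξ) ⟩
  z * ⟨ dividedDifference k f ∣ ξ ⟩   ∎
  where open ≡-Reasoning

schubert-detects : ∀ {z} → (∀ (w : Permutation′ (suc m)) → w ≈ₚ reverse → Detects z w (staircase (suc m))) →
                   ∀ (v : Permutation′ (suc m)) → Σ[ f ∈ Poly (suc m) ] IsSchubert v f × Detects z v f
schubert-detects {m} {z} top = descending-from-reverse
  (λ v → Σ[ f ∈ Poly (suc m) ] IsSchubert v f × Detects z v f)
  (λ w w≈ → staircase (suc m) , longest w≈ refl , top w w≈)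
  λ { w u k (f , schubert , det) lt u≈ →
      dividedDifference k f , descent k schubert lt u≈ (dividedDifference-correct k f) ,
      ∂-detects z w u k f det lt u≈ }

-- The action of the Fomin–Kirillov algebra

-- For i < j this is 1 if w has an inversion at (i , j) and 0 otherwise,
-- and it is antisymmetric in i and j.
inversionSign : Fin n → Fin n → Fun n
inversionSign i j .at w = ½ * (sign i j + sign (w ⟨$⟩ʳ j) (w ⟨$⟩ʳ i))
inversionSign i j .resp u w u≈w = cong₂ (λ p q → ½ * (sign i j + sign p q)) (u≈w j) (u≈w i)

B : Fin n → Fin n → Op n
B i j = shift (inversionSign i j) (transpose i j)

B-anti : ∀ (i j : Fin n) → B j i ≈ᵒ -ᵒ B i j
B-anti i j = pointwise λ ξ v → ≡.trans
  (cong₂ _*_ (cong₂ (λ x y → ½ * (x + y)) (sign-anti i j) (sign-anti (v ⟨$⟩ʳ j) (v ⟨$⟩ʳ i)))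
             (resp ξ (v · transpose j i) (v · transpose i j) (·-transpose-comm v j i)))
  (solve 3 (λ x y z → const ½ :* (:- x :+ :- y) :* z := const (- 1ℚ) :* (const ½ :* (x :+ y) :* z)) refl
    (sign i j) (sign (v ⟨$⟩ʳ j) (v ⟨$⟩ʳ i)) (at ξ (v · transpose i j)))

B-diagonal : ∀ (i : Fin n) ξ v → at (B i i $ᵒ ξ) v ≡ 0ℚ
B-diagonal i ξ v rewrite sign-diagonal i | sign-diagonal (v ⟨$⟩ʳ i) = ℚₚ.*-zeroˡ (at ξ (v · transpose i i))

sign-square : ∀ {a b : Fin n} → a ≢ b → sign a b * sign a b ≡ 1ℚ
sign-square {a = a} {b} a≢b with <-cmp a b
... | tri< _ _ _   = refl
... | tri≈ _ a≡b _ = contradiction a≡b a≢b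
... | tri> _ _ _   = refl

sign-triple : ∀ {a b c : Fin n} → a ≢ b → b ≢ c → a ≢ c →
              sign a b * sign b c + 1ℚ ≡ sign a c * (sign a b + sign b c)
sign-triple {a = a} {b} {c} a≢b b≢c a≢c with <-cmp a b | <-cmp b c | <-cmp a c
... | tri≈ _ a≡b _   | _              | _              = contradiction a≡b a≢b
... | _              | tri≈ _ b≡c _   | _              = contradiction b≡c b≢c
... | _              | _              | tri≈ _ a≡c _   = contradiction a≡c a≢c
... | tri< _ _ _     | tri< _ _ _     | tri< _ _ _     = refl
... | tri< a<b _ _   | tri< b<c _ _   | tri> a≮c _ _   = contradiction (Finₚ.<-trans a<b b<c) a≮c
... | tri< _ _ _     | tri> _ _ _     | tri< _ _ _     = refl
... | tri< _ _ _     | tri> _ _ _     | tri> _ _ _     = refl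
... | tri> _ _ _     | tri< _ _ _     | tri< _ _ _     = refl
... | tri> _ _ _     | tri< _ _ _     | tri> _ _ _     = refl
... | tri> _ _ b<a   | tri> _ _ c<b   | tri< _ _ c≮a   = contradiction (Finₚ.<-trans c<b b<a) c≮a
... | tri> _ _ _     | tri> _ _ _     | tri> _ _ _     = refl

inversionSign-· : ∀ (v t : Permutation′ n) i j {a b} → t ⟨$⟩ʳ i ≡ a → t ⟨$⟩ʳ j ≡ b →
                  at (inversionSign i j) (v · t) ≡ ½ * (sign i j + sign (v ⟨$⟩ʳ b) (v ⟨$⟩ʳ a))
inversionSign-· v t i j ti≡a tj≡b = cong₂ (λ a b → ½ * (sign i j + sign (v ⟨$⟩ʳ b) (v ⟨$⟩ʳ a))) ti≡a tj≡b

B-square : ∀ (i j : Fin n) → i ≢ j → B i j *ᵒ B i j ≈ᵒ scalar 0ℚ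
B-square i j i≢j = pointwise λ ξ v →
  let x = sign i j
      y = sign (v ⟨$⟩ʳ j) (v ⟨$⟩ʳ i)
      z = at ξ (v · transpose i j · transpose i j)
  in begin
    ½ * (x + y) * (at (inversionSign i j) (v · transpose i j) * z)
      ≡⟨ cong (λ u → ½ * (x + y) * (u * z)) (≡.trans
           (inversionSign-· v (transpose i j) i j (transpose-fst i j) (transpose-snd i j))
           (cong (λ u → ½ * (x + u)) (sign-anti (v ⟨$⟩ʳ j) (v ⟨$⟩ʳ i)))) ⟩
    ½ * (x + y) * (½ * (x + - y) * z)
      ≡⟨ solve 3 (λ x y z → const ½ :* (x :+ y) :* (const ½ :* (x :+ :- y) :* z) :=
                            const ½ :* const ½ :* (x :* x :- y :* y) :* z) refl x y z ⟩
    ½ * ½ * (x * x - y * y) * z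
      ≡⟨ cong₂ (λ p q → ½ * ½ * (p - q) * z) (sign-square i≢j) (sign-square (i≢j ∘ ≡.sym ∘ perm-injective v)) ⟩
    0ℚ * z
      ≡⟨ ≡.trans (ℚₚ.*-zeroˡ z) (≡.sym (ℚₚ.*-zeroˡ (at ξ v))) ⟩
    0ℚ * at ξ v ∎
  where open ≡-Reasoning

B-disjoint : ∀ (i j k l : Fin n) → i ≢ k → i ≢ l → j ≢ k → j ≢ l → B i j *ᵒ B k l ≈ᵒ B k l *ᵒ B i j
B-disjoint i j k l i≢k i≢l j≢k j≢l = pointwise λ ξ v → ≡.trans
  (cong₂ (λ x y → at (inversionSign i j) v * (x * y))
    (inversionSign-· v (transpose i j) k l k-fixed l-fixed)
    (resp ξ (v · transpose i j · transpose k l) (v · transpose k l · transpose i j) (λ x → ≡.trans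
      (·-conjugate v (transpose i j) k l x) (cong₂ (λ p q → v · transpose p q · transpose i j ⟨$⟩ʳ x) k-fixed l-fixed))))
  (≡.trans (solve 3 (λ a b c → a :* (b :* c) := b :* (a :* c)) refl
             (at (inversionSign i j) v) (at (inversionSign k l) v) (at ξ (v · transpose k l · transpose i j)))
    (cong (λ x → at (inversionSign k l) v * (x * at ξ (v · transpose k l · transpose i j)))
      (≡.sym (inversionSign-· v (transpose k l) i j (transpose-other i≢k i≢l) (transpose-other j≢k j≢l)))))
  where
  k-fixed = transpose-other (i≢k ∘ ≡.sym) (j≢k ∘ ≡.sym)
  l-fixed = transpose-other (i≢l ∘ ≡.sym) (j≢l ∘ ≡.sym)

-- With a sign for each pair of positions and of values, this is the
-- difference of the relations sign-triple for positions and for values.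
triple-identity : ∀ a b c p q r → a * b + 1ℚ ≡ c * (a + b) → p * q + 1ℚ ≡ r * (p + q) → ∀ z →
  ½ * (b + p) * (½ * (a + r) * z) ≡
  ½ * (c + r) * (½ * (b + - q) * z) + ½ * (a + q) * (½ * (c + p) * z)
triple-identity a b c p q r e₁ e₂ z = begin
  ½ * (b + p) * (½ * (a + r) * z)
    ≡⟨ regroup (b + p) (a + r) z ⟩
  ½ * ½ * ((b + p) * (a + r)) * z
    ≡⟨ cong (λ x → ½ * ½ * x * z) core ⟩
  ½ * ½ * ((c + r) * (b + - q) + (a + q) * (c + p)) * z
    ≡⟨ solve 3 (λ x y z → const ½ :* const ½ :* (x :+ y) :* z :=
         const ½ :* const ½ :* x :* z :+ const ½ :* const ½ :* y :* z) refl ((c + r) * (b + - q)) ((a + q) * (c + p)) z ⟩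
  ½ * ½ * ((c + r) * (b + - q)) * z + ½ * ½ * ((a + q) * (c + p)) * z
    ≡⟨ cong₂ _+_ (regroup (c + r) (b + - q) z) (regroup (a + q) (c + p) z) ⟨
  ½ * (c + r) * (½ * (b + - q) * z) + ½ * (a + q) * (½ * (c + p) * z) ∎
  where
  open ≡-Reasoning
  regroup : ∀ x y z → ½ * x * (½ * y * z) ≡ ½ * ½ * (x * y) * z
  regroup = solve 3 (λ x y z → const ½ :* x :* (const ½ :* y :* z) := const ½ :* const ½ :* (x :* y) :* z) refl

  expand : ∀ a b c p q r → (b + p) * (a + r) ≡
           (c + r) * (b + - q) + (a + q) * (c + p) + ((a * b - c * (a + b)) - (p * q - r * (p + q)))
  expand = solve 6 (λ a b c p q r → (b :+ p) :* (a :+ r) :=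
    (c :+ r) :* (b :+ :- q) :+ (a :+ q) :* (c :+ p) :+ ((a :* b :- c :* (a :+ b)) :- (p :* q :- r :* (p :+ q)))) refl

  minus-one : ∀ x y → x + 1ℚ ≡ y → x - y ≡ - 1ℚ
  minus-one x _ refl = solve 1 (λ x → x :- (x :+ const 1ℚ) := const (- 1ℚ)) refl x

  core : (b + p) * (a + r) ≡ (c + r) * (b + - q) + (a + q) * (c + p)
  core = ≡.trans (expand a b c p q r) (≡.trans
    (cong₂ (λ x y → (c + r) * (b + - q) + (a + q) * (c + p) + (x - y))
           (minus-one (a * b) (c * (a + b)) e₁) (minus-one (p * q) (r * (p + q)) e₂))
    (ℚₚ.+-identityʳ _))

B-triple : ∀ (i j k : Fin n) → i ≢ j → i ≢ k → j ≢ k →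
           B j k *ᵒ B i j ≈ᵒ B i k *ᵒ B j k +ᵒ B i j *ᵒ B i k
B-triple i j k i≢j i≢k j≢k = pointwise λ ξ v →
  let z = at ξ (v · transpose j k · transpose i j)
      p = sign (v ⟨$⟩ʳ k) (v ⟨$⟩ʳ j)
      q = sign (v ⟨$⟩ʳ j) (v ⟨$⟩ʳ i)
      r = sign (v ⟨$⟩ʳ k) (v ⟨$⟩ʳ i)
      v≢ = λ {x y} (x≢y : x ≢ y) → x≢y ∘ ≡.sym ∘ perm-injective v
  in begin
    ½ * (sign j k + p) * (at (inversionSign i j) (v · transpose j k) * z)
      ≡⟨ cong (λ x → ½ * (sign j k + p) * (x * z))
           (inversionSign-· v (transpose j k) i j (transpose-other i≢j i≢k) (transpose-fst j k)) ⟩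
    ½ * (sign j k + p) * (½ * (sign i j + r) * z)
      ≡⟨ triple-identity (sign i j) (sign j k) (sign i k) p q r
           (sign-triple i≢j j≢k i≢k) (sign-triple (v≢ j≢k) (v≢ i≢j) (v≢ i≢k)) z ⟩
    ½ * (sign i k + r) * (½ * (sign j k + - q) * z) + ½ * (sign i j + q) * (½ * (sign i k + p) * z)
      ≡⟨ cong₂ _+_
           (cong₂ (λ x y → ½ * (sign i k + r) * (x * y))
             (≡.trans (cong (λ x → ½ * (sign j k + x)) (≡.sym (sign-anti (v ⟨$⟩ʳ j) (v ⟨$⟩ʳ i))))
                      (≡.sym (inversionSign-· v (transpose i k) j k (transpose-other (i≢j ∘ ≡.sym) j≢k) (transpose-snd i k))))
             (resp ξ (v · transpose j k · transpose i j) (v · transpose i k · transpose j k) λ x → ≡.trans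
               (·-conjugate v (transpose j k) i j x)
               (cong₂ (λ p q → v · transpose p q · transpose j k ⟨$⟩ʳ x) (transpose-other i≢j i≢k) (transpose-fst j k))))
           (cong₂ (λ x y → ½ * (sign i j + q) * (x * y))
             (≡.sym (inversionSign-· v (transpose i j) i k (transpose-fst i j) (transpose-other (i≢k ∘ ≡.sym) (j≢k ∘ ≡.sym))))
             (resp ξ (v · transpose j k · transpose i j) (v · transpose i j · transpose i k) λ x → ≡.sym (≡.trans
               (·-conjugate v (transpose i j) i k x)
               (cong₂ (λ p q → v · transpose p q · transpose i j ⟨$⟩ʳ x)
                      (transpose-fst i j) (transpose-other (i≢k ∘ ≡.sym) (j≢k ∘ ≡.sym)))))) ⟩
    at (B i k $ᵒ B j k $ᵒ ξ) v + at (B i j $ᵒ B i k $ᵒ ξ) v ∎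
  where open ≡-Reasoning

neg-*-neg : ∀ {A A′ C C′ : Op n} → A′ ≈ᵒ -ᵒ A → C′ ≈ᵒ -ᵒ C → A′ *ᵒ C′ ≈ᵒ A *ᵒ C
neg-*-neg {A = A} {A′} {C} {C′} p q = pointwise λ ξ v → ≡.trans (point p (C′ $ᵒ ξ) v)
  (≡.trans (cong (- 1ℚ *_) (≡.trans ($-cong A (C′ $ᵒ ξ) (- 1ℚ *ᶠ C $ᵒ ξ) (point q ξ) v) ($-* A (- 1ℚ) (C $ᵒ ξ) v)))
    (solve 1 (λ x → const (- 1ℚ) :* (const (- 1ℚ) :* x) := x) refl (at (A $ᵒ C $ᵒ ξ) v)))

-- Products are reversed: the last factor of a monomial acts on w first.
module FominKirillov {n : ℕ} =
  Evaluation {FKGenerator n} (Flip.ring (Op-ring n)) scalar (Ring.refl (Op-ring n)) (Ring.refl (Op-ring n)) scalar-+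
    (λ p q → pointwise λ ξ v → ≡.trans (cong (_* at ξ v) (ℚₚ.*-comm p q)) (ℚₚ.*-assoc q p (at ξ v)))
    (λ q A → Ring.sym (Op-ring n) (scalar-central q A))
    (λ (i , j , _) → B i j)

open FominKirillov using () renaming (⟦_⟧ to fk)

fk-bracket : ∀ (i j : Fin n) → fk [ i , j ] ≈ᵒ B i j
fk-bracket i j with <-cmp i j
... | tri< _ _ _    = pointwise λ ξ v → refl
... | tri≈ _ refl _ = pointwise λ ξ v → ≡.trans (ℚₚ.*-zeroˡ (at ξ v)) (≡.sym (B-diagonal i ξ v))
... | tri> _ _ _    = pointwise λ ξ v → ≡.sym (point (B-anti j i) ξ v)

fk-relation : ∀ {a b : FK n} → FKRelation a b → fk a ≈ᵒ fk b
fk-relation {n} = go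
  where
  open Ring (Op-ring n) using (setoid; +-cong; *-cong)
  open import Relation.Binary.Reasoning.Setoid setoid

  fk-product : ∀ i j k l → fk ([ i , j ] ⊗ [ k , l ]) ≈ᵒ B k l *ᵒ B i j
  fk-product i j k l = *-cong (fk-bracket k l) (fk-bracket i j)

  go : ∀ {a b : FK n} → FKRelation a b → fk a ≈ᵒ fk b
  go (square i j ((i≢j ∷ []) ∷ _)) = begin
    fk ([ i , j ] ⊗ [ i , j ])  ≈⟨ fk-product i j i j ⟩
    B i j *ᵒ B i j              ≈⟨ B-square i j i≢j ⟩
    scalar 0ℚ                   ∎
  go (disjoint i j k l ((i≢j ∷ i≢k ∷ i≢l ∷ []) ∷ (j≢k ∷ j≢l ∷ []) ∷ _)) = begin
    fk ([ i , j ] ⊗ [ k , l ])  ≈⟨ fk-product i j k l ⟩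
    B k l *ᵒ B i j              ≈⟨ B-disjoint i j k l i≢k i≢l j≢k j≢l ⟨
    B i j *ᵒ B k l              ≈⟨ fk-product k l i j ⟨
    fk ([ k , l ] ⊗ [ i , j ])  ∎
  go (triple₁ i j k ((i≢j ∷ i≢k ∷ []) ∷ (j≢k ∷ []) ∷ _)) = begin
    fk ([ i , j ] ⊗ [ j , k ])                          ≈⟨ fk-product i j j k ⟩
    B j k *ᵒ B i j                                      ≈⟨ B-triple i j k i≢j i≢k j≢k ⟩
    B i k *ᵒ B j k +ᵒ B i j *ᵒ B i k                    ≈⟨ +-cong (fk-product j k i k) (fk-product i k i j) ⟨
    fk ([ j , k ] ⊗ [ i , k ] ⊕ [ i , k ] ⊗ [ i , j ])  ∎
  go (triple₂ i j k ((i≢j ∷ i≢k ∷ []) ∷ (j≢k ∷ []) ∷ _)) = begin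
    fk ([ j , k ] ⊗ [ i , j ])                          ≈⟨ fk-product j k i j ⟩
    B i j *ᵒ B j k                                      ≈⟨ neg-*-neg (B-anti i j) (B-anti j k) ⟨
    B j i *ᵒ B k j                                      ≈⟨ B-triple k j i (j≢k ∘ ≡.sym) (i≢k ∘ ≡.sym) (i≢j ∘ ≡.sym) ⟩
    B k i *ᵒ B j i +ᵒ B k j *ᵒ B k i                    ≈⟨ +-cong (neg-*-neg (B-anti i k) (B-anti i j)) (neg-*-neg (B-anti j k) (B-anti i k)) ⟩
    B i k *ᵒ B i j +ᵒ B j k *ᵒ B i k                    ≈⟨ Ring.+-comm (Op-ring n) (B i k *ᵒ B i j) (B j k *ᵒ B i k) ⟩
    B j k *ᵒ B i k +ᵒ B i k *ᵒ B i j                    ≈⟨ +-cong (fk-product i k j k) (fk-product i j i k) ⟨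
    fk ([ i , k ] ⊗ [ j , k ] ⊕ [ i , j ] ⊗ [ i , k ])  ∎

fk-cong : ∀ {a b : FK n} → a ≈FK b → fk a ≈ᵒ fk b
fk-cong = FominKirillov.sound fk-relation

fk-θ : ∀ (i : Fin n) ξ v → at (fk (θ i) $ᵒ ξ) v ≡ ∑ λ j → at (B i j $ᵒ ξ) v
fk-θ {n} i ξ v = begin
  at (fk (θ i) $ᵒ ξ) v                                          ≡⟨ sum-⨁ (filter (λ j → ¬? (j ≟ i)) (allFin n)) ⟩
  ℚ-Sum.⨁ (filter (λ j → ¬? (j ≟ i)) (allFin n)) F              ≡⟨ ℚ-Sum.⨁-filter (λ j → ¬? (j ≟ i)) (allFin n) F ⟩
  ℚ-Sum.⨁ (allFin n) (λ j → if does (¬? (j ≟ i)) then F j else 0ℚ) ≡⟨ ℚ-Sum.⨁-tabulate {n} (λ j → j) (λ j → if does (¬? (j ≟ i)) then F j else 0ℚ) ⟩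
  ∑ (λ j → if does (¬? (j ≟ i)) then F j else 0ℚ)               ≡⟨ ∑-cong (λ j → term j (j ≟ i)) ⟩
  ∑ (λ j → at (B i j $ᵒ ξ) v)                                   ∎
  where
  open ≡-Reasoning
  F : Fin n → ℚ
  F j = at (fk [ i , j ] $ᵒ ξ) v

  sum-⨁ : ∀ js → at (fk (sum (List.map (λ j → [ i , j ]) js)) $ᵒ ξ) v ≡ ℚ-Sum.⨁ js F
  sum-⨁ []       = ℚₚ.*-zeroˡ (at ξ v)
  sum-⨁ (j ∷ js) = cong (F j +_) (sum-⨁ js)

  term : ∀ j (d : Dec (j ≡ i)) → (if does (¬? d) then F j else 0ℚ) ≡ at (B i j $ᵒ ξ) v
  term j (yes refl) = ≡.sym (B-diagonal j ξ v)
  term j (no _)     = point (fk-bracket i j) ξ v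

inversionSign-nonneg : ∀ {i j : Fin n} → i < j → ∀ w → 0ℚ ℚ.≤ at (inversionSign i j) w
inversionSign-nonneg {i = i} {j} i<j w rewrite sign-< i<j with <-cmp (w ⟨$⟩ʳ j) (w ⟨$⟩ʳ i)
... | tri< _ _ _ = ℚₚ.nonNegative⁻¹ 1ℚ
... | tri≈ _ _ _ = ℚₚ.nonNegative⁻¹ ½
... | tri> _ _ _ = ℚₚ.≤-refl

fk-nonneg : ∀ {a : FK n} → FKNonnegative a → ∀ φ → (∀ w → 0ℚ ℚ.≤ at φ w) → ∀ w → 0ℚ ℚ.≤ at (fk a $ᵒ φ) w
fk-nonneg (ts , ts≥0 , a≈) φ φ≥0 w = subst (0ℚ ℚ.≤_) (≡.sym (point (fk-cong a≈) φ w)) (combination-nonneg ts ts≥0)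
  where
  monomial-nonneg : ∀ m φ → (∀ w → 0ℚ ℚ.≤ at φ w) → ∀ w → 0ℚ ℚ.≤ at (fk (product (List.map gen m)) $ᵒ φ) w
  monomial-nonneg []                φ φ≥0 w = subst (0ℚ ℚ.≤_) (≡.sym (ℚₚ.*-identityˡ (at φ w))) (φ≥0 w)
  monomial-nonneg ((i , j , i<j) ∷ m) φ φ≥0 = monomial-nonneg m (B i j $ᵒ φ)
    λ w → *-nonneg (inversionSign-nonneg i<j w) (φ≥0 (w · transpose i j))

  combination-nonneg : ∀ ts → All (λ (q , _) → 0ℚ ℚ.≤ q) ts → 0ℚ ℚ.≤ at (fk (combination ts) $ᵒ φ) w
  combination-nonneg []             []         = ℚₚ.≤-reflexive (≡.sym (ℚₚ.*-zeroˡ (at φ w)))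
  combination-nonneg ((q , m) ∷ ts) (q≥0 ∷ qs) = +-nonneg
    (monomial-nonneg m (q *ᶠ φ) (λ w → *-nonneg q≥0 (φ≥0 w)) w)
    (combination-nonneg ts qs)

-- Homology classes and their coefficients

fromℤ : ℤ → ℚ
fromℤ a = a ℚ./ 1

toℚᵘ-fromℤ : ∀ a → ℚ.toℚᵘ (fromℤ a) ≃ mkℚᵘ a 0
toℚᵘ-fromℤ a = ℚₚ.toℚᵘ-fromℚᵘ (mkℚᵘ a 0)

fromℤ-+ : ∀ a b → fromℤ (a ℤ.+ b) ≡ fromℤ a + fromℤ b
fromℤ-+ a b = ℚₚ.toℚᵘ-injective (begin
  ℚ.toℚᵘ (fromℤ (a ℤ.+ b))                     ≈⟨ toℚᵘ-fromℤ (a ℤ.+ b) ⟩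
  mkℚᵘ (a ℤ.+ b) 0                             ≡⟨ cong₂ (λ x y → mkℚᵘ (x ℤ.+ y) 0) (ℤₚ.*-identityʳ a) (ℤₚ.*-identityʳ b) ⟨
  mkℚᵘ a 0 ℚᵘ.+ mkℚᵘ b 0                       ≈⟨ ℚᵘₚ.+-cong (toℚᵘ-fromℤ a) (toℚᵘ-fromℤ b) ⟨
  ℚ.toℚᵘ (fromℤ a) ℚᵘ.+ ℚ.toℚᵘ (fromℤ b)       ≈⟨ ℚₚ.toℚᵘ-homo-+ (fromℤ a) (fromℤ b) ⟨
  ℚ.toℚᵘ (fromℤ a + fromℤ b)                   ∎)
  where open ℚᵘₚ.≃-Reasoning

fromℤ-* : ∀ a b → fromℤ (a ℤ.* b) ≡ fromℤ a * fromℤ b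
fromℤ-* a b = ℚₚ.toℚᵘ-injective (begin
  ℚ.toℚᵘ (fromℤ (a ℤ.* b))                     ≈⟨ toℚᵘ-fromℤ (a ℤ.* b) ⟩
  mkℚᵘ a 0 ℚᵘ.* mkℚᵘ b 0                       ≈⟨ ℚᵘₚ.*-cong (toℚᵘ-fromℤ a) (toℚᵘ-fromℤ b) ⟨
  ℚ.toℚᵘ (fromℤ a) ℚᵘ.* ℚ.toℚᵘ (fromℤ b)       ≈⟨ ℚₚ.toℚᵘ-homo-* (fromℤ a) (fromℤ b) ⟨
  ℚ.toℚᵘ (fromℤ a * fromℤ b)                   ∎)
  where open ℚᵘₚ.≃-Reasoning

fromℤ-neg : ∀ a → fromℤ (ℤ.- a) ≡ - fromℤ a
fromℤ-neg a = ≡.trans (cong fromℤ (≡.sym (ℤₚ.-1*i≡-i a)))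
  (≡.trans (fromℤ-* (ℤ.- 1ℤ) a) (solve 1 (λ x → const (- 1ℚ) :* x := :- x) refl (fromℤ a)))

fromℤ-nonneg : ∀ a → 0ℚ ℚ.≤ fromℤ a → 0ℤ ℤ.≤ a
fromℤ-nonneg a le with ℚᵘₚ.≤-respʳ-≃ (toℚᵘ-fromℤ a) (ℚₚ.toℚᵘ-mono-≤ le)
... | *≤* le′ = subst (0ℤ ℤ.≤_) (ℤₚ.*-identityʳ a) le′

𝟙-fromℤ : ∀ {P : Set} (P? : Dec P) → fromℤ (if does P? then 1ℤ else 0ℤ) ≡ 𝟙 P?
𝟙-fromℤ (yes _) = refl
𝟙-fromℤ (no _)  = refl

coefficients : H n → Fun n
coefficients h .at v = fromℤ (coefficient h v)
coefficients h .resp u w u≈w = cong fromℤ (coefficient-cong h)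
  where
  coefficient-cong : ∀ h → coefficient h u ≡ coefficient h w
  coefficient-cong []            = refl
  coefficient-cong ((c , x) ∷ h) = cong₂ ℤ._+_
    (if-cong (x ≟ₚ u) (x ≟ₚ w) (λ p → ≈ₚ-trans {u = x} {u} {w} p u≈w)
             (λ p → ≈ₚ-trans {u = x} {w} {u} p (≈ₚ-sym {u = u} {w} u≈w)) λ _ → refl)
    (coefficient-cong h)

coefficients-++ : ∀ (h h′ : H n) → coefficients (h ++ h′) ≐ coefficients h +ᶠ coefficients h′
coefficients-++ []            h′ v = ≡.sym (ℚₚ.+-identityˡ (at (coefficients h′) v))
coefficients-++ ((c , w) ∷ h) h′ v = begin
  fromℤ (x ℤ.+ coefficient (h ++ h′) v)             ≡⟨ fromℤ-+ x (coefficient (h ++ h′) v) ⟩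
  fromℤ x + fromℤ (coefficient (h ++ h′) v)         ≡⟨ cong (fromℤ x +_) (coefficients-++ h h′ v) ⟩
  fromℤ x + (y + y′)                                ≡⟨ ℚₚ.+-assoc (fromℤ x) y y′ ⟨
  fromℤ x + y + y′                                  ≡⟨ cong (_+ y′) (fromℤ-+ x (coefficient h v)) ⟨
  fromℤ (x ℤ.+ coefficient h v) + y′                ∎
  where
  open ≡-Reasoning
  x = if does (w ≟ₚ v) then c else 0ℤ
  y = at (coefficients h) v
  y′ = at (coefficients h′) v

coefficients-∷ : ∀ c w (h : H n) → coefficients ((c , w) ∷ h) ≐ fromℤ c *ᶠ coefficients [X w ] +ᶠ coefficients h
coefficients-∷ c w h v = ≡.trans (fromℤ-+ (if does (w ≟ₚ v) then c else 0ℤ) (coefficient h v))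
  (cong (_+ at (coefficients h) v) (term (w ≟ₚ v)))
  where
  term : ∀ {P : Set} (P? : Dec P) → fromℤ (if does P? then c else 0ℤ) ≡ fromℤ c * fromℤ ((if does P? then 1ℤ else 0ℤ) ℤ.+ 0ℤ)
  term (yes _) = ≡.sym (ℚₚ.*-identityʳ (fromℤ c))
  term (no _)  = ≡.sym (ℚₚ.*-zeroʳ (fromℤ c))

coefficients-[X] : ∀ (w v : Permutation′ n) → at (coefficients [X w ]) v ≡ 𝟙 (w ≟ₚ v)
coefficients-[X] w v = ≡.trans (cong fromℤ (ℤₚ.+-identityʳ (if does (w ≟ₚ v) then 1ℤ else 0ℤ))) (𝟙-fromℤ (w ≟ₚ v))

coefficients-scale : ∀ c (h : H n) → coefficients (scale c h) ≐ fromℤ c *ᶠ coefficients h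
coefficients-scale c []            v = ≡.sym (ℚₚ.*-zeroʳ (fromℤ c))
coefficients-scale c ((d , w) ∷ h) v = begin
  at (coefficients ((c ℤ.* d , w) ∷ scale c h)) v
    ≡⟨ coefficients-∷ (c ℤ.* d) w (scale c h) v ⟩
  fromℤ (c ℤ.* d) * x + at (coefficients (scale c h)) v
    ≡⟨ cong₂ (λ p q → p * x + q) (fromℤ-* c d) (coefficients-scale c h v) ⟩
  fromℤ c * fromℤ d * x + fromℤ c * y
    ≡⟨ solve 4 (λ c d x y → c :* d :* x :+ c :* y := c :* (d :* x :+ y)) refl (fromℤ c) (fromℤ d) x y ⟩
  fromℤ c * (fromℤ d * x + y)
    ≡⟨ cong (fromℤ c *_) (coefficients-∷ d w h v) ⟨
  fromℤ c * at (coefficients ((d , w) ∷ h)) v ∎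
  where
  open ≡-Reasoning
  x = at (coefficients [X w ]) v
  y = at (coefficients h) v

coefficients--H : ∀ (h h′ : H n) v → at (coefficients (h -H h′)) v ≡ at (coefficients h) v - at (coefficients h′) v
coefficients--H h h′ v = ≡.trans (coefficients-++ h (scale (ℤ.- 1ℤ) h′) v)
  (cong (at (coefficients h) v +_) (≡.trans (coefficients-scale (ℤ.- 1ℤ) h′ v)
    (solve 1 (λ x → const (- 1ℚ) :* x := :- x) refl (at (coefficients h′) v))))

$-zero : ∀ (A : Op n) ξ → (∀ v → at ξ v ≡ 0ℚ) → ∀ v → at (A $ᵒ ξ) v ≡ 0ℚ
$-zero A ξ ξ≡0 v = ≡.trans
  ($-cong A ξ (0ℚ *ᶠ ξ) (λ w → ≡.trans (ξ≡0 w) (≡.sym (ℚₚ.*-zeroˡ (at ξ w)))) v)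
  (≡.trans ($-* A 0ℚ ξ v) (ℚₚ.*-zeroˡ (at (A $ᵒ ξ) v)))

coefficients-extendLinearly : ∀ (A : Op n) (φ : Permutation′ n → H n) →
  (∀ w → coefficients (φ w) ≐ A $ᵒ coefficients [X w ]) →
  ∀ h → coefficients (extendLinearly φ h) ≐ A $ᵒ coefficients h
coefficients-extendLinearly A φ φ≐A []            v = ≡.sym ($-zero A (coefficients []) (λ _ → refl) v)
coefficients-extendLinearly A φ φ≐A ((c , w) ∷ h) v = begin
  at (coefficients (scale c (φ w) ++ extendLinearly φ h)) v
    ≡⟨ coefficients-++ (scale c (φ w)) (extendLinearly φ h) v ⟩
  at (coefficients (scale c (φ w))) v + at (coefficients (extendLinearly φ h)) v
    ≡⟨ cong₂ _+_ (≡.trans (coefficients-scale c (φ w) v) (cong (fromℤ c *_) (φ≐A w v)))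
                 (coefficients-extendLinearly A φ φ≐A h v) ⟩
  fromℤ c * at (A $ᵒ coefficients [X w ]) v + at (A $ᵒ coefficients h) v
    ≡⟨ cong (_+ at (A $ᵒ coefficients h) v) ($-* A (fromℤ c) (coefficients [X w ]) v) ⟨
  at (A $ᵒ (fromℤ c *ᶠ coefficients [X w ])) v + at (A $ᵒ coefficients h) v
    ≡⟨ $-+ A (fromℤ c *ᶠ coefficients [X w ]) (coefficients h) v ⟨
  at (A $ᵒ (fromℤ c *ᶠ coefficients [X w ] +ᶠ coefficients h)) v
    ≡⟨ $-cong A (coefficients ((c , w) ∷ h)) (fromℤ c *ᶠ coefficients [X w ] +ᶠ coefficients h) (coefficients-∷ c w h) v ⟨
  at (A $ᵒ coefficients ((c , w) ∷ h)) v ∎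
  where open ≡-Reasoning

coefficients-∂ : ∀ (k : Fin m) h → coefficients (∂ k h) ≐ D k $ᵒ coefficients h
coefficients-∂ {m} k = coefficients-extendLinearly (D k) _ λ w v → begin
  at (coefficients (if does (ℓ w ℕₚ.<? ℓ (w · s k)) then [X w · s k ] else [])) v
    ≡⟨ choose w v (ℓ w ℕₚ.<? ℓ (w · s k)) ⟩
  𝟙 (ℓ w ℕₚ.<? ℓ (w · s k)) * 𝟙 ((w · s k) ≟ₚ v)
    ≡⟨ 𝟙-*-cong (ℓ w ℕₚ.<? ℓ (w · s k)) ((w · s k) ≟ₚ v) (ℓ (v · s k) ℕₚ.<? ℓ v) (w ≟ₚ (v · s k))
         (λ lt eq → let eq′ = swap v w (≈ₚ-sym {u = w · s k} {v} eq) in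
            ≡.subst₂ ℕ._<_ (ℓ-cong w (v · s k) eq′) (ℓ-cong (w · s k) v eq) lt , eq′)
         (λ lt eq → let eq′ = swap w v eq in
            ≡.subst₂ ℕ._<_ (≡.sym (ℓ-cong w (v · s k) eq)) (ℓ-cong v (w · s k) eq′) lt , ≈ₚ-sym {u = v} {w · s k} eq′) ⟩
  at (descends k) v * 𝟙 (w ≟ₚ (v · s k))
    ≡⟨ cong (at (descends k) v *_) (coefficients-[X] w (v · s k)) ⟨
  at (D k $ᵒ coefficients [X w ]) v ∎
  where
  open ≡-Reasoning
  swap : ∀ (u w : Permutation′ (suc m)) → u ≈ₚ w · s k → w ≈ₚ u · s k
  swap u w = ·-transpose-swap {u = u} {w} (inject₁ k) (suc k)

  choose : ∀ (w v : Permutation′ (suc m)) {P : Set} (P? : Dec P) →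
           at (coefficients (if does P? then [X w · s k ] else [])) v ≡ 𝟙 P? * 𝟙 ((w · s k) ≟ₚ v)
  choose w v (yes _) = ≡.trans (coefficients-[X] (w · s k) v) (≡.sym (ℚₚ.*-identityˡ (𝟙 ((w · s k) ≟ₚ v))))
  choose w v (no _)  = ≡.sym (ℚₚ.*-zeroˡ (𝟙 ((w · s k) ≟ₚ v)))

∑∑-+ : ∀ (f g : Fin n → Fin n → ℚ) →
       ∑ (λ i → ∑ λ j → f i j + g i j) ≡ ∑ (λ i → ∑ (f i)) + ∑ (λ i → ∑ (g i))
∑∑-+ f g = ≡.trans (∑-cong λ i → ℚ-Sum.∑-distrib-+ (f i) (g i)) (ℚ-Sum.∑-distrib-+ (∑ ∘ f) (∑ ∘ g))

∑-roots : ∀ (e : Fin n → ℚ) (K : Fin n → Fin n → ℚ) → (∀ i j → K i j ≡ K j i) →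
          ∑ (λ a → ∑ λ b → if does (a <? b) then (e a - e b) * K a b else 0ℚ) ≡
          ∑ (λ i → e i * ∑ λ j → sign i j * K i j)
∑-roots {n} e K K-sym = begin
  ∑ (λ a → ∑ λ b → if does (a <? b) then (e a - e b) * K a b else 0ℚ)
    ≡⟨ (∑-cong λ a → ∑-cong λ b → split (e a) (e b) (K a b) (a <? b)) ⟩
  ∑ (λ a → ∑ λ b → F a b + G a b)
    ≡⟨ ∑∑-+ F G ⟩
  ∑ (λ a → ∑ (F a)) + ∑ (λ a → ∑ (G a))
    ≡⟨ cong (∑ (λ a → ∑ (F a)) +_) (ℚ-Sum.∑-comm G) ⟩
  ∑ (λ a → ∑ (F a)) + ∑ (λ b → ∑ λ a → G a b)
    ≡⟨ ∑∑-+ F (λ b a → G a b) ⟨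
  ∑ (λ a → ∑ λ b → F a b + G b a)
    ≡⟨ (∑-cong λ a → ≡.trans (∑-cong λ b → join a b) (≡.sym (ℚ-Sum.*-distribˡ-sum (e a) λ b → sign a b * K a b))) ⟩
  ∑ (λ a → e a * ∑ λ b → sign a b * K a b) ∎
  where
  open ≡-Reasoning
  F G : Fin n → Fin n → ℚ
  F a b = 𝟙 (a <? b) * (e a * K a b)
  G a b = 𝟙 (a <? b) * (- e b * K a b)

  split : ∀ x y z {P : Set} (P? : Dec P) → (if does P? then (x - y) * z else 0ℚ) ≡ 𝟙 P? * (x * z) + 𝟙 P? * (- y * z)
  split x y z (yes _) = solve 3 (λ x y z → (x :- y) :* z := const 1ℚ :* (x :* z) :+ const 1ℚ :* (:- y :* z)) refl x y z
  split x y z (no _)  = solve 3 (λ x y z → const 0ℚ := const 0ℚ :* (x :* z) :+ const 0ℚ :* (:- y :* z)) refl x y z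

  sign-𝟙 : ∀ a b → sign a b ≡ 𝟙 (a <? b) - 𝟙 (b <? a)
  sign-𝟙 a b with <-cmp a b
  ... | tri< a<b _ b≮a = ≡.sym (cong₂ _-_ (𝟙-yes (a <? b) a<b) (𝟙-no (b <? a) b≮a))
  ... | tri≈ a≮b _ b≮a = ≡.sym (cong₂ _-_ (𝟙-no (a <? b) a≮b) (𝟙-no (b <? a) b≮a))
  ... | tri> a≮b _ b<a = ≡.sym (cong₂ _-_ (𝟙-no (a <? b) a≮b) (𝟙-yes (b <? a) b<a))

  join : ∀ a b → F a b + G b a ≡ e a * (sign a b * K a b)
  join a b = ≡.trans (cong (λ z → F a b + 𝟙 (b <? a) * (- e a * z)) (K-sym b a))
    (≡.trans (solve 4 (λ p q x z → p :* (x :* z) :+ q :* (:- x :* z) := x :* ((p :- q) :* z)) refl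
                (𝟙 (a <? b)) (𝟙 (b <? a)) (e a) (K a b))
             (cong (λ x → e a * (x * K a b)) (≡.sym (sign-𝟙 a b))))

∑-ε : ∀ (k : Fin m) (f : Fin (suc m) → ℚ) → ∑ (λ i → ε k i * f i) ≡ f (inject₁ k) - f (suc k)
∑-ε {m} k f = begin
  ∑ (λ i → ε k i * f i)
    ≡⟨ (∑-cong λ i → solve 3 (λ p q x → (p :- q) :* x := p :* x :+ :- q :* x) refl (𝟙 (i ≟ inject₁ k)) (𝟙 (i ≟ suc k)) (f i)) ⟩
  ∑ (λ i → F i + G i)
    ≡⟨ ℚ-Sum.∑-distrib-+ F G ⟩
  ∑ F + ∑ G
    ≡⟨ cong₂ _+_ (ℚ-Sum.∑-single (inject₁ k) F λ i i≢ → ≡.trans (cong (_* f i) (𝟙-no (i ≟ inject₁ k) i≢)) (ℚₚ.*-zeroˡ (f i)))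
                 (ℚ-Sum.∑-single (suc k) G λ i i≢ → ≡.trans (cong (λ x → - x * f i) (𝟙-no (i ≟ suc k) i≢)) (ℚₚ.*-zeroˡ (f i))) ⟩
  F (inject₁ k) + G (suc k)
    ≡⟨ cong₂ (λ p q → p * f (inject₁ k) + - q * f (suc k)) (𝟙-yes (inject₁ k ≟ inject₁ k) refl) (𝟙-yes (suc k ≟ suc k) refl) ⟩
  1ℚ * f (inject₁ k) + - 1ℚ * f (suc k)
    ≡⟨ solve 2 (λ x y → const 1ℚ :* x :+ const (- 1ℚ) :* y := x :- y) refl (f (inject₁ k)) (f (suc k)) ⟩
  f (inject₁ k) - f (suc k) ∎
  where
  open ≡-Reasoning
  F G : Fin (suc m) → ℚ
  F i = 𝟙 (i ≟ inject₁ k) * f i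
  G i = - 𝟙 (i ≟ suc k) * f i

coefficients-c₁ : ∀ (k : Fin m) h → coefficients (c₁ (α k) h) ≐ (X (inject₁ k) +ᵒ -ᵒ X (suc k)) $ᵒ coefficients h
coefficients-c₁ {m} k = coefficients-extendLinearly (X (inject₁ k) +ᵒ -ᵒ X (suc k)) _ λ w v → begin
  at (coefficients (List.map (root w) (filter (covered w) (positiveRoots (suc m))))) v
    ≡⟨ list w v (filter (covered w) (positiveRoots (suc m))) ⟩
  ℚ-Sum.⨁ (filter (covered w) (positiveRoots (suc m))) (F w v)
    ≡⟨ ℚ-Sum.⨁-filter (covered w) (positiveRoots (suc m)) (F w v) ⟩
  ℚ-Sum.⨁ (positiveRoots (suc m)) (λ β → if does (covered w β) then F w v β else 0ℚ)
    ≡⟨ ℚ-Sum.⨁-positiveRoots (λ β → if does (covered w β) then F w v β else 0ℚ) ⟩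
  ∑ (λ a → ∑ λ b → if does (a <? b) then (if does (covered w (a , b)) then F w v (a , b) else 0ℚ) else 0ℚ)
    ≡⟨ (∑-cong λ a → ∑-cong λ b → cong (if does (a <? b) then_else 0ℚ) (term w v a b)) ⟩
  ∑ (λ a → ∑ λ b → if does (a <? b) then (ε k a - ε k b) * K w v a b else 0ℚ)
    ≡⟨ ∑-roots (ε k) (K w v) (K-sym w v) ⟩
  ∑ (λ i → ε k i * ∑ λ j → sign i j * K w v i j)
    ≡⟨ ∑-ε k (λ i → ∑ λ j → sign i j * K w v i j) ⟩
  ∑ (λ j → sign (inject₁ k) j * K w v (inject₁ k) j) - ∑ (λ j → sign (suc k) j * K w v (suc k) j)
    ≡⟨ cong₂ _-_ (X-[X] w v (inject₁ k)) (X-[X] w v (suc k)) ⟨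
  at (X (inject₁ k) $ᵒ coefficients [X w ]) v - at (X (suc k) $ᵒ coefficients [X w ]) v
    ≡⟨ solve 2 (λ x y → x :- y := x :+ const (- 1ℚ) :* y) refl
         (at (X (inject₁ k) $ᵒ coefficients [X w ]) v) (at (X (suc k) $ᵒ coefficients [X w ]) v) ⟩
  at ((X (inject₁ k) +ᵒ -ᵒ X (suc k)) $ᵒ coefficients [X w ]) v ∎
  where
  open ≡-Reasoning
  Sₙ = Permutation′ (suc m)
  Root = Fin (suc m) × Fin (suc m)

  covered : ∀ (w : Sₙ) (β : Root) → Dec (suc (ℓ (w · transpose (proj₁ β) (proj₂ β))) ≡ ℓ w)
  covered w (a , b) = suc (ℓ (w · transpose a b)) ℕₚ.≟ ℓ w

  root : Sₙ → Root → ℤ × Sₙ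
  root w (a , b) = ⟨ α k , (a , b) ⟩ , w · transpose a b

  F : Sₙ → Sₙ → Root → ℚ
  F w v (a , b) = fromℤ ⟨ α k , (a , b) ⟩ * 𝟙 ((w · transpose a b) ≟ₚ v)

  K : Sₙ → Sₙ → Fin (suc m) → Fin (suc m) → ℚ
  K w v a b = 𝟙 (cover? v a b) * 𝟙 (w ≟ₚ (v · transpose a b))

  list : ∀ w v βs → at (coefficients (List.map (root w) βs)) v ≡ ℚ-Sum.⨁ βs (F w v)
  list w v []             = refl
  list w v ((a , b) ∷ βs) = ≡.trans (coefficients-∷ ⟨ α k , (a , b) ⟩ (w · transpose a b) (List.map (root w) βs) v)
    (cong₂ (λ x y → fromℤ ⟨ α k , (a , b) ⟩ * x + y) (coefficients-[X] (w · transpose a b) v) (list w v βs))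

  fromℤ-- : ∀ a b → fromℤ (a ℤ.- b) ≡ fromℤ a - fromℤ b
  fromℤ-- a b = ≡.trans (fromℤ-+ a (ℤ.- b)) (cong (fromℤ a +_) (fromℤ-neg b))

  fromℤ-α : ∀ i → fromℤ (α k i) ≡ ε k i
  fromℤ-α i = ≡.trans (fromℤ-- (if does (i ≟ inject₁ k) then 1ℤ else 0ℤ) (if does (i ≟ suc k) then 1ℤ else 0ℤ))
    (cong₂ _-_ (𝟙-fromℤ (i ≟ inject₁ k)) (𝟙-fromℤ (i ≟ suc k)))

  exchange : ∀ w v a b → 𝟙 (covered w (a , b)) * 𝟙 ((w · transpose a b) ≟ₚ v) ≡ K w v a b
  exchange w v a b = 𝟙-*-cong (covered w (a , b)) ((w · transpose a b) ≟ₚ v) (cover? v a b) (w ≟ₚ (v · transpose a b))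
    (λ cov eq → let eq′ = ·-transpose-swap {u = v} {w} a b (≈ₚ-sym {u = w · transpose a b} {v} eq) in
      ≡.trans (≡.sym (ℓ-cong w (v · transpose a b) eq′)) (≡.trans (≡.sym cov) (cong suc (ℓ-cong (w · transpose a b) v eq))) , eq′)
    (λ cov eq → let eq′ = ·-transpose-swap {u = w} {v} a b eq in
      ≡.trans (cong suc (≡.sym (ℓ-cong v (w · transpose a b) eq′))) (≡.trans (≡.sym cov) (≡.sym (ℓ-cong w (v · transpose a b) eq)))
      , ≈ₚ-sym {u = v} {w · transpose a b} eq′)

  term : ∀ w v a b → (if does (covered w (a , b)) then F w v (a , b) else 0ℚ) ≡ (ε k a - ε k b) * K w v a b
  term w v a b = ≡.trans (pull (covered w (a , b)) (fromℤ ⟨ α k , (a , b) ⟩) (𝟙 ((w · transpose a b) ≟ₚ v)))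
    (cong₂ _*_ (≡.trans (fromℤ-- (α k a) (α k b)) (cong₂ _-_ (fromℤ-α a) (fromℤ-α b))) (exchange w v a b))
    where
    pull : ∀ {P : Set} (P? : Dec P) x y → (if does P? then x * y else 0ℚ) ≡ x * (𝟙 P? * y)
    pull (yes _) x y = cong (x *_) (≡.sym (ℚₚ.*-identityˡ y))
    pull (no _)  x y = ≡.sym (≡.trans (cong (x *_) (ℚₚ.*-zeroˡ y)) (ℚₚ.*-zeroʳ x))

  K-sym : ∀ w v a b → K w v a b ≡ K w v b a
  K-sym w v a b = cong₂ _*_
    (cong (λ x → 𝟙 (x ℕₚ.≟ suc (ℓ v))) (ℓ-transpose-comm v a b))
    (𝟙-cong (w ≟ₚ (v · transpose a b)) (w ≟ₚ (v · transpose b a))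
      (λ p → ≈ₚ-trans {u = w} {v · transpose a b} {v · transpose b a} p (·-transpose-comm v a b))
      (λ p → ≈ₚ-trans {u = w} {v · transpose b a} {v · transpose a b} p (·-transpose-comm v b a)))

  X-[X] : ∀ w v i → at (X i $ᵒ coefficients [X w ]) v ≡ ∑ λ j → sign i j * K w v i j
  X-[X] w v i = ≡.trans (X-at i (coefficients [X w ]) v) (∑-cong λ j → ≡.trans
    (ℚₚ.*-assoc (sign i j) (𝟙 (cover? v i j)) (at (coefficients [X w ]) (v · transpose i j)))
    (cong (λ x → sign i j * (𝟙 (cover? v i j) * x)) (coefficients-[X] w (v · transpose i j))))

Tᵒ : Fin m → Op (suc m)
Tᵒ k = D k +ᵒ -ᵒ (scalar 1ℚ +ᵒ -ᵒ ((X (inject₁ k) +ᵒ -ᵒ X (suc k)) *ᵒ D k))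

coefficients-T : ∀ (k : Fin m) h → coefficients (T k h) ≐ Tᵒ k $ᵒ coefficients h
coefficients-T {m} k h v = begin
  at (coefficients (T k h)) v
    ≡⟨ coefficients--H (∂ k h) (s* k h) v ⟩
  at (coefficients (∂ k h)) v - at (coefficients (s* k h)) v
    ≡⟨ cong₂ _-_ (coefficients-∂ k h v) (coefficients--H h (c₁ (α k) (∂ k h)) v) ⟩
  at (D k $ᵒ coefficients h) v - (at (coefficients h) v - at (coefficients (c₁ (α k) (∂ k h))) v)
    ≡⟨ cong (λ x → at (D k $ᵒ coefficients h) v - (at (coefficients h) v - x)) (≡.trans
         (coefficients-c₁ k (∂ k h) v)
         ($-cong A (coefficients (∂ k h)) (D k $ᵒ coefficients h) (coefficients-∂ k h) v)) ⟩
  at (D k $ᵒ coefficients h) v - (at (coefficients h) v - at (A $ᵒ D k $ᵒ coefficients h) v)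
    ≡⟨ solve 3 (λ d x y → d :- (x :- y) := d :+ const (- 1ℚ) :* (const 1ℚ :* x :+ const (- 1ℚ) :* y)) refl
         (at (D k $ᵒ coefficients h) v) (at (coefficients h) v) (at (A $ᵒ D k $ᵒ coefficients h) v) ⟩
  at (Tᵒ k $ᵒ coefficients h) v ∎
  where
  open ≡-Reasoning
  A : Op (suc m)
  A = X (inject₁ k) +ᵒ -ᵒ X (suc k)

-- CSM classes

combine : ∀ {k} → (Fin k → ℚ) → (Fin k → Fun n) → Fun n
combine c ξ .at v         = ∑ λ j → c j * at (ξ j) v
combine c ξ .resp u w u≈w = ∑-cong λ j → cong (c j *_) (resp (ξ j) u w u≈w)

$-combine : ∀ {k} (A : Op n) (c : Fin k → ℚ) (ξ : Fin k → Fun n) v →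
            at (A $ᵒ combine c ξ) v ≡ ∑ λ j → c j * at (A $ᵒ ξ j) v
$-combine {k = zero}  A c ξ v = $-zero A (combine c ξ) (λ _ → refl) v
$-combine {k = suc k} A c ξ v = begin
  at (A $ᵒ combine c ξ) v
    ≡⟨ $-cong A (combine c ξ) (c zero *ᶠ ξ zero +ᶠ combine (c ∘ suc) (ξ ∘ suc)) (λ _ → refl) v ⟩
  at (A $ᵒ (c zero *ᶠ ξ zero +ᶠ combine (c ∘ suc) (ξ ∘ suc))) v
    ≡⟨ $-+ A (c zero *ᶠ ξ zero) (combine (c ∘ suc) (ξ ∘ suc)) v ⟩
  at (A $ᵒ (c zero *ᶠ ξ zero)) v + at (A $ᵒ combine (c ∘ suc) (ξ ∘ suc)) v
    ≡⟨ cong₂ _+_ ($-* A (c zero) (ξ zero) v) ($-combine A (c ∘ suc) (ξ ∘ suc) v) ⟩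
  ∑ (λ j → c j * at (A $ᵒ ξ j) v) ∎
  where open ≡-Reasoning

X-Tᵒ : ∀ (k : Fin m) i ξ v →
       at (X i $ᵒ Tᵒ k $ᵒ ξ) v ≡ at (Tᵒ k $ᵒ X (s {suc m} k ⟨$⟩ʳ i) $ᵒ ξ) v + ε k i * at ξ v
X-Tᵒ {m} k i ξ v = begin
  at (X i $ᵒ Tᵒ k $ᵒ ξ) v
    ≡⟨ expand ⟩
  x (D k $ᵒ ξ) + - 1ℚ * (1ℚ * x ξ + - 1ℚ * (at (X i $ᵒ X⁻ $ᵒ D k $ᵒ ξ) v + - 1ℚ * at (X i $ᵒ X⁺ $ᵒ D k $ᵒ ξ) v))
    ≡⟨ cong₂ (λ p q → p + - 1ℚ * (1ℚ * x ξ + - 1ℚ * q)) (X-D k i ξ v)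
         (cong₂ (λ p q → p + - 1ℚ * q) (past (inject₁ k)) (past (suc k))) ⟩
  (d + e * y) + - 1ℚ * (1ℚ * x ξ + - 1ℚ * ((a + e * f (inject₁ k)) + - 1ℚ * (b + e * f (suc k))))
    ≡⟨ cong (λ z → (d + e * y) + - 1ℚ * (1ℚ * z + - 1ℚ * ((a + e * f (inject₁ k)) + - 1ℚ * (b + e * f (suc k)))))
         (≡.trans (solve 2 (λ p q → p := q :+ (p :- q)) refl (f i) (f (t i))) (cong (f (t i) +_) (ε-difference k f i))) ⟩
  (d + e * y) + - 1ℚ * (1ℚ * (f (t i) + e * (f (inject₁ k) - f (suc k))) + - 1ℚ * ((a + e * f (inject₁ k)) + - 1ℚ * (b + e * f (suc k))))
    ≡⟨ collect d e y (f (t i)) a b (f (inject₁ k)) (f (suc k)) ⟩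
  d + - 1ℚ * (1ℚ * f (t i) + - 1ℚ * (a + - 1ℚ * b)) + e * y ∎
  where
  open ≡-Reasoning
  t = s {suc m} k ⟨$⟩ʳ_
  X⁻ X⁺ : Op (suc m)
  X⁻ = X (inject₁ k)
  X⁺ = X (suc k)

  x : Fun (suc m) → ℚ
  x η = at (X i $ᵒ η) v

  f : Fin (suc m) → ℚ
  f j = at (X j $ᵒ ξ) v

  d e y a b : ℚ
  d = at (D k $ᵒ X (t i) $ᵒ ξ) v
  e = ε k i
  y = at ξ v
  a = at (X⁻ $ᵒ D k $ᵒ X (t i) $ᵒ ξ) v
  b = at (X⁺ $ᵒ D k $ᵒ X (t i) $ᵒ ξ) v

  past : ∀ j → at (X i $ᵒ X j $ᵒ D k $ᵒ ξ) v ≡ at (X j $ᵒ D k $ᵒ X (t i) $ᵒ ξ) v + e * f j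
  past j = ≡.trans (X-comm-at v (D k $ᵒ ξ) i j)
    (≡.trans ($-cong (X j) (X i $ᵒ D k $ᵒ ξ) (D k $ᵒ X (t i) $ᵒ ξ +ᶠ e *ᶠ ξ) (X-D k i ξ) v)
    (≡.trans ($-+ (X j) (D k $ᵒ X (t i) $ᵒ ξ) (e *ᶠ ξ) v)
             (cong (at (X j $ᵒ D k $ᵒ X (t i) $ᵒ ξ) v +_) ($-* (X j) e ξ v))))

  expand : at (X i $ᵒ Tᵒ k $ᵒ ξ) v ≡
    x (D k $ᵒ ξ) + - 1ℚ * (1ℚ * x ξ + - 1ℚ * (at (X i $ᵒ X⁻ $ᵒ D k $ᵒ ξ) v + - 1ℚ * at (X i $ᵒ X⁺ $ᵒ D k $ᵒ ξ) v))
  expand = ≡.trans ($-+ (X i) (D k $ᵒ ξ) (- 1ℚ *ᶠ η₁) v) (cong (x (D k $ᵒ ξ) +_)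
    (≡.trans ($-* (X i) (- 1ℚ) η₁ v) (cong (- 1ℚ *_)
    (≡.trans ($-+ (X i) (1ℚ *ᶠ ξ) (- 1ℚ *ᶠ η₂) v) (cong₂ _+_ ($-* (X i) 1ℚ ξ v)
    (≡.trans ($-* (X i) (- 1ℚ) η₂ v) (cong (- 1ℚ *_)
    (≡.trans ($-+ (X i) (X⁻ $ᵒ D k $ᵒ ξ) (- 1ℚ *ᶠ X⁺ $ᵒ D k $ᵒ ξ) v)
      (cong (at (X i $ᵒ X⁻ $ᵒ D k $ᵒ ξ) v +_) ($-* (X i) (- 1ℚ) (X⁺ $ᵒ D k $ᵒ ξ) v))))))))))
    where
    η₂ = X⁻ $ᵒ D k $ᵒ ξ +ᶠ - 1ℚ *ᶠ X⁺ $ᵒ D k $ᵒ ξ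
    η₁ = 1ℚ *ᶠ ξ +ᶠ - 1ℚ *ᶠ η₂

  collect : ∀ d e y z a b g h →
    (d + e * y) + - 1ℚ * (1ℚ * (z + e * (g - h)) + - 1ℚ * ((a + e * g) + - 1ℚ * (b + e * h))) ≡
    d + - 1ℚ * (1ℚ * z + - 1ℚ * (a + - 1ℚ * b)) + e * y
  collect = solve 8 (λ d e y z a b g h → let -1′ = const (- 1ℚ); 1′ = const 1ℚ in
    (d :+ e :* y) :+ -1′ :* (1′ :* (z :+ e :* (g :- h)) :+ -1′ :* ((a :+ e :* g) :+ -1′ :* (b :+ e :* h))) :=
    d :+ -1′ :* (1′ :* z :+ -1′ :* (a :+ -1′ :* b)) :+ e :* y) refl

Tᵒ-identity : ∀ (k : Fin m) ξ → at (Tᵒ k $ᵒ ξ) idₚ ≡ at ξ idₚ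
Tᵒ-identity {m} k ξ = begin
  at (Tᵒ k $ᵒ ξ) idₚ
    ≡⟨ cong₂ (λ p q → p + - 1ℚ * (1ℚ * x + - 1ℚ * q)) (D-identity k ξ)
         (cong₂ (λ p q → p + - 1ℚ * q) (at-identity (inject₁ k) (ε-fst k)) (at-identity (suc k) (ε-snd k))) ⟩
  0ℚ + - 1ℚ * (1ℚ * x + - 1ℚ * (1ℚ * x + - 1ℚ * (- 1ℚ * x)))
    ≡⟨ solve 1 (λ x → let -1′ = const (- 1ℚ); 1′ = const 1ℚ in
         const 0ℚ :+ -1′ :* (1′ :* x :+ -1′ :* (1′ :* x :+ -1′ :* (-1′ :* x))) := x) refl x ⟩
  x ∎
  where
  open ≡-Reasoning
  x = at ξ idₚ

  at-identity : ∀ j {q} → ε k j ≡ q → at (X j $ᵒ D k $ᵒ ξ) idₚ ≡ q * x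
  at-identity j refl = ≡.trans (X-D k j ξ idₚ)
    (≡.trans (cong (_+ ε k j * x) (D-identity k (X (s k ⟨$⟩ʳ j) $ᵒ ξ))) (ℚₚ.+-identityˡ (ε k j * x)))

half-sign : ∀ (k : Fin m) i j →
            ½ * sign i j ≡ ½ * sign (s {suc m} k ⟨$⟩ʳ i) (s {suc m} k ⟨$⟩ʳ j) + τ k i j
half-sign {m} k i j with position k i j
... | ascending  rewrite s-fst k | s-snd k | τ-ascending k | sign-< (inject₁<suc k) | sign-> (inject₁<suc k) = refl
... | descending rewrite s-fst k | s-snd k | τ-descending k | sign-< (inject₁<suc k) | sign-> (inject₁<suc k) = refl
... | unrelated {a} {b} ¬up ¬down = ≡.trans (≡.sym (ℚₚ.+-identityʳ (½ * sign a b)))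
  (cong₂ (λ p q → ½ * p + q) (≡.sym (sign-s-unrelated k ¬up ¬down)) (≡.sym (τ-unrelated k ¬up ¬down)))

module _ {m : ℕ} (c_SM : Permutation′ (suc m) → H (suc m)) (isCSM : IsCSM c_SM) where
  private
    module CSM = IsCSM isCSM

    C : Permutation′ (suc m) → Fun (suc m)
    C w = coefficients (c_SM w)

    C-cong : ∀ u w → u ≈ₚ w → C u ≐ C w
    C-cong u w u≈w v = cong fromℤ (CSM.cong u≈w v)

    C-identity : ∀ w → w ≈ₚ idₚ → C w ≐ coefficients [X idₚ ]
    C-identity w w≈ v = ≡.trans (C-cong w idₚ w≈ v) (cong fromℤ (CSM.identity v))

    C-step : ∀ u w k → u ≈ₚ w · s k → C u ≐ Tᵒ k $ᵒ C w
    C-step u w k u≈ v = ≡.trans (C-cong u (w · s k) u≈ v)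
      (≡.trans (cong fromℤ (≡.sym (CSM.step w k v))) (coefficients-T k (c_SM w) v))

    X-C-Formula : Permutation′ (suc m) → Set
    X-C-Formula w = ∀ i v → at (X i $ᵒ C w) v ≡ ∑ λ j → at (inversionSign i j) w * at (C (w · transpose i j)) v

    X-C-base : ∀ w → w ≈ₚ idₚ → X-C-Formula w
    X-C-base w w≈ i v = ≡.trans
      (≡.trans (X-at i (C w) v) (ℚ-Sum.∑-zero {f = F} λ j → left j (cover? v i j)))
      (≡.sym (ℚ-Sum.∑-zero {f = G} λ j → ≡.trans (cong (_* at (C (w · transpose i j)) v) (right j))
                                                  (ℚₚ.*-zeroˡ (at (C (w · transpose i j)) v))))
      where
      F G : Fin (suc m) → ℚ
      F j = sign i j * 𝟙 (cover? v i j) * at (C w) (v · transpose i j)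
      G j = at (inversionSign i j) w * at (C (w · transpose i j)) v

      left : ∀ j (d : Dec (ℓ (v · transpose i j) ≡ suc (ℓ v))) → sign i j * 𝟙 d * at (C w) (v · transpose i j) ≡ 0ℚ
      left j (no _)    = ≡.trans (cong (_* at (C w) (v · transpose i j)) (ℚₚ.*-zeroʳ (sign i j)))
                                 (ℚₚ.*-zeroˡ (at (C w) (v · transpose i j)))
      left j (yes cov) = ≡.trans (cong (sign i j * 1ℚ *_) (≡.trans (C-identity w w≈ (v · transpose i j))
        (≡.trans (coefficients-[X] idₚ (v · transpose i j)) (𝟙-no (idₚ ≟ₚ (v · transpose i j)) λ eq →
          ℕₚ.0≢1+n (≡.trans (≡.sym (ℓ-identity (v · transpose i j) (≈ₚ-sym {u = idₚ} {v · transpose i j} eq))) cov)))))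
        (ℚₚ.*-zeroʳ (sign i j * 1ℚ))

      right : ∀ j → at (inversionSign i j) w ≡ 0ℚ
      right j = begin
        ½ * (sign i j + sign (w ⟨$⟩ʳ j) (w ⟨$⟩ʳ i))  ≡⟨ cong₂ (λ p q → ½ * (sign i j + sign p q)) (w≈ j) (w≈ i) ⟩
        ½ * (sign i j + sign j i)                    ≡⟨ cong (λ x → ½ * (sign i j + x)) (sign-anti i j) ⟩
        ½ * (sign i j + - sign i j)                  ≡⟨ cong (½ *_) (ℚₚ.+-inverseʳ (sign i j)) ⟩
        0ℚ                                           ∎
        where open ≡-Reasoning

    X-C-step : ∀ w u k → X-C-Formula w → u ≈ₚ w · s k → X-C-Formula u
    X-C-step w u k ih u≈ i v = begin
      at (X i $ᵒ C u) v
        ≡⟨ $-cong (X i) (C u) (Tᵒ k $ᵒ C w) (C-step u w k u≈) v ⟩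
      at (X i $ᵒ Tᵒ k $ᵒ C w) v
        ≡⟨ X-Tᵒ k i (C w) v ⟩
      at (Tᵒ k $ᵒ X (t i) $ᵒ C w) v + ε k i * at (C w) v
        ≡⟨ cong (_+ ε k i * at (C w) v) (≡.trans
             ($-cong (Tᵒ k) (X (t i) $ᵒ C w) (combine (λ j → at (inversionSign (t i) j) w) (λ j → C (w · transpose (t i) j))) (ih (t i)) v)
             ($-combine (Tᵒ k) (λ j → at (inversionSign (t i) j) w) (λ j → C (w · transpose (t i) j)) v)) ⟩
      ∑ G + ε k i * at (C w) v
        ≡⟨ cong₂ _+_ (ℚ-Sum.sum-permute G (s k)) (≡.sym (∑-τ k i (λ i j → at (C (w · s k · transpose i j)) v) (at (C w) v)
             (C-cong (w · s k · transpose (inject₁ k) (suc k)) w (s-involutiveʳ w k) v)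
             (C-cong (w · s k · transpose (suc k) (inject₁ k)) w down v))) ⟩
      ∑ (λ j → G (t j)) + ∑ (λ j → τ k i j * at (C (w · s k · transpose i j)) v)
        ≡⟨ ℚ-Sum.∑-distrib-+ (λ j → G (t j)) (λ j → τ k i j * at (C (w · s k · transpose i j)) v) ⟨
      ∑ (λ j → G (t j) + τ k i j * at (C (w · s k · transpose i j)) v)
        ≡⟨ ∑-cong term ⟩
      ∑ (λ j → at (inversionSign i j) u * at (C (u · transpose i j)) v) ∎
      where
      open ≡-Reasoning
      t = s {suc m} k ⟨$⟩ʳ_

      G : Fin (suc m) → ℚ
      G j = at (inversionSign (t i) j) w * at (Tᵒ k $ᵒ C (w · transpose (t i) j)) v

      down : w · s k · transpose (suc k) (inject₁ k) ≈ₚ w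
      down = ≈ₚ-trans {u = w · s k · transpose (suc k) (inject₁ k)} {w · s k · s k} {w}
        (·-transpose-comm (w · s k) (suc k) (inject₁ k)) (s-involutiveʳ w k)

      term : ∀ j → G (t j) + τ k i j * at (C (w · s k · transpose i j)) v ≡
                   at (inversionSign i j) u * at (C (u · transpose i j)) v
      term j = begin
        at (inversionSign (t i) (t j)) w * at (Tᵒ k $ᵒ C (w · transpose (t i) (t j))) v + τ k i j * y
          ≡⟨ cong (λ x → at (inversionSign (t i) (t j)) w * x + τ k i j * y)
               (C-step (w · s k · transpose i j) (w · transpose (t i) (t j)) k (·-conjugate w (s k) i j) v) ⟨
        at (inversionSign (t i) (t j)) w * y + τ k i j * y
          ≡⟨ regroup (sign (t i) (t j)) (sign (w ⟨$⟩ʳ t j) (w ⟨$⟩ʳ t i)) (τ k i j) y ⟩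
        (½ * sign (t i) (t j) + τ k i j + ½ * sign (w ⟨$⟩ʳ t j) (w ⟨$⟩ʳ t i)) * y
          ≡⟨ cong (λ x → (x + ½ * sign (w ⟨$⟩ʳ t j) (w ⟨$⟩ʳ t i)) * y) (half-sign k i j) ⟨
        (½ * sign i j + ½ * sign (w ⟨$⟩ʳ t j) (w ⟨$⟩ʳ t i)) * y
          ≡⟨ cong (_* y) (ℚₚ.*-distribˡ-+ ½ (sign i j) (sign (w ⟨$⟩ʳ t j) (w ⟨$⟩ʳ t i))) ⟨
        at (inversionSign i j) (w · s k) * y
          ≡⟨ cong₂ _*_ (resp (inversionSign i j) u (w · s k) u≈)
               (C-cong (u · transpose i j) (w · s k · transpose i j) (·-congˡ {u = u} {w · s k} (transpose i j) u≈) v) ⟨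
        at (inversionSign i j) u * at (C (u · transpose i j)) v ∎
        where
        y = at (C (w · s k · transpose i j)) v
        regroup : ∀ a b c y → ½ * (a + b) * y + c * y ≡ (½ * a + c + ½ * b) * y
        regroup = solve 4 (λ a b c y → const ½ :* (a :+ b) :* y :+ c :* y := (const ½ :* a :+ c :+ const ½ :* b) :* y) refl

    -- x_i acts on the CSM classes as the Dunkl element θ_i does.
    X-C : ∀ w → X-C-Formula w
    X-C = generated-by-s X-C-Formula X-C-base X-C-step

    ψ : Op (suc m) → Fun (suc m)
    ψ A .at w         = at (A $ᵒ C w) idₚ
    ψ A .resp u w u≈w = $-cong A (C u) (C w) (C-cong u w u≈w) idₚ

    -- The linear functional η ↦ (A η)(e) varies in the induction: a product
    -- a ⊗ b is handled by applying the hypothesis for b to A a.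
    transfer : ∀ f A w → at (A $ᵒ op f $ᵒ C w) idₚ ≡ at (fk (atDunkl f) $ᵒ ψ A) w
    transfer (gen i) A w = begin
      at (A $ᵒ X i $ᵒ C w) idₚ
        ≡⟨ $-cong A (X i $ᵒ C w) (combine (λ j → at (inversionSign i j) w) (λ j → C (w · transpose i j))) (X-C w i) idₚ ⟩
      at (A $ᵒ combine (λ j → at (inversionSign i j) w) (λ j → C (w · transpose i j))) idₚ
        ≡⟨ $-combine A (λ j → at (inversionSign i j) w) (λ j → C (w · transpose i j)) idₚ ⟩
      ∑ (λ j → at (B i j $ᵒ ψ A) w)
        ≡⟨ fk-θ i (ψ A) w ⟨
      at (fk (θ i) $ᵒ ψ A) w ∎
      where open ≡-Reasoning
    transfer (con q) A w = $-* A q (C w) idₚ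
    transfer (a ⊕ b) A w = ≡.trans ($-+ A (op a $ᵒ C w) (op b $ᵒ C w) idₚ) (cong₂ _+_ (transfer a A w) (transfer b A w))
    transfer (a ⊗ b) A w = ≡.trans (transfer b (A *ᵒ op a) w)
      ($-cong (fk (atDunkl b)) (ψ (A *ᵒ op a)) (fk (atDunkl a) $ᵒ ψ A) (transfer a A) w)
    transfer (⊝ a)   A w = ≡.trans ($-* A (- 1ℚ) (op a $ᵒ C w) idₚ) (cong (- 1ℚ *_) (transfer a A w))

    Euler-characteristic : ∀ w → at (C w) idₚ ≡ 1ℚ
    Euler-characteristic = generated-by-s (λ w → at (C w) idₚ ≡ 1ℚ)
      (λ w w≈ → ≡.trans (C-identity w w≈ idₚ)
        (≡.trans (coefficients-[X] {suc m} idₚ idₚ) (𝟙-yes (idₚ {suc m} ≟ₚ idₚ) λ _ → refl)))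
      (λ w u k ih u≈ → ≡.trans (C-step u w k u≈ idₚ) (≡.trans (Tᵒ-identity k (C w)) ih))

  pairing-nonneg : ∀ f → FKNonnegative (atDunkl f) → ∀ w → 0ℚ ℚ.≤ ⟨ f ∣ C w ⟩
  pairing-nonneg f f≥0 w = subst (0ℚ ℚ.≤_)
    (≡.trans (≡.sym (transfer f (scalar 1ℚ) w)) (ℚₚ.*-identityˡ ⟨ f ∣ C w ⟩))
    (fk-nonneg f≥0 (ψ (scalar 1ℚ))
      (λ u → subst (0ℚ ℚ.≤_) (≡.sym (≡.trans (ℚₚ.*-identityˡ (at (C u) idₚ)) (Euler-characteristic u))) (ℚₚ.nonNegative⁻¹ 1ℚ)) w)

theorem1p1 : (∀ (n : ℕ) → 2 ≤ n → (w : Permutation′ n) (f : Poly n) →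
    IsSchubert w f → FKNonnegative (atDunkl f)) →
    ∀ (n : ℕ) → 2 ≤ n →
    (c_SM : Permutation′ n → H n) → IsCSM c_SM →
    ∀ (w v : Permutation′ n) → 0ℤ ≤ℤ coefficient (c_SM w) v
theorem1p1 nonneg (suc m) 2≤n c_SM isCSM w v =
  let z , z≥0 , top = staircase-detects {m}
      f , schubert , detects = schubert-detects {z = z} top v
  in fromℤ-nonneg (coefficient (c_SM w) v) (subst (0ℚ ℚ.≤_) (≡.sym (detects (coefficients (c_SM w))))
       (*-nonneg z≥0 (pairing-nonneg c_SM isCSM f (nonneg (suc m) 2≤n v f schubert) w)))
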